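{- The Weighted Balanced Connected Subgraph problem (WBCS) on bicolored vertex-weighted trees with $n$ vertices can be solved in $\min\{O(nW^2),\,O(n^{1.585}W)\}$ time, where $W$ is the total weight of the vertices of the tree.
   Context: All graphs are finite, simple and undirected. A graph is bicolored if every vertex is colored blue or red (adjacent vertices may have the same color); $B$ and $R$ denote the sets of blue and red vertices. The Weighted Balanced Connected Subgraph problem (WBCS): the input is a bicolored vertex-weighted graph $G=(B\cup R,E,w)$ with $w:B\cup R\to\mathbb{N}$ (positive integers); the output is a connected induced subgraph $H$ of $G$ with $\sum_{v\in V(H)\cap B}w(v)=\sum_{v\in V(H)\cap R}w(v)$ whose total weight $\sum_{v\in V(H)}w(v)$ is maximum. The empty subgraph (of weight $0$) counts as feasible. Running times are in the standard unit-cost RAM model. -}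

module Defs where

open import Data.Bool.Base using (Bool; if_then_else_)
open import Data.Fin.Base using (Fin; toℕ)
open import Data.Fin.Subset using (Subset; _∈_; _∩_; ∁)
open import Data.List.Base as List using (List; []; _∷_; _++_; _∷ʳ_; length)
import Data.List.Membership.Propositional as ListMembership
open import Data.List.Relation.Unary.All using (All)
open import Data.List.Relation.Unary.AllPairs using (AllPairs)
open import Data.List.Relation.Unary.Linked using (Linked)
open import Data.List.Relation.Unary.Unique.Propositional using (Unique)
open import Data.Maybe.Base using (Maybe; just; nothing; fromMaybe)
open import Data.Nat.Base using (ℕ; suc; _+_; _∸_; _≤_; _<_; NonZero)
open import Data.Nat.Properties using (_≟_; +-0-commutativeMonoid)
open import Data.Product.Base using (_×_; _,_; swap)
open import Data.Sum.Base using (_⊎_)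
open import Data.Vec.Base using (lookup)
open import Relation.Binary.Construct.Closure.ReflexiveTransitive using (Star)
open import Relation.Binary.PropositionalEquality using (_≡_; _≢_)
open import Relation.Nullary using (¬_; does)

open import Algebra.Properties.CommutativeMonoid.Sum +-0-commutativeMonoid using (sum)

------------------------------------------------------------------------
-- Bicolored vertex-weighted graphs

-- Each edge is listed once, in arbitrary order and orientation, so a graph
-- comes together with one of its edge-list presentations.
record BicoloredGraph (n : ℕ) : Set where
  field
    edges      : List (Fin n × Fin n)
    loopless   : All (λ (u , v) → u ≢ v) edges
    noMultiple : AllPairs (λ e f → e ≢ f × e ≢ swap f) edges
    B          : Subset n
    w          : Fin n → ℕ
    w-positive : ∀ v → 0 < w v

  R : Subset n
  R = ∁ B

  Adj : Fin n → Fin n → Set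
  Adj u v = (u , v) ListMembership.∈ edges ⊎ (v , u) ListMembership.∈ edges

  InducedAdj : Subset n → Fin n → Fin n → Set
  InducedAdj S u v = u ∈ S × v ∈ S × Adj u v

  weight : Subset n → ℕ
  weight S = sum (λ v → if lookup S v then w v else 0)

  totalWeight : ℕ
  totalWeight = sum w

  Connected : Set
  Connected = ∀ u v → Star Adj u v

  -- A cycle visits at least three distinct vertices and returns to the first.
  data Cycle : Set where
    cycle : ∀ x y z vs → Unique (x ∷ y ∷ z ∷ vs) →
            Linked Adj ((x ∷ y ∷ z ∷ vs) ∷ʳ x) → Cycle

  record IsTree : Set where
    field
      nonempty  : NonZero n
      connected : Connected
      acyclic   : ¬ Cycle

  -- An induced subgraph is identified with its vertex set.  The empty one is
  -- connected.
  InducesConnected : Subset n → Set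
  InducesConnected S = ∀ {u v} → u ∈ S → v ∈ S → Star (InducedAdj S) u v

  Balanced : Subset n → Set
  Balanced S = weight (S ∩ B) ≡ weight (S ∩ R)

  record IsOptimalWBCS (S : Subset n) : Set where
    field
      connected : InducesConnected S
      balanced  : Balanced S
      maximum   : ∀ T → InducesConnected T → Balanced T → weight T ≤ weight S

------------------------------------------------------------------------
-- Unit-cost RAM

-- A load/store machine with registers and memory cells that hold natural
-- numbers.  There is no multiplication, division or shift: at unit cost on
-- unbounded words these would make the machine unreasonably powerful.
data Instr : Set where
  const     : (r k : ℕ) → Instr      -- r ← k
  add       : (r s t : ℕ) → Instr    -- r ← s + t
  sub       : (r s t : ℕ) → Instr    -- r ← s ∸ t
  load      : (r s : ℕ) → Instr      -- r ← mem[s]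
  store     : (r s : ℕ) → Instr      -- mem[r] ← s
  jump      : (l : ℕ) → Instr
  jumpZero  : (r l : ℕ) → Instr      -- if r = 0 go to l

Program : Set
Program = List Instr

record State : Set where
  constructor state
  field
    pc  : ℕ
    reg : ℕ → ℕ
    mem : ℕ → ℕ

open State public

_at_ : ∀ {A : Set} → List A → ℕ → Maybe A
xs at i = List.head (List.drop i xs)

_[_≔_] : (ℕ → ℕ) → ℕ → ℕ → (ℕ → ℕ)
(f [ i ≔ x ]) j = if does (j ≟ i) then x else f j

exec : Instr → State → State
exec (const r k)    (state p g m) = state (suc p) (g [ r ≔ k ]) m
exec (add r s t)    (state p g m) = state (suc p) (g [ r ≔ g s + g t ]) m
exec (sub r s t)    (state p g m) = state (suc p) (g [ r ≔ g s ∸ g t ]) m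
exec (load r s)     (state p g m) = state (suc p) (g [ r ≔ m (g s) ]) m
exec (store r s)    (state p g m) = state (suc p) g (m [ g r ≔ g s ])
exec (jump l)       (state p g m) = state l g m
exec (jumpZero r l) (state p g m) = state (if does (g r ≟ 0) then l else suc p) g m

-- P ⊢ σ ⇓[ t ] τ : started in σ, P halts in τ after exactly t instructions.
-- The machine halts when the program counter leaves the program.
data _⊢_⇓[_]_ (P : Program) : State → ℕ → State → Set where
  halt : ∀ {σ} → P at pc σ ≡ nothing → P ⊢ σ ⇓[ 0 ] σ
  step : ∀ {σ τ i t} → P at pc σ ≡ just i →
         P ⊢ exec i σ ⇓[ t ] τ → P ⊢ σ ⇓[ suc t ] τ

initial : List ℕ → State
initial xs = state 0 (λ _ → 0) (λ a → fromMaybe 0 (xs at a))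

------------------------------------------------------------------------
-- Input and output conventions

bit : Bool → ℕ
bit b = if b then 1 else 0

-- n, m, w₀ … wₙ₋₁, b₀ … bₙ₋₁, u₁, v₁, …, uₘ, vₘ   (bᵢ = 1 for blue, 0 for red)
encode : ∀ {n} → BicoloredGraph n → List ℕ
encode {n} G =
  n ∷ length edges ∷
    List.tabulate w ++
    List.tabulate (λ v → bit (lookup B v)) ++
    List.concatMap (λ (u , v) → toℕ u ∷ toℕ v ∷ []) edges
  where open BicoloredGraph G

-- The first n memory cells hold the characteristic vector of S.
Outputs : ∀ {n} → State → Subset n → Set
Outputs σ S = ∀ v → mem σ (toℕ v) ≡ bit (lookup S v)

-- For a fixed root the sets that contain every parent of their members are picked from
-- the preorder list of the tree: a vertex is either taken, or skipped together with its
-- descendants.  A dynamic program along the list, from its end, with one cell for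
-- each difference between blue and red weight, finds the heaviest set of every
-- difference in O(ℓ W) steps for a list of length ℓ.  Along the way it sees the
-- best set topped by each vertex whose subtree ends the list.
--
-- To see all tops, grow the tree from one vertex and undo the growth: in reverse
-- order, join the list of every vertex to the list of its parent.  Whichever of the
-- two lists is shorter is processed and put in front; the longer one stays a
-- suffix, so that its tops are still to be seen later.  As in small-to-large
-- merging the lengths of the processed lists add up to at most n (1 + log₂ n), and
-- the total time is O(n (1 + log₂ n) W).  Both bounds follow, since
-- 1 + log₂ n ≤ n ≤ W and (1 + log₂ n)² ≤ 4 n.
module Submission where

open import Defs
open import Data.Nat.Base using (ℕ; _*_; _^_; _≤_)
open import Data.Product.Base using (_×_; ∃-syntax)

open import Data.Bool.Base using (Bool; true; false; if_then_else_; T; not; _∨_; _∧_)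
open import Data.Empty using (⊥; ⊥-elim)
open import Data.Fin using (#_)
open import Data.Fin.Base as Fin using (Fin; toℕ; fromℕ<)
open import Data.Fin.Properties as Fin using (toℕ<n; toℕ-injective; toℕ-fromℕ<)
open import Data.Fin.Subset as Subset using (Subset; _∩_)
import Data.Fin.Subset.Properties as Subset
open import Data.List.Base as List using (List; []; _∷_; _++_; _∷ʳ_; length; drop; head; concatMap; tabulate; applyUpTo)
import Data.List.Membership.DecPropositional as DecMembership
open import Data.List.Membership.Propositional using (_∈_; _∉_)
open import Data.List.Membership.Propositional.Properties using (∈-++⁺ˡ; ∈-++⁺ʳ; ∈-++⁻; ∈-map⁺)
open import Data.List.Properties using (length-++; ++-assoc; drop-drop; ++-identityʳ; length-drop; length-map; length-tabulate; map-++)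
open import Data.List.Relation.Unary.All as All using (All)
open import Data.List.Relation.Unary.AllPairs using (AllPairs; []; _∷_)
open import Data.List.Relation.Unary.Any using (here; there)
open import Data.List.Relation.Unary.Linked using (Linked; [-]; _∷_)
open import Data.List.Relation.Unary.Unique.Propositional using (Unique)
import Data.List.Relation.Unary.Unique.Propositional.Properties as Unique
open import Data.Maybe.Base using (just; nothing; fromMaybe)
open import Data.Nat.Base hiding (ℕ; _*_; _^_; _≤_)
open import Data.Nat.DivMod using (_%_; [m+kn]%n≡m%n; m<n⇒m%n≡m)
open import Data.Nat.Induction using (<-rec)
import Data.Nat.ListAction as ListAction
open import Data.Nat.Logarithm using (⌊log₂_⌋; ⌊log₂⌋-mono-≤; ⌊log₂[2*b]⌋≡1+⌊log₂b⌋; ⌊log₂⌊n/2⌋⌋≡⌊log₂n⌋∸1; ⌊log₂[2^n]⌋≡n)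
open import Data.Nat.Properties
open import Data.Nat.Tactic.RingSolver using (solve-∀)
open import Data.Product.Base using (_,_; proj₁; proj₂; swap)
open import Data.Sum.Base as Sum using (_⊎_; inj₁; inj₂)
open import Data.Unit.Base using (⊤; tt)
open import Data.Vec.Base as Vec using (lookup)
open import Data.Vec.Properties using (lookup-zipWith; lookup-map; lookup∘tabulate; []=⇒lookup; lookup⇒[]=)
open import Function.Base using (id)
open import Relation.Binary.Construct.Closure.ReflexiveTransitive as Star using (Star; ε; _◅_; _◅◅_)
open import Relation.Binary.PropositionalEquality hiding ([_])
open import Relation.Nullary using (¬_; Dec; yes; no; does; _→-dec_; _×-dec_)
open import Relation.Nullary.Decidable using (dec-true; dec-false; decidable-stable)
open import Relation.Unary using (Decidable)

open import Algebra.Properties.CommutativeMonoid.Sum +-0-commutativeMonoid using (sum; sum-cong-≗)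

-- A connected set has a unique top for the fixed root, and within the subtree of its top it is the
-- same thing as a pick containing the top. But a row of the table belongs to a suffix of the list.
-- Unless the subtree of the top is that whole suffix, picks of the row also take vertices from
-- other branches and need not be connected. This is why only tops whose subtree ends the list can
-- be read off, and why the lists must be rearranged. A joint list loses only the tops of its front
-- part, and these have just been seen. A set that first fits into a joint list contains both ends
-- of the new edge, so it is topped by the parent, whose subtree is the entire joint list.
--
-- Only the rows need the economy of the shorter list. Growing the tree by n scans of the edge list
-- and copying both lists at every merge take O(n²) steps, which is harmless because positive
-- weights give n ≤ W. The exponent 317/200 of the statement stands for 1.585; the proof achieves
-- 3/2. The algorithm is written in a small structured language whose compiler is verified with
-- exact instruction counts.

private variable
  n : ℕ

≡ᵇ-refl : ∀ i → (i ≡ᵇ i) ≡ true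
≡ᵇ-refl zero    = refl
≡ᵇ-refl (suc i) = ≡ᵇ-refl i

≢⇒≡ᵇ : ∀ {i j} → i ≢ j → (i ≡ᵇ j) ≡ false
≢⇒≡ᵇ {i} {j} i≢j with i ≡ᵇ j in eq
... | false = refl
... | true  = ⊥-elim (i≢j (≡ᵇ⇒≡ i j (subst T (sym eq) tt)))

≔-same : ∀ (f : ℕ → ℕ) i {x} → (f [ i ≔ x ]) i ≡ x
≔-same f i rewrite ≡ᵇ-refl i = refl

≔-other : ∀ (f : ℕ → ℕ) {i j x} → j ≢ i → (f [ i ≔ x ]) j ≡ f j
≔-other f j≢i rewrite ≢⇒≡ᵇ j≢i = refl

infixl 9 _[_∙_≔_]
_[_∙_≔_] : (ℕ → ℕ → ℕ) → ℕ → ℕ → ℕ → (ℕ → ℕ → ℕ)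
(f [ a ∙ i ≔ x ]) b = if does (b ≟ a) then f b [ i ≔ x ] else f b

-- A structured language over the RAM

record Store : Set where
  constructor mk
  field
    var : ℕ → ℕ
    inp : ℕ → ℕ
    arr : ℕ → ℕ → ℕ

open Store public

-- The array is a literal of the program and never computed, so the arrays that a command writes can
-- be read off its syntax. `input` and `output` address the same region: the answer overwrites the
-- input word.
data Op : Set where
  set        : (r k : ℕ) → Op
  plus minus : (r s t : ℕ) → Op
  get        : (r : ℕ) (a : Fin 16) (s : ℕ) → Op
  put        : (a : Fin 16) (r s : ℕ) → Op
  input      : (r s : ℕ) → Op
  output     : (r s : ℕ) → Op

infixr 4 _⨾_
data Cmd : Set where
  ops    : List Op → Cmd
  _⨾_    : Cmd → Cmd → Cmd
  ifZero : ℕ → Cmd → Cmd → Cmd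
  while  : ℕ → Cmd → Cmd

eval : Op → Store → Store
eval (set r k)     (mk v i m) = (mk (v [ r ≔ k ]) i m)
eval (plus r s t)  (mk v i m) = (mk (v [ r ≔ v s + v t ]) i m)
eval (minus r s t) (mk v i m) = (mk (v [ r ≔ v s ∸ v t ]) i m)
eval (get r a s)   (mk v i m) = (mk (v [ r ≔ m (toℕ a) (v s) ]) i m)
eval (put a r s)   (mk v i m) = (mk v i (m [ toℕ a ∙ v r ≔ v s ]))
eval (input r s)   (mk v i m) = (mk (v [ r ≔ i (v s) ]) i m)
eval (output r s)  (mk v i m) = (mk v (i [ v r ≔ v s ]) m)

evals : List Op → Store → Store
evals []       σ = σ
evals (o ∷ os) σ = evals os (eval o σ)

-- b + 16 i.  Entry i of array a < 16 is kept at address (base + a) i, where base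
-- is the length of the input; register a holds base + a, register 16 is scratch
-- and variable r is register 17 + r.
address : ℕ → ℕ → ℕ
address b i = ((i + i + (i + i)) + (i + i + (i + i)) + ((i + i + (i + i)) + (i + i + (i + i)))) + b

compileOp : Op → List Instr
compileOp (set r k)     = const (17 + r) k ∷ []
compileOp (plus r s t)  = add (17 + r) (17 + s) (17 + t) ∷ []
compileOp (minus r s t) = sub (17 + r) (17 + s) (17 + t) ∷ []
compileOp (get r a s)   =
  -- Four doublings replace a multiplication by 16; register `a` already holds `base + a`.
  add 16 (17 + s) (17 + s) ∷ add 16 16 16 ∷ add 16 16 16 ∷ add 16 16 16 ∷ add 16 16 (toℕ a) ∷ load (17 + r) 16 ∷ []
compileOp (put a r s)   =
  add 16 (17 + r) (17 + r) ∷ add 16 16 16 ∷ add 16 16 16 ∷ add 16 16 16 ∷ add 16 16 (toℕ a) ∷ store 16 (17 + s) ∷ []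
compileOp (input r s)   = load (17 + r) (17 + s) ∷ []
compileOp (output r s)  = store (17 + r) (17 + s) ∷ []

compileOps : List Op → List Instr
compileOps []       = []
compileOps (o ∷ os) = compileOp o ++ compileOps os

size : Cmd → ℕ
size (ops os)       = length (compileOps os)
size (c ⨾ d)        = size c + size d
size (ifZero r c d) = suc (size d + suc (size c))
size (while r c)    = suc (size c + 1)

-- Jumps are absolute, so `p` is the position at which the code will be placed. In `ifZero` the
-- nonzero case comes first, because `jumpZero` falls through to it.
compile : ℕ → Cmd → List Instr
compile p (ops os)       = compileOps os
compile p (c ⨾ d)        = compile p c ++ compile (size c + p) d
compile p (ifZero r c d) =
  jumpZero (17 + r) (suc (size d + suc p)) ∷
  compile (suc p) d ++ jump (size c + suc (size d + suc p)) ∷ compile (suc (size d + suc p)) c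
compile p (while r c)    =
  jumpZero (17 + r) (suc (size c + suc p)) ∷ compile (suc p) c ++ jump p ∷ []

length-compile : ∀ p c → length (compile p c) ≡ size c
length-compile p (ops os) = refl
length-compile p (c ⨾ d) = trans (length-++ (compile p c)) (cong₂ _+_ (length-compile p c) (length-compile _ d))
length-compile p (ifZero r c d) =
  cong suc (trans (length-++ (compile (suc p) d)) (cong₂ _+_ (length-compile _ d) (cong suc (length-compile _ c))))
length-compile p (while r c) = cong suc (trans (length-++ (compile (suc p) c)) (cong (_+ 1) (length-compile _ c)))

module Execution (base : ℕ) where

  -- Only accesses to the input region need a limit, since beyond `base` they would hit the
  -- interleaved arrays. Each array owns a residue class modulo 16 of the remaining addresses and is
  -- unbounded.
  Safe : Op → Store → Set
  Safe (input r s)  σ = var σ s < base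
  Safe (output r s) σ = var σ r < base
  Safe _            σ = ⊤

  Safes : List Op → Store → Set
  Safes []       σ = ⊤
  Safes (o ∷ os) σ = Safe o σ × Safes os (eval o σ)

  infix 3 _∕_⇓[_]_
  -- The costs are exact instruction counts of the compiled code: the additional units are the
  -- `jumpZero` and, in `nonzero` and `loop`, the closing `jump`.
  data _∕_⇓[_]_ : Cmd → Store → ℕ → Store → Set where
    ops   : ∀ {os σ} → Safes os σ → ops os ∕ σ ⇓[ length (compileOps os) ] evals os σ
    _⨾_   : ∀ {c d σ ρ τ t u} → c ∕ σ ⇓[ t ] ρ → d ∕ ρ ⇓[ u ] τ → c ⨾ d ∕ σ ⇓[ t + u ] τ
    zero  : ∀ {r c d σ τ t} → var σ r ≡ 0 → c ∕ σ ⇓[ t ] τ → ifZero r c d ∕ σ ⇓[ suc t ] τ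
    nonzero : ∀ {r c d σ τ t} → var σ r ≢ 0 → d ∕ σ ⇓[ t ] τ → ifZero r c d ∕ σ ⇓[ suc (t + 1) ] τ
    exit  : ∀ {r c σ} → var σ r ≡ 0 → while r c ∕ σ ⇓[ 1 ] σ
    loop  : ∀ {r c σ ρ τ t u} → var σ r ≢ 0 → c ∕ σ ⇓[ t ] ρ → while r c ∕ ρ ⇓[ u ] τ →
            while r c ∕ σ ⇓[ suc (t + suc u) ] τ

  -- Correctness of the compiler

  record Implements (g m : ℕ → ℕ) (σ : Store) : Set where
    field
      vars  : ∀ r → g (17 + r) ≡ var σ r
      bases : ∀ (a : Fin 16) → g (toℕ a) ≡ toℕ a + base
      inps  : ∀ i → i < base → m i ≡ inp σ i
      arrs  : ∀ (a : Fin 16) i → m (address (toℕ a + base) i) ≡ arr σ (toℕ a) i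

  open Implements

  private
    address-16 : ∀ a i → address (a + base) i ≡ (a + i * 16) + base
    address-16 a i = trans (cong (_+ (a + base)) (lemma i)) (lemma′ i a base)
      where
      lemma : ∀ i → (i + i + (i + i)) + (i + i + (i + i)) + ((i + i + (i + i)) + (i + i + (i + i))) ≡ i * 16
      lemma = solve-∀
      lemma′ : ∀ i a b → i * 16 + (a + b) ≡ (a + i * 16) + b
      lemma′ = solve-∀

    remainder : ∀ (a : Fin 16) i → (toℕ a + i * 16) % 16 ≡ toℕ a
    remainder a i = trans ([m+kn]%n≡m%n (toℕ a) i 16) (m<n⇒m%n≡m (toℕ<n a))

  -- After `base` is subtracted, the array is the remainder modulo 16 and the index is the quotient.
  address-injective : ∀ (a b : Fin 16) {i j} → address (toℕ a + base) i ≡ address (toℕ b + base) j →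
                      toℕ a ≡ toℕ b × i ≡ j
  address-injective a b {i} {j} eq = a≡b , *-cancelʳ-≡ i j 16
      (+-cancelˡ-≡ (toℕ a) _ _ (trans eq′ (cong (_+ j * 16) (sym a≡b))))
    where
    eq′ : toℕ a + i * 16 ≡ toℕ b + j * 16
    eq′ = +-cancelʳ-≡ base _ _ (trans (sym (address-16 (toℕ a) i)) (trans eq (address-16 (toℕ b) j)))
    a≡b : toℕ a ≡ toℕ b
    a≡b = trans (sym (remainder a i)) (trans (cong (_% 16) eq′) (remainder b j))

  base≤address : ∀ a i → base ≤ address (a + base) i
  base≤address a i = subst (base ≤_) (sym (address-16 a i)) (m≤n+m base _)

  execs : List Instr → State → State
  execs []       s = s
  execs (i ∷ is) s = execs is (exec i s)

  scratch : ∀ {g m σ x} → Implements g m σ → Implements (g [ 16 ≔ x ]) m σ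
  scratch {g} I = record
    { vars  = vars I
    ; bases = λ a → trans (≔-other g (<⇒≢ (toℕ<n a))) (bases I a)
    ; inps  = inps I
    ; arrs  = arrs I
    }

  assign : ∀ {g m v i A} r {x y} → Implements g m (mk v i A) → x ≡ y →
           Implements (g [ 17 + r ≔ x ]) m (mk (v [ r ≔ y ]) i A)
  assign {g} {m} {v} r {x} I refl = record
    { vars  = vars′
    ; bases = λ a → trans (≔-other g (<⇒≢ (<-≤-trans (toℕ<n a) (m≤n⇒m≤1+n (m≤m+n 16 r))))) (bases I a)
    ; inps  = inps I
    ; arrs  = arrs I
    }
    where
    vars′ : ∀ j → (g [ 17 + r ≔ x ]) (17 + j) ≡ (v [ r ≔ x ]) j
    vars′ j with j ≡ᵇ r
    ... | true  = refl
    ... | false = vars I j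

  put-array : ∀ m A → (∀ (a : Fin 16) i → m (address (toℕ a + base) i) ≡ A (toℕ a) i) → ∀ a b i j x →
              (m [ address (toℕ a + base) i ≔ x ]) (address (toℕ b + base) j) ≡ (A [ toℕ a ∙ i ≔ x ]) (toℕ b) j
  put-array m A eqs a b i j x with toℕ b ≟ toℕ a | j ≟ i
  ... | yes b≡a | yes refl rewrite toℕ-injective b≡a | ≡ᵇ-refl (toℕ a) | ≡ᵇ-refl i = ≔-same m (address (toℕ a + base) i)
  ... | yes b≡a | no j≢ rewrite toℕ-injective b≡a | ≡ᵇ-refl (toℕ a) | ≢⇒≡ᵇ j≢ =
    trans (≔-other m {address (toℕ a + base) i} {x = x} (λ eq → j≢ (proj₂ (address-injective a a {j} {i} eq)))) (eqs a j)
  ... | no b≢a  | _ rewrite ≢⇒≡ᵇ b≢a =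
    trans (≔-other m {address (toℕ a + base) i} {x = x} (λ eq → b≢a (proj₁ (address-injective b a {j} {i} eq)))) (eqs b j)

  implements-op : ∀ o {p g m σ} → Implements g m σ → Safe o σ →
                  let s = execs (compileOp o) (state p g m) in
                  Implements (reg s) (mem s) (eval o σ) × pc s ≡ length (compileOp o) + p
  implements-op (set r k) I _ = assign r I refl , refl
  implements-op (plus r s t) I _ = assign r I (cong₂ _+_ (vars I s) (vars I t)) , refl
  implements-op (minus r s t) I _ = assign r I (cong₂ _∸_ (vars I s) (vars I t)) , refl
  implements-op (get r a s) {m = m} I _ = assign r I₅ (trans (cong m at-address) (arrs I a _)) , refl
    where
    I₄ = scratch (scratch (scratch (scratch I)))
    I₅ = scratch I₄
    at-address = cong₂ address (bases I₄ a) (vars I s)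
  implements-op (put a r s) {g = g} {m} {mk v i A} I _ = record
    { vars  = vars I₅
    ; bases = bases I₅
    ; inps  = λ j j<base → trans (≔-other m (λ j≡ → <⇒≱ j<base
                (subst (base ≤_) (sym (trans j≡ at-address)) (base≤address (toℕ a) (v r))))) (inps I j j<base)
    ; arrs  = arrs′
    } , refl
    where
    I₄ = scratch (scratch (scratch (scratch I)))
    I₅ = scratch I₄
    at-address = cong₂ address (bases I₄ a) (vars I r)
    arrs′ : ∀ b j → (m [ address _ (g (17 + r)) ≔ g (17 + s) ]) (address (toℕ b + base) j) ≡ (A [ toℕ a ∙ v r ≔ v s ]) (toℕ b) j
    arrs′ b j = trans
      (cong₂ (λ k x → (m [ k ≔ x ]) (address (toℕ b + base) j)) at-address (vars I s))
      (put-array m A (arrs I) a b (v r) j (v s))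
  implements-op (input r s) {g = g} {m} {σ} I s<base =
    assign r I (trans (cong m (vars I s)) (inps I _ s<base)) , refl
  implements-op (output r s) {g = g} {m} {mk v i A} I r<base = record
    { vars  = vars I
    ; bases = bases I
    ; inps  = inps′
    ; arrs  = λ a j → trans (≔-other m (λ eq → <⇒≱ r<base (subst (base ≤_) (trans eq (vars I r)) (base≤address (toℕ a) j)))) (arrs I a j)
    } , refl
    where
    inps′ : ∀ j → j < base → (m [ g (17 + r) ≔ g (17 + s) ]) j ≡ (i [ v r ≔ v s ]) j
    inps′ j j<base rewrite vars I r | vars I s with j ≡ᵇ v r
    ... | true  = refl
    ... | false = inps I j j<base

  Straight : Instr → Set
  Straight i = ∀ {p g m} → pc (exec i (state p g m)) ≡ suc p

  data AllStraight : List Instr → Set where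
    []  : AllStraight []
    _∷_ : ∀ {i is} → Straight i → AllStraight is → AllStraight (i ∷ is)

  straight-op : ∀ o → AllStraight (compileOp o)
  straight-op (set r k)     = refl ∷ []
  straight-op (plus r s t)  = refl ∷ []
  straight-op (minus r s t) = refl ∷ []
  straight-op (get r a s)   = refl ∷ refl ∷ refl ∷ refl ∷ refl ∷ refl ∷ []
  straight-op (put a r s)   = refl ∷ refl ∷ refl ∷ refl ∷ refl ∷ refl ∷ []
  straight-op (input r s)   = refl ∷ []
  straight-op (output r s)  = refl ∷ []

  module _ (P : Program) where

    record CodeAt (p : ℕ) (is : List Instr) : Set where
      constructor code
      field
        {rest} : List Instr
        placed : drop p P ≡ is ++ rest

    -- The machine relation only has runs that halt. An initial piece of a run is therefore
    -- represented by its effect on complete runs, and pieces compose as functions.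
    record Leads (s : State) (t : ℕ) (s′ : State) : Set where
      constructor leads
      field
        continue : ∀ {u ρ} → P ⊢ s′ ⇓[ u ] ρ → P ⊢ s ⇓[ t + u ] ρ

    open Leads public

    skip-code : ∀ is {p js} → CodeAt p (is ++ js) → CodeAt (length is + p) js
    skip-code is {p} {js} (code {rest} eq) = code (begin
        drop (length is + p) P           ≡⟨ cong (λ k → drop k P) (+-comm (length is) p) ⟩
        drop (p + length is) P           ≡⟨ drop-drop p (length is) P ⟨
        drop (length is) (drop p P)      ≡⟨ cong (drop (length is)) (trans eq (++-assoc is js rest)) ⟩
        drop (length is) (is ++ js ++ rest) ≡⟨ drop-length is ⟩
        js ++ rest ∎)
      where
      open ≡-Reasoning
      drop-length : ∀ {A : Set} (xs : List A) {ys} → drop (length xs) (xs ++ ys) ≡ ys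
      drop-length []       = refl
      drop-length (x ∷ xs) = drop-length xs

    take-code : ∀ is {p js} → CodeAt p (is ++ js) → CodeAt p is
    take-code is {js = js} (code {rest} eq) = code (trans eq (++-assoc is js rest))

    fetch : ∀ {p i is} → CodeAt p (i ∷ is) → P at p ≡ just i
    fetch (code eq) = cong head eq

    one-step : ∀ {p g m i is} → CodeAt p (i ∷ is) → Leads (state p g m) 1 (exec i (state p g m))
    one-step placed₀ = leads (step (fetch placed₀))

    leads-trans : ∀ {s s′ s″ t u} → Leads s t s′ → Leads s′ u s″ → Leads s (t + u) s″
    leads-trans {s} {t = t} {u} f g =
      leads λ {v} {ρ} run → subst (λ k → P ⊢ s ⇓[ k ] ρ) (sym (+-assoc t u v)) (continue f (continue g run))

    straight : ∀ {is p g m} → AllStraight is → CodeAt p is → Leads (state p g m) (length is) (execs is (state p g m))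
    straight [] placed₀ = leads id
    straight {i ∷ is} {p} {g} {m} (eq ∷ eqs) placed₀ with exec i (state p g m) in eq′ | eq {p} {g} {m}
    ... | state _ g′ m′ | refl =
      leads-trans {t = 1} (one-step placed₀)
        (subst (λ s → Leads s (length is) _) (sym eq′) (straight eqs (skip-code (i ∷ []) placed₀)))

    Simulates : ℕ → State → Store → ℕ → Set
    Simulates p s τ t = ∃[ g ] ∃[ m ] Implements g m τ × Leads s t (state p g m)

    simulate-ops : ∀ os {p g m σ} → Implements g m σ → CodeAt p (compileOps os) → Safes os σ →
                   Simulates (length (compileOps os) + p) (state p g m) (evals os σ) (length (compileOps os))
    simulate-ops [] I placed₀ safe = _ , _ , I , leads id
    simulate-ops (o ∷ os) {p} {g} {m} I placed₀ (safe , safes)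
      with implements-op o {p} I safe
    ... | I′ , pc≡
      with simulate-ops os I′ (skip-code (compileOp o) placed₀) safes
    ... | g″ , m″ , I″ , run₂′ =
      g″ , m″ , I″ ,
      subst₂ (λ n k → Leads (state p g m) n (state k g″ m″))
        (sym (length-++ (compileOp o))) lemma
        (leads-trans {t = length (compileOp o)}
          (straight {g = g} {m} (straight-op o) (take-code (compileOp o) placed₀))
          (subst (λ k → Leads (state k g′ m′) (length (compileOps os)) _) (sym pc≡) run₂′))
      where
      g′ = reg (execs (compileOp o) (state p g m))
      m′ = mem (execs (compileOp o) (state p g m))
      lemma : length (compileOps os) + (length (compileOp o) + p) ≡ length (compileOp o ++ compileOps os) + p
      lemma = trans (sym (+-assoc (length (compileOps os)) _ p))
        (cong (_+ p) (trans (+-comm (length (compileOps os)) _) (sym (length-++ (compileOp o)))))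

    at-zero : ∀ {k x y : ℕ} → k ≡ 0 → (if does (k ≟ 0) then x else y) ≡ x
    at-zero refl = refl

    at-nonzero : ∀ {k x y : ℕ} → k ≢ 0 → (if does (k ≟ 0) then x else y) ≡ y
    at-nonzero {zero}  k≢0 = ⊥-elim (k≢0 refl)
    at-nonzero {suc k} k≢0 = refl

    branch : ∀ {p g m r l k is} → CodeAt p (jumpZero r l ∷ is) → (if does (g r ≟ 0) then l else suc p) ≡ k →
             Leads (state p g m) 1 (state k g m)
    branch placed₀ refl = one-step placed₀

    -- Induction on the run rather than on the command: the further rounds of a loop form a smaller
    -- run of the same command at the same place in the code.
    simulate : ∀ {c σ t τ p g m} → c ∕ σ ⇓[ t ] τ → Implements g m σ → CodeAt p (compile p c) →
               Simulates (size c + p) (state p g m) τ t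
    simulate {ops os} (ops safe) I placed₀ = simulate-ops os I placed₀ safe
    simulate {c ⨾ d} {p = p} {g} {m} (_⨾_ {t = t} {u} run₁ run₂) I placed₀
      with simulate run₁ I (take-code (compile p c) placed₀)
    ... | g′ , m′ , I′ , run₁′
      with simulate run₂ I′ (subst (λ k → CodeAt (k + p) (compile (size c + p) d)) (length-compile p c)
                              (skip-code (compile p c) placed₀))
    ... | g″ , m″ , I″ , run₂′ =
      g″ , m″ , I″ ,
      subst (λ k → Leads (state p g m) (t + u) (state k g″ m″))
        (trans (sym (+-assoc (size d) (size c) p)) (cong (_+ p) (+-comm (size d) (size c))))
        (leads-trans {t = t} run₁′ run₂′)
    simulate {ifZero r c d} {p = p} {g} {m} (zero {t = t} r≡0 run) I placed₀
      with simulate {p = suc (size d + suc p)} run I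
             (subst (λ k → CodeAt k (compile (suc (size d + suc p)) c))
               (trans (cong (λ k → suc k + suc p) (length-compile _ d)) refl)
               (skip-code (jump (size c + suc (size d + suc p)) ∷ [])
                 (skip-code (compile (suc p) d) (skip-code (_ ∷ []) placed₀))))
    ... | g′ , m′ , I′ , run₁′ =
      g′ , m′ , I′ ,
      subst (λ k → Leads (state p g m) (suc t) (state k g′ m′)) (lemma (size c) (size d) p)
        (leads-trans {t = 1}
          (branch placed₀ (at-zero (trans (vars I r) r≡0)))
          run₁′)
      where
      lemma : ∀ c d p → c + suc (d + suc p) ≡ suc (d + suc c) + p
      lemma = solve-∀
    simulate {ifZero r c d} {p = p} {g} {m} (nonzero {t = t} r≢0 run) I placed₀
      with simulate {p = suc p} run I (take-code (compile (suc p) d) (skip-code (_ ∷ []) placed₀))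
    ... | g′ , m′ , I′ , run₁′ =
      g′ , m′ , I′ ,
      subst (λ k → Leads (state p g m) (suc (t + 1)) (state k g′ m′)) (lemma (size c) (size d) p)
        (leads-trans {t = 1}
          (branch placed₀ (at-nonzero (λ eq → r≢0 (trans (sym (vars I r)) eq))))
          (leads-trans {t = t} run₁′
            (one-step (subst (λ k → CodeAt k (jump (size c + suc (size d + suc p)) ∷ compile (suc (size d + suc p)) c))
              (cong (_+ suc p) (length-compile _ d))
              (skip-code (compile (suc p) d) (skip-code (_ ∷ []) placed₀))))))
      where
      lemma : ∀ c d p → c + suc (d + suc p) ≡ suc (d + suc c) + p
      lemma = solve-∀
    simulate {while r c} {p = p} {g} {m} (exit r≡0) I placed₀ =
      g , m , I ,
      branch placed₀ (trans (at-zero (trans (vars I r) r≡0)) (lemma (size c) p))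
      where
      lemma : ∀ c p → suc (c + suc p) ≡ suc (c + 1) + p
      lemma = solve-∀
    simulate {while r c} {p = p} {g} {m} (loop {t = t} r≢0 run₁ run₂) I placed₀
      with simulate {p = suc p} run₁ I (take-code (compile (suc p) c) (skip-code (_ ∷ []) placed₀))
    ... | g′ , m′ , I′ , run₁′
      with simulate run₂ I′ placed₀
    ... | g″ , m″ , I″ , run₂′ =
      g″ , m″ , I″ ,
      leads-trans {t = 1}
        (branch placed₀ (at-nonzero (λ eq → r≢0 (trans (sym (vars I r)) eq))))
        (leads-trans {t = t} run₁′
          (leads-trans {t = 1}
            (one-step (subst (λ k → CodeAt k (jump p ∷ []))
              (cong (_+ suc p) (length-compile _ c))
              (skip-code (compile (suc p) c) (skip-code (_ ∷ []) placed₀))))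
            run₂′))

-- Frames and a total-correctness logic with costs

writesVarOp : Op → ℕ → Bool
writesVarOp (set r k)     x = r ≡ᵇ x
writesVarOp (plus r s t)  x = r ≡ᵇ x
writesVarOp (minus r s t) x = r ≡ᵇ x
writesVarOp (get r a s)   x = r ≡ᵇ x
writesVarOp (put a r s)   x = false
writesVarOp (input r s)   x = r ≡ᵇ x
writesVarOp (output r s)  x = false

writesArrOp : Op → ℕ → Bool
writesArrOp (put a r s) b = b ≡ᵇ toℕ a
writesArrOp _           b = false

writesInpOp : Op → Bool
writesInpOp (output r s) = true
writesInpOp _            = false

writes : (Op → Bool) → Cmd → Bool
writes w (ops os)       = List.foldr (λ o b → w o ∨ b) false os
writes w (c ⨾ d)        = writes w c ∨ writes w d
writes w (ifZero r c d) = writes w c ∨ writes w d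
writes w (while r c)    = writes w c

-- For a concrete command this evaluates to `⊤`, so every frame condition of the program is proved
-- by `tt`.
Untouched : (Op → Bool) → Cmd → Set
Untouched w c = T (not (writes w c))

record Frame (c : Cmd) (σ τ : Store) : Set where
  field
    keep    : ∀ r → Untouched (λ o → writesVarOp o r) c → var τ r ≡ var σ r
    keepArr : ∀ a → Untouched (λ o → writesArrOp o a) c → arr τ a ≡ arr σ a
    keepInp : Untouched writesInpOp c → inp τ ≡ inp σ

open Frame public

frame-refl : ∀ {c σ} → Frame c σ σ
frame-refl = record { keep = λ _ _ → refl ; keepArr = λ _ _ → refl ; keepInp = λ _ → refl }

frame-trans : ∀ {c σ ρ τ} → Frame c σ ρ → Frame c ρ τ → Frame c σ τ
frame-trans f g = record
  { keep    = λ r u → trans (keep g r u) (keep f r u)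
  ; keepArr = λ a u → trans (keepArr g a u) (keepArr f a u)
  ; keepInp = λ u → trans (keepInp g u) (keepInp f u)
  }

private
  not-∨ˡ : ∀ x {y} → T (not (x ∨ y)) → T (not x)
  not-∨ˡ false _ = tt

  not-∨ʳ : ∀ x {y} → T (not (x ∨ y)) → T (not y)
  not-∨ʳ false u = u

  ≔-untouched : ∀ (f : ℕ → ℕ) {r x y} → T (not (r ≡ᵇ x)) → (f [ r ≔ y ]) x ≡ f x
  ≔-untouched f {r} {x} u = ≔-other f λ x≡r → subst (λ b → T (not b)) (trans (cong (r ≡ᵇ_) x≡r) (≡ᵇ-refl r)) u

  put-untouched : ∀ (f : ℕ → ℕ → ℕ) {a b i y} → T (not (b ≡ᵇ a)) → (f [ a ∙ i ≔ y ]) b ≡ f b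
  put-untouched f {a} {b} u with b ≡ᵇ a
  ... | false = refl

frame-op : ∀ o {σ} → (∀ r → T (not (writesVarOp o r)) → var (eval o σ) r ≡ var σ r) ×
                     (∀ a → T (not (writesArrOp o a)) → arr (eval o σ) a ≡ arr σ a) ×
                     (T (not (writesInpOp o)) → inp (eval o σ) ≡ inp σ)
frame-op (set r k)     {mk v i m} = (λ x → ≔-untouched v) , (λ _ _ → refl) , λ _ → refl
frame-op (plus r s t)  {mk v i m} = (λ x → ≔-untouched v) , (λ _ _ → refl) , λ _ → refl
frame-op (minus r s t) {mk v i m} = (λ x → ≔-untouched v) , (λ _ _ → refl) , λ _ → refl
frame-op (get r a s)   {mk v i m} = (λ x → ≔-untouched v) , (λ _ _ → refl) , λ _ → refl
frame-op (put a r s)   {mk v i m} = (λ _ _ → refl) , (λ b → put-untouched m) , λ _ → refl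
frame-op (input r s)   {mk v i m} = (λ x → ≔-untouched v) , (λ _ _ → refl) , λ _ → refl
frame-op (output r s)  {mk v i m} = (λ _ _ → refl) , (λ _ _ → refl) , λ ()

frame-ops : ∀ os {σ} → Frame (ops os) σ (evals os σ)
frame-ops [] = frame-refl
frame-ops (o ∷ os) {σ} with frame-op o {σ} | frame-ops os {eval o σ}
... | kv , ka , ki | f = record
  { keep    = λ r u → trans (keep f r (not-∨ʳ _ u)) (kv r (not-∨ˡ _ u))
  ; keepArr = λ a u → trans (keepArr f a (not-∨ʳ _ u)) (ka a (not-∨ˡ _ u))
  ; keepInp = λ u → trans (keepInp f (not-∨ʳ _ u)) (ki (not-∨ˡ _ u))
  }

module CostLogic (base : ℕ) where

  open Execution base

  private
    weaken-frame : ∀ {c e σ τ} → (∀ w → Untouched w e → Untouched w c) → Frame c σ τ → Frame e σ τ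
    weaken-frame h f = record
      { keep    = λ r u → keep f r (h _ u)
      ; keepArr = λ a u → keepArr f a (h _ u)
      ; keepInp = λ u → keepInp f (h _ u)
      }

  frame : ∀ {c σ t τ} → c ∕ σ ⇓[ t ] τ → Frame c σ τ
  frame (ops {os} _) = frame-ops os
  frame (_⨾_ {c} {d} run₁ run₂) =
    frame-trans (weaken-frame (λ w → not-∨ˡ _) (frame run₁)) (weaken-frame (λ w → not-∨ʳ (writes w c)) (frame run₂))
  frame (zero {c = c} _ run) = weaken-frame (λ w → not-∨ˡ _) (frame run)
  frame (nonzero {c = c} _ run) = weaken-frame (λ w → not-∨ʳ (writes w c)) (frame run)
  frame (exit _) = frame-refl
  frame (loop {c = c} _ run₁ run₂) = frame-trans (weaken-frame (λ w u → u) (frame run₁)) (frame run₂)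

  -- The cost is only bounded from above, so that bounds can be rounded and padded; the final store
  -- is known through `Q` alone.
  record Ensures (c : Cmd) (σ : Store) (b : ℕ) (Q : Store → Set) : Set where
    constructor ensures
    field
      {final} : Store
      {cost}  : ℕ
      run     : c ∕ σ ⇓[ cost ] final
      bound   : cost ≤ b
      post    : Q final

  relax : ∀ {c σ b b′} {Q : Store → Set} → b ≤ b′ → Ensures c σ b Q → Ensures c σ b′ Q
  relax b≤b′ (ensures r t≤b q) = ensures r (≤-trans t≤b b≤b′) q

  -- For closed bounds the implicit premise evaluates to `⊤` and is filled in silently.
  relax! : ∀ {c σ b b′} {Q : Store → Set} {_ : T (b ≤ᵇ b′)} → Ensures c σ b Q → Ensures c σ b′ Q
  relax! {b = b} {b′} {_} {b≤b′} = relax (≤ᵇ⇒≤ b b′ b≤b′)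

  weaken : ∀ {c σ b} {Q R : Store → Set} → (∀ τ → Q τ → R τ) → Ensures c σ b Q → Ensures c σ b R
  weaken f (ensures r t≤b q) = ensures r t≤b (f _ q)

  -- Unlike `weaken` it passes on what `c` cannot have changed, so postconditions need to mention
  -- only what does change.
  framed : ∀ {c σ b} {Q R : Store → Set} → (∀ τ → Frame c σ τ → Q τ → R τ) → Ensures c σ b Q → Ensures c σ b R
  framed f (ensures r t≤b q) = ensures r t≤b (f _ (frame r) q)

  ops-rule : ∀ os {σ} {Q : Store → Set} → Safes os σ → Q (evals os σ) →
             Ensures (ops os) σ (length (compileOps os)) Q
  ops-rule os safe q = ensures (ops safe) ≤-refl q

  ⨾-rule : ∀ {c d σ b b′} {Q : Store → Set} → Ensures c σ b (λ ρ → Ensures d ρ b′ Q) → Ensures (c ⨾ d) σ (b + b′) Q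
  ⨾-rule (ensures r t≤b (ensures r′ t′≤b′ q)) = ensures (r ⨾ r′) (+-mono-≤ t≤b t′≤b′) q

  ifZero-rule : ∀ {r c d σ b} {Q : Store → Set} →
                (var σ r ≡ 0 → Ensures c σ b Q) → (var σ r ≢ 0 → Ensures d σ b Q) →
                Ensures (ifZero r c d) σ (2 + b) Q
  ifZero-rule {r} {σ = σ} {b} f g with var σ r ≟ 0
  ... | yes r≡0 with f r≡0
  ... | ensures run t≤b q = ensures (zero r≡0 run) (s≤s (m≤n⇒m≤1+n t≤b)) q
  ifZero-rule {r} {σ = σ} {b} f g | no r≢0 with g r≢0
  ... | ensures {cost = t} run t≤b q =
    ensures (nonzero r≢0 run) (s≤s (subst (_≤ suc b) (+-comm 1 t) (s≤s t≤b))) q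

  exit-rule : ∀ {r c σ} {Q : Store → Set} → var σ r ≡ 0 → Q σ → Ensures (while r c) σ 1 Q
  exit-rule r≡0 q = ensures (exit r≡0) ≤-refl q

  loop-rule : ∀ {r c σ b b′} {Q : Store → Set} → var σ r ≢ 0 →
              Ensures c σ b (λ ρ → Ensures (while r c) ρ b′ Q) → Ensures (while r c) σ (2 + b + b′) Q
  loop-rule {b = b} {b′} r≢0 (ensures {cost = t} r t≤b (ensures {cost = u} r′ u≤b′ q)) =
    ensures (loop r≢0 r r′)
      (s≤s (subst (t + suc u ≤_) (+-suc b b′) (+-mono-≤ t≤b (s≤s u≤b′)))) q

  -- The loop variable counts the remaining rounds. Every round may use the frame back to the store
  -- `σ₀` at entry, so `I` describes only what the loop modifies. A round pays 2 for the test and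
  -- the jump back; the final 1 is the failing test.
  while-rule : ∀ {r c b σ₀} (I : ℕ → Store → Set) → (∀ k σ → I k σ → var σ r ≡ k) →
               (∀ k σ → Frame c σ₀ σ → I (suc k) σ → Ensures c σ b (I k)) →
               ∀ k → I k σ₀ → Ensures (while r c) σ₀ (k * (2 + b) + 1) (I 0)
  while-rule {r} {c} {b} {σ₀} I counter body k = go k σ₀ frame-refl
    where
    go : ∀ k σ → Frame c σ₀ σ → I k σ → Ensures (while r c) σ (k * (2 + b) + 1) (I 0)
    go zero    σ f inv = exit-rule (counter 0 σ inv) inv
    go (suc k) σ f inv =
      relax (≤-reflexive (sym (+-assoc (2 + b) (k * (2 + b)) 1)))
        (loop-rule (λ r≡0 → 0≢1+n (trans (sym r≡0) (counter (suc k) σ inv)))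
          (framed (λ τ f′ → go k τ (frame-trans f f′)) (body k σ f inv)))

  ops-then : ∀ os {d σ b′} b {Q : Store → Set} {_ : T (length (compileOps os) ≤ᵇ b)} → Safes os σ →
             Ensures d (evals os σ) b′ Q → Ensures (ops os ⨾ d) σ (b + b′) Q
  ops-then os {d} {σ} {b′} b {Q} {le} safe e =
    relax (+-monoˡ-≤ b′ (≤ᵇ⇒≤ (length (compileOps os)) b le)) (⨾-rule (ops-rule os {σ} {λ ρ → Ensures d ρ b′ Q} safe e))

-- Picks of a preorder list

total : (Fin n → ℕ) → List (Fin n) → ℕ
total f []       = 0
total f (v ∷ vs) = f v + total f vs

-- A rooted forest in preorder, every vertex with its number of descendants.
Forest : ℕ → Set
Forest n = List (Fin n × ℕ)

vertices : Forest n → List (Fin n)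
vertices = List.map proj₁

-- The sets closed under parents, where a vertex that is left out takes its
-- descendants along.
data Pick {n} : Forest n → List (Fin n) → Set where
  done : Pick [] []
  skip : ∀ {v d l s} → Pick (drop d l) s → Pick ((v , d) ∷ l) s
  take : ∀ {v d l s} → Pick l s → Pick ((v , d) ∷ l) (v ∷ s)

total-drop : ∀ (f : Fin n → ℕ) k l → total f (vertices (drop k l)) ≤ total f (vertices l)
total-drop f zero    l       = ≤-refl
total-drop f (suc k) []      = ≤-refl
total-drop f (suc k) (e ∷ l) = ≤-trans (total-drop f k l) (m≤n+m _ _)

total-pick : ∀ (f : Fin n → ℕ) {l s} → Pick l s → total f s ≤ total f (vertices l)
total-pick f done = ≤-refl
total-pick f (skip {d = d} {l} pk) = ≤-trans (total-pick f pk) (≤-trans (total-drop f d l) (m≤n+m _ _))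
total-pick f (take pk) = +-monoʳ-≤ _ (total-pick f pk)

-- The dynamic program

rN rM rOne rK rO rF rH rBest rZero rSA rSL rJ rR1 rR2 rX1 rP rQ rW rI rC rS rT rSrc rSk rA rB rX rD : ℕ
rN = 0
rM = 1
rOne = 2
rK = 3
rO = 4
rF = 5
rH = 6
rBest = 7
rZero = 8
rSA = 9
rSL = 10
rJ = 11
rR1 = 12
rR2 = 13
rX1 = 14
rP = 15
rQ = 16
rW = 17
rI = 18
rC = 19
rS = 20
rT = 21
rSrc = 22
rSk = 23
rA = 24
rB = 25
rX = 26
rD = 27

-- Arrays 5 and 6 hold forests.  Array 7 maps a position of the forest to the first
-- of the cells of its row.  A cell consists of 1 + weight (0 if nothing is
-- feasible), a pointer to the cell with the rest of the set, and 1 + vertex (0 for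
-- the empty set).  Cells are never overwritten, so rows can share sets.
aVertex aDesc aRow aWeight aNext aNode aBlue aRed : Fin 16
aVertex = # 5
aDesc   = # 6
aRow    = # 7
aWeight = # 8
aNext   = # 9
aNode   = # 10
aBlue   = # 11
aRed    = # 12

Memory : Set
Memory = ℕ → ℕ → ℕ

weightAt nextAt nodeAt : Memory → ℕ → ℕ
weightAt A = A 8
nextAt A   = A 9
nodeAt A   = A 10

-- Here `f` is the first free cell. Cells below it are final, so a later memory always extends an
-- earlier one.
record Agree (f : ℕ) (A B : Memory) : Set where
  field
    weight≡ : ∀ {e} → e < f → weightAt B e ≡ weightAt A e
    next≡   : ∀ {e} → e < f → nextAt B e ≡ nextAt A e
    node≡   : ∀ {e} → e < f → nodeAt B e ≡ nodeAt A e

open Agree public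

agree-refl : ∀ {f A} → Agree f A A
agree-refl = record { weight≡ = λ _ → refl ; next≡ = λ _ → refl ; node≡ = λ _ → refl }

agree-trans : ∀ {f g A C B} → f ≤ g → Agree f A C → Agree g C B → Agree f A B
agree-trans f≤g a b = record
  { weight≡ = λ e< → trans (weight≡ b (<-≤-trans e< f≤g)) (weight≡ a e<)
  ; next≡   = λ e< → trans (next≡ b (<-≤-trans e< f≤g)) (next≡ a e<)
  ; node≡   = λ e< → trans (node≡ b (<-≤-trans e< f≤g)) (node≡ a e<)
  }

-- Every cell on the way lies below `f`; this lets a chain survive all later writes.
data Chain (A : Memory) (f : ℕ) {n} : ℕ → List (Fin n) → Set where
  []   : ∀ {e} → e < f → nodeAt A e ≡ 0 → Chain A f e []
  node : ∀ {e v s} → e < f → nodeAt A e ≡ suc (toℕ v) → Chain A f (nextAt A e) s → Chain A f e (v ∷ s)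

chain-mono : ∀ {A B f g e} {s : List (Fin n)} → Agree f A B → f ≤ g → Chain A f e s → Chain B g e s
chain-mono a f≤g ([] e< eq) = [] (<-≤-trans e< f≤g) (trans (node≡ a e<) eq)
chain-mono {B = B} {g = g} a f≤g (node e< eq c) =
  node (<-≤-trans e< f≤g) (trans (node≡ a e<) eq)
    (subst (λ k → Chain B g k _) (sym (next≡ a e<)) (chain-mono a f≤g c))

chain-copy : ∀ {A f e e′} {s : List (Fin n)} → e′ < f → nodeAt A e′ ≡ nodeAt A e → nextAt A e′ ≡ nextAt A e →
             Chain A f e s → Chain A f e′ s
chain-copy e′< eq eq′ ([] _ z) = [] e′< (trans eq z)
chain-copy {A = A} {f} e′< eq eq′ (node _ z c) = node e′< (trans eq z) (subst (λ k → Chain A f k _) (sym eq′) c)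

-- Rows of the table: optima for every difference of the colours

module Rows (p q : Fin n → ℕ) (W : ℕ) where

  w : Fin n → ℕ
  w v = p v + q v

  -- Differences between -W and W occupy the indices 1 to 2 W + 1. The margins 0 and K = 2 W + 2 are
  -- there to catch truncated arithmetic.
  O K : ℕ
  O = suc W
  K = O + O

  weigh : List (Fin n) → ℕ
  weigh = total w

  weigh-+ : ∀ s → weigh s ≡ total p s + total q s
  weigh-+ [] = refl
  weigh-+ (v ∷ s) rewrite weigh-+ s = lemma (p v) (q v) (total p s) (total q s)
    where
    lemma : ∀ a b c d → (a + b) + (c + d) ≡ (a + c) + (b + d)
    lemma = solve-∀

  -- i − O is the excess of blue over red weight.
  Candidate : Forest n → ℕ → List (Fin n) → Set
  Candidate l i s = Pick l s × O + total p s ≡ i + total q s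

  -- The optimum is described without being named: a positive value is attained by the chain of the
  -- cell, and every candidate weighs strictly less than the value. In particular 0 excludes
  -- candidates.
  record Cell (A : Memory) (f e : ℕ) (l : Forest n) (i : ℕ) : Set where
    field
      e<f      : e < f
      sound    : ∀ {k} → weightAt A e ≡ suc k → ∃[ s ] Candidate l i s × k ≡ weigh s × Chain A f e s
      complete : ∀ {s} → Candidate l i s → weigh s < weightAt A e

  open Cell public

  cell-mono : ∀ {A B f g e l i} → Agree f A B → f ≤ g → Cell A f e l i → Cell B g e l i
  cell-mono a f≤g c = record
    { e<f = <-≤-trans (e<f c) f≤g
    ; sound = λ eq → let s , cd , k≡ , ch = sound c (trans (sym (weight≡ a (e<f c))) eq)
                     in s , cd , k≡ , chain-mono a f≤g ch
    ; complete = λ cd → subst (_ <_) (sym (weight≡ a (e<f c))) (complete c cd)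
    }

  Row : Memory → ℕ → ℕ → Forest n → Set
  Row A f a l = ∀ i → i ≤ K → Cell A f (a + i) l i

  row-mono : ∀ {A B f g a l} → Agree f A B → f ≤ g → Row A f a l → Row B g a l
  row-mono a f≤g r i i≤K = cell-mono a f≤g (r i i≤K)

  -- Both truncations lead to the infeasible indices 0 and K.
  shift : ℕ → ℕ → ℕ → ℕ
  shift a b i = K ∸ ((K ∸ (i ∸ a)) ∸ b)

  shift≤K : ∀ a b i → shift a b i ≤ K
  shift≤K a b i = m∸n≤m K ((K ∸ (i ∸ a)) ∸ b)

  module _ {a b x y i : ℕ} (i≤K : i ≤ K) (ax≤W : a + x ≤ W) (by≤W : b + y ≤ W) where

    -- Truncation contradicts the assumed equation. If `i ∸ a` is cut off, the index is `b`, and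
    -- `O + x` would equal `b + y ≤ W < O`. If the index is cut off at `K`, then `x` would be at
    -- least `O`.
    shift-sound : O + x ≡ shift a b i + y → O + (a + x) ≡ i + (b + y)
    shift-sound eq with a ≤? i
    ... | no a≰i = ⊥-elim (<⇒≱ (s≤s (≤-trans by≤W (m≤m+n W x))) (≤-reflexive (begin
        O + x           ≡⟨ eq ⟩
        shift a b i + y ≡⟨ cong (λ k → K ∸ ((K ∸ k) ∸ b) + y) (m≤n⇒m∸n≡0 (≰⇒≥ a≰i)) ⟩
        K ∸ (K ∸ b) + y ≡⟨ cong (_+ y) (m∸[m∸n]≡n (≤-trans (m≤m+n b y) (≤-trans by≤W (≤-trans (n≤1+n W) (m≤m+n O O))))) ⟩
        b + y ∎)))
      where open ≡-Reasoning
    ... | yes a≤i with b ≤? K ∸ (i ∸ a)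
    ... | no b≰ = ⊥-elim (<⇒≱ (s≤s (≤-trans (m≤n+m x a) (≤-trans ax≤W (m≤m+n W y)))) (+-cancelˡ-≤ O _ _ (≤-reflexive (begin
        O + (O + y)     ≡⟨ +-assoc O O y ⟨
        K + y           ≡⟨ cong (λ k → K ∸ k + y) (m≤n⇒m∸n≡0 (≰⇒≥ b≰)) ⟨
        shift a b i + y ≡⟨ eq ⟨
        O + x ∎))))
      where open ≡-Reasoning
    ... | yes b≤ = begin
        O + (a + x)           ≡⟨ lemma O a x ⟩
        a + (O + x)           ≡⟨ cong (a +_) eq ⟩
        a + (shift a b i + y) ≡⟨ cong (λ k → a + (k + y)) shift≡ ⟩
        a + ((i ∸ a + b) + y) ≡⟨ lemma′ a (i ∸ a) b y ⟩
        (a + (i ∸ a)) + (b + y) ≡⟨ cong (_+ (b + y)) (m+[n∸m]≡n a≤i) ⟩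
        i + (b + y) ∎
      where
      open ≡-Reasoning
      lemma : ∀ o a x → o + (a + x) ≡ a + (o + x)
      lemma = solve-∀
      lemma′ : ∀ a c b y → a + ((c + b) + y) ≡ (a + c) + (b + y)
      lemma′ = solve-∀
      shift≡ : shift a b i ≡ i ∸ a + b
      shift≡ = +-cancelʳ-≡ (K ∸ (i ∸ a) ∸ b) _ _ (begin
        shift a b i + (K ∸ (i ∸ a) ∸ b) ≡⟨ m∸n+n≡m (≤-trans (m∸n≤m _ b) (m∸n≤m K (i ∸ a))) ⟩
        K                               ≡⟨ m+[n∸m]≡n (≤-trans (m∸n≤m i a) i≤K) ⟨
        (i ∸ a) + (K ∸ (i ∸ a))         ≡⟨ cong ((i ∸ a) +_) (m+[n∸m]≡n b≤) ⟨
        (i ∸ a) + (b + (K ∸ (i ∸ a) ∸ b)) ≡⟨ +-assoc (i ∸ a) b _ ⟨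
        i ∸ a + b + (K ∸ (i ∸ a) ∸ b) ∎)

    -- For a set that exists nothing is cut off: the equation and the bounds by `W` give `a ≤ i` and
    -- `i ∸ a + b ≤ K`.
    shift-complete : O + (a + x) ≡ i + (b + y) → O + x ≡ shift a b i + y
    shift-complete eq = +-cancelˡ-≡ a _ _ (begin
        a + (O + x)           ≡⟨ lemma O a x ⟩
        O + (a + x)           ≡⟨ eq ⟩
        i + (b + y)           ≡⟨ cong (_+ (b + y)) (m+[n∸m]≡n a≤i) ⟨
        (a + (i ∸ a)) + (b + y) ≡⟨ lemma′ a (i ∸ a) b y ⟩
        a + ((i ∸ a + b) + y) ≡⟨ cong (λ k → a + (k + y)) shift≡ ⟨
        a + (shift a b i + y) ∎)
      where
      open ≡-Reasoning
      lemma : ∀ o a x → a + (o + x) ≡ o + (a + x)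
      lemma = solve-∀
      lemma′ : ∀ a c b y → (a + c) + (b + y) ≡ a + ((c + b) + y)
      lemma′ = solve-∀
      a≤i : a ≤ i
      a≤i = +-cancelʳ-≤ (b + y) a i (≤-trans (+-monoʳ-≤ a (≤-trans by≤W (n≤1+n W)))
              (≤-trans (≤-trans (≤-reflexive (+-comm a O)) (+-monoʳ-≤ O (m≤m+n a x))) (≤-reflexive eq)))
      i∸a+b≤K : i ∸ a + b ≤ K
      i∸a+b≤K = +-cancelˡ-≤ a _ _ (≤-trans (≤-reflexive (trans (sym (+-assoc a _ b)) (cong (_+ b) (m+[n∸m]≡n a≤i))))
        (+-cancelʳ-≤ y _ _ (≤-trans (≤-reflexive (trans (+-assoc i b y) (sym eq)))
          (≤-trans (≤-reflexive (sym (lemma O a x))) (≤-trans (+-monoʳ-≤ a (+-monoʳ-≤ O (≤-trans (m≤n+m x a) (≤-trans ax≤W (n≤1+n W)))))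
            (m≤m+n (a + K) y))))))
      shift≡ : shift a b i ≡ i ∸ a + b
      shift≡ = trans (cong (K ∸_) (∸-+-assoc K (i ∸ a) b)) (m∸[m∸n]≡n i∸a+b≤K)

  module _ {v : Fin n} {d : ℕ} {l : Forest n} {i : ℕ} (i≤K : i ≤ K)
           (light : weigh (vertices ((v , d) ∷ l)) ≤ W) where

    private
      j : ℕ
      j = shift (p v) (q v) i

      bounds : ∀ {s} → Pick l s → p v + total p s ≤ W × q v + total q s ≤ W
      bounds {s} pk = ≤-trans (m≤m+n _ _) both , ≤-trans (m≤n+m _ (p v + total p s)) both
        where
        both : (p v + total p s) + (q v + total q s) ≤ W
        both = ≤-trans (≤-reflexive (sym (weigh-+ (v ∷ s)))) (≤-trans (+-monoʳ-≤ (w v) (total-pick w pk)) light)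

      taken : ∀ {s} → Candidate l j s → Candidate ((v , d) ∷ l) i (v ∷ s)
      taken (pk , eq) = take pk , shift-sound {a = p v} {q v} i≤K (proj₁ (bounds pk)) (proj₂ (bounds pk)) eq

      untaken : ∀ {s} → Pick l s → O + (p v + total p s) ≡ i + (q v + total q s) → Candidate l j s
      untaken pk eq = pk , shift-complete {a = p v} {q v} i≤K (proj₁ (bounds pk)) (proj₂ (bounds pk)) eq

    -- The cell `e` leaves `v` out and `e′` takes it. The comparison is required only if `e′` is
    -- nonzero: 0 means that taking `v` is impossible, and adding `w v` to it would simulate a set
    -- that does not exist.
    copied-cell : ∀ {A B f e e′} → Cell A f e (drop d l) i → Cell A f e′ l j → Agree f A B →
                  (weightAt A e′ ≢ 0 → weightAt A e′ + w v ≤ weightAt A e) →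
                  weightAt B f ≡ weightAt A e → nextAt B f ≡ nextAt A e → nodeAt B f ≡ nodeAt A e →
                  Cell B (suc f) f ((v , d) ∷ l) i
    copied-cell {A} {B} {f} {e} {e′} cₛ cₜ a worse eq₁ eq₂ eq₃ = record
      { e<f = ≤-refl
      ; sound = λ eq → let s , (pk , bal) , k≡ , ch = sound cₛ (trans (sym eq₁) eq) in
          s , (skip pk , bal) , k≡ ,
          chain-copy ≤-refl (trans eq₃ (sym (node≡ a (e<f cₛ)))) (trans eq₂ (sym (next≡ a (e<f cₛ))))
            (chain-mono a (n≤1+n f) ch)
      ; complete = best
      }
      where
      best : ∀ {s} → Candidate ((v , d) ∷ l) i s → weigh s < weightAt B f
      best (skip pk , bal) = subst (_ <_) (sym eq₁) (complete cₛ (pk , bal))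
      best {v ∷ s} (take pk , bal) = subst (_ <_) (sym eq₁) (begin-strict
          w v + weigh s         ≡⟨ +-comm (w v) _ ⟩
          weigh s + w v         <⟨ +-monoˡ-< (w v) below ⟩
          weightAt A e′ + w v   ≤⟨ worse (λ z → n≮0 (subst (_ <_) z below)) ⟩
          weightAt A e          ∎)
        where
        open ≤-Reasoning
        below = complete cₜ (untaken pk bal)

    -- The 1 stored on top of the weight is carried along by the addition, so the sum is again 1
    -- plus the weight of the enlarged set. That `e′` is nonzero provides the set to enlarge.
    taken-cell : ∀ {A B f e e′} → Cell A f e (drop d l) i → Cell A f e′ l j → Agree f A B →
                 weightAt A e′ ≢ 0 → weightAt A e ≤ weightAt A e′ + w v →
                 weightAt B f ≡ weightAt A e′ + w v → nextAt B f ≡ e′ → nodeAt B f ≡ suc (toℕ v) →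
                 Cell B (suc f) f ((v , d) ∷ l) i
    taken-cell {A} {B} {f} {e} {e′} cₛ cₜ a a≢0 better eq₁ eq₂ eq₃ = record
      { e<f = ≤-refl
      ; sound = found
      ; complete = best
      }
      where
      best : ∀ {s} → Candidate ((v , d) ∷ l) i s → weigh s < weightAt B f
      best (skip pk , bal) = subst (_ <_) (sym eq₁) (<-≤-trans (complete cₛ (pk , bal)) better)
      best {v ∷ s} (take pk , bal) = subst (_ <_) (sym eq₁)
        (subst (_< weightAt A e′ + w v) (+-comm (weigh s) (w v)) (+-monoˡ-< (w v) (complete cₜ (untaken pk bal))))
      found : ∀ {k} → weightAt B f ≡ suc k → ∃[ s ] Candidate ((v , d) ∷ l) i s × k ≡ weigh s × Chain B (suc f) f s
      found eq with weightAt A e′ in eq₀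
      ... | zero  = ⊥-elim (a≢0 refl)
      ... | suc k with sound cₜ eq₀
      ... | s , cd , k≡ , ch =
        v ∷ s , taken cd ,
        trans (suc-injective (trans (sym eq) eq₁)) (trans (cong (_+ w v) k≡) (+-comm (weigh s) (w v))) ,
        node ≤-refl eq₃ (subst (λ k → Chain B (suc f) k s) (sym eq₂) (chain-mono a (n≤1+n f) ch))

-- Filling a row

copyCellOps takeCellOps : List Op
copyCellOps = put aWeight rF rB ∷ get rT aNext rSk ∷ put aNext rF rT ∷ get rT aNode rSk ∷ put aNode rF rT
  ∷ plus rI rI rOne ∷ plus rF rF rOne ∷ minus rC rC rOne ∷ []
takeCellOps = put aWeight rF rA ∷ put aNext rF rSrc ∷ put aNode rF rX1
  ∷ plus rI rI rOne ∷ plus rF rF rOne ∷ minus rC rC rOne ∷ []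

copyCell takeCell fillCell : Cmd
copyCell = ops copyCellOps
takeCell = ops takeCellOps
fillCell =
  -- The four subtractions compute `shift`. `rSrc` is the cell for taking the vertex, in the row of
  -- the list right behind it; `rSk` is the cell for leaving it out, in the row of the list behind
  -- its subtree.
  ops ( minus rT rI rP ∷ minus rT rK rT ∷ minus rT rT rQ ∷ minus rT rK rT ∷ plus rSrc rR1 rT ∷ plus rSk rR2 rI
      ∷ get rA aWeight rSrc ∷ get rB aWeight rSk ∷ [])
  ⨾ ifZero rA copyCell (ops (plus rA rA rW ∷ minus rT rA rB ∷ []) ⨾ ifZero rT copyCell takeCell)

module FillCell (base : ℕ) (p q : Fin n → ℕ) (W : ℕ) where

  open Execution base
  open CostLogic base
  open Rows p q W

  Filled : Memory → ℕ → ℕ → ℕ → Forest n → Store → Set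
  Filled A f i c l τ = Agree f A (arr τ) × var τ rI ≡ suc i × var τ rF ≡ suc f × var τ rC ≡ c ×
                       Cell (arr τ) (suc f) f l i

  agree-put : ∀ {A B f x y z} →
              weightAt B ≡ weightAt A [ f ≔ x ] → nextAt B ≡ nextAt A [ f ≔ y ] → nodeAt B ≡ nodeAt A [ f ≔ z ] →
              Agree f A B
  agree-put {A} {B} {f} eq₁ eq₂ eq₃ = record
    { weight≡ = λ e< → trans (cong (λ g → g _) eq₁) (≔-other (weightAt A) (<⇒≢ e<))
    ; next≡   = λ e< → trans (cong (λ g → g _) eq₂) (≔-other (nextAt A) (<⇒≢ e<))
    ; node≡   = λ e< → trans (cong (λ g → g _) eq₃) (≔-other (nodeAt A) (<⇒≢ e<))
    }

  module _ {v d l i} (i≤K : i ≤ K) (light : weigh (vertices ((v , d) ∷ l)) ≤ W) where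

    copyCell-correct : ∀ {A f e e′ c} ρ → arr ρ ≡ A → var ρ rF ≡ f → var ρ rI ≡ i → var ρ rC ≡ suc c → var ρ rOne ≡ 1 →
      var ρ rSk ≡ e → var ρ rB ≡ weightAt A e →
      Cell A f e (drop d l) i → Cell A f e′ l (shift (p v) (q v) i) →
      (weightAt A e′ ≢ 0 → weightAt A e′ + w v ≤ weightAt A e) →
      Ensures copyCell ρ 40 (Filled A f i c ((v , d) ∷ l))
    copyCell-correct {c = c} ρ refl refl refl c≡ one≡ refl b≡ cₛ cₜ worse =
      relax! (ops-rule _ _
        ( agree , trans (cong (var ρ rI +_) one≡) (+-comm _ 1) , trans (cong (var ρ rF +_) one≡) (+-comm _ 1)
        , cong₂ _∸_ c≡ one≡
        , copied-cell i≤K light cₛ cₜ agree worse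
            (trans (≔-same (weightAt (arr ρ)) (var ρ rF)) b≡)
            (≔-same (nextAt (arr ρ)) (var ρ rF)) (≔-same (nodeAt (arr ρ)) (var ρ rF))))
      where
      agree : Agree (var ρ rF) (arr ρ) (arr (evals copyCellOps ρ))
      agree = agree-put refl refl refl

    takeCell-correct : ∀ {A f e e′ c} ρ → arr ρ ≡ A → var ρ rF ≡ f → var ρ rI ≡ i → var ρ rC ≡ suc c → var ρ rOne ≡ 1 →
      var ρ rA ≡ weightAt A e′ + w v → var ρ rSrc ≡ e′ → var ρ rX1 ≡ suc (toℕ v) →
      Cell A f e (drop d l) i → Cell A f e′ l (shift (p v) (q v) i) →
      weightAt A e′ ≢ 0 → weightAt A e ≤ weightAt A e′ + w v →
      Ensures takeCell ρ 40 (Filled A f i c ((v , d) ∷ l))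
    takeCell-correct {c = c} ρ refl refl refl c≡ one≡ a≡ src≡ x≡ cₛ cₜ a≢0 better =
      relax! (ops-rule _ _
        ( agree , trans (cong (var ρ rI +_) one≡) (+-comm _ 1) , trans (cong (var ρ rF +_) one≡) (+-comm _ 1)
        , cong₂ _∸_ c≡ one≡
        , taken-cell i≤K light cₛ cₜ agree a≢0 better
            (trans (≔-same (weightAt (arr ρ)) (var ρ rF)) a≡)
            (trans (≔-same (nextAt (arr ρ)) (var ρ rF)) src≡)
            (trans (≔-same (nodeAt (arr ρ)) (var ρ rF)) x≡)))
      where
      agree : Agree (var ρ rF) (arr ρ) (arr (evals takeCellOps ρ))
      agree = agree-put refl refl refl

  fillCell-correct : ∀ {v d l f i c a b} σ → i ≤ K → weigh (vertices ((v , d) ∷ l)) ≤ W →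
    var σ rF ≡ f → var σ rI ≡ i → var σ rC ≡ suc c → var σ rOne ≡ 1 →
    var σ rK ≡ K → var σ rP ≡ p v → var σ rQ ≡ q v → var σ rW ≡ w v → var σ rX1 ≡ suc (toℕ v) →
    var σ rR1 ≡ a → var σ rR2 ≡ b → Row (arr σ) f a l → Row (arr σ) f b (drop d l) →
    Ensures fillCell σ 100 (Filled (arr σ) f i c ((v , d) ∷ l))
  fillCell-correct {v} {d} {l} {f} {i} {c} {a} {b} σ i≤K light f≡ i≡ c≡ one≡ K≡ p≡ q≡ w≡ x≡ a≡ b≡ row₁ row₂ =
    relax! (⨾-rule (ops-rule _ _ (ifZero-rule
      -- Both branches of a test share one bound, so the shorter one is padded.
      (λ a≡0 → relax {b′ = 60} (≤ᵇ⇒≤ 40 60 tt)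
        (copyCell-correct i≤K light _ refl f≡ i≡ c≡ one≡ sk≡ (cong (weightAt (arr σ)) sk≡) cell₂ cell₁
          (λ a≢0 → ⊥-elim (a≢0 (trans (cong (weightAt (arr σ)) (sym src≡)) a≡0)))))
      (λ a≢0 → relax! (⨾-rule (ops-rule _ _ (ifZero-rule
        (λ t≡0 → copyCell-correct i≤K light _ refl f≡ i≡ c≡ one≡ sk≡ (cong (weightAt (arr σ)) sk≡) cell₂ cell₁
          (λ _ → subst₂ _≤_ sum≡ (cong (weightAt (arr σ)) sk≡) (m∸n≡0⇒m≤n t≡0)))
        (λ t≢0 → takeCell-correct i≤K light _ refl f≡ i≡ c≡ one≡ sum≡ src≡ x≡ cell₂ cell₁
          (λ z → a≢0 (trans (cong (weightAt (arr σ)) src≡) z))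
          (subst₂ _≤_ (cong (weightAt (arr σ)) sk≡) sum≡ (<⇒≤ (≰⇒> λ le → t≢0 (m≤n⇒m∸n≡0 le))))))))))))
    where
    cell₁ = row₁ (shift (p v) (q v) i) (shift≤K (p v) (q v) i)
    cell₂ = row₂ i i≤K
    src≡ : var σ rR1 + (var σ rK ∸ ((var σ rK ∸ (var σ rI ∸ var σ rP)) ∸ var σ rQ)) ≡ a + shift (p v) (q v) i
    src≡ rewrite K≡ | p≡ | q≡ | i≡ | a≡ = refl
    sk≡ : var σ rR2 + var σ rI ≡ b + i
    sk≡ = cong₂ _+_ b≡ i≡
    sum≡ : weightAt (arr σ) (var σ rR1 + (var σ rK ∸ ((var σ rK ∸ (var σ rI ∸ var σ rP)) ∸ var σ rQ))) + var σ rW ≡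
           weightAt (arr σ) (a + shift (p v) (q v) i) + w v
    sum≡ = cong₂ (λ x y → weightAt (arr σ) x + y) src≡ w≡

  abstract
    -- A cell costs at most 100 and the two jumps of the loop. Being abstract, the product is not
    -- unfolded in the bounds that contain it.
    rowCost : ℕ
    rowCost = suc K * 102 + 1

    rowCost≡ : rowCost ≡ suc K * 102 + 1
    rowCost≡ = refl

  fillRow-correct : ∀ {v d l f a b} σ → weigh (vertices ((v , d) ∷ l)) ≤ W →
    var σ rF ≡ f → var σ rI ≡ 0 → var σ rC ≡ suc K → var σ rOne ≡ 1 →
    var σ rK ≡ K → var σ rP ≡ p v → var σ rQ ≡ q v → var σ rW ≡ w v → var σ rX1 ≡ suc (toℕ v) →
    var σ rR1 ≡ a → var σ rR2 ≡ b → Row (arr σ) f a l → Row (arr σ) f b (drop d l) →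
    Ensures (while rC fillCell) σ rowCost
      (λ τ → Agree f (arr σ) (arr τ) × var τ rF ≡ f + suc K × Row (arr τ) (f + suc K) f ((v , d) ∷ l))
  fillRow-correct {v} {d} {l} {f} σ light f≡ i≡ c≡ one≡ K≡ p≡ q≡ w≡ x≡ a≡ b≡ row₁ row₂ =
    relax (≤-reflexive (sym rowCost≡)) (weaken finish (while-rule Inv (λ _ _ (_ , _ , _ , eq , _) → eq) body (suc K) start))
    where
    Inv : ℕ → Store → Set
    Inv c τ = ∃[ i ] i + c ≡ suc K × var τ rI ≡ i × var τ rC ≡ c × var τ rF ≡ f + i × Agree f (arr σ) (arr τ) ×
              (∀ j → j < i → Cell (arr τ) (f + i) (f + j) ((v , d) ∷ l) j)
    start : Inv (suc K) σ
    start = 0 , refl , i≡ , c≡ , trans f≡ (sym (+-identityʳ f)) , agree-refl , λ _ ()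
    finish : ∀ τ → Inv 0 τ → _
    finish τ (i , i≡ , _ , _ , F≡ , agree , cells) with trans (sym (+-identityʳ i)) i≡
    ... | refl = agree , F≡ , λ j j≤K → cells j (s≤s j≤K)
    body : ∀ c ρ → Frame fillCell σ ρ → Inv (suc c) ρ → Ensures fillCell ρ 100 (Inv c)
    body c ρ fr (i , i+c≡ , I≡ , C≡ , F≡ , agree , cells) =
      weaken next (fillCell-correct ρ i≤K light F≡ I≡ C≡ (kept rOne one≡) (kept rK K≡) (kept rP p≡) (kept rQ q≡)
        (kept rW w≡) (kept rX1 x≡) (kept rR1 a≡) (kept rR2 b≡)
        (row-mono agree (m≤m+n f i) row₁) (row-mono agree (m≤m+n f i) row₂))
      where
      kept : ∀ r {x} {_ : Untouched (λ o → writesVarOp o r) fillCell} → var σ r ≡ x → var ρ r ≡ x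
      kept r {_} {u} eq = trans (keep fr r u) eq
      i≤K : i ≤ K
      i≤K = +-cancelʳ-≤ c i K (≤-trans (≤-reflexive (suc-injective (trans (sym (+-suc i c)) i+c≡))) (m≤m+n K c))
      next : ∀ τ → Filled (arr ρ) (f + i) i c ((v , d) ∷ l) τ → Inv c τ
      next τ (agree′ , I≡′ , F≡′ , C≡′ , cell) =
        suc i , trans (sym (+-suc i c)) i+c≡ , I≡′ , C≡′ , trans F≡′ (sym (+-suc f i)) ,
        agree-trans (m≤m+n f i) agree agree′ , cells′
        where
        cells′ : ∀ j → j < suc i → Cell (arr τ) (f + suc i) (f + j) ((v , d) ∷ l) j
        cells′ j (s≤s j≤i) rewrite +-suc f i with m≤n⇒m<n∨m≡n j≤i
        ... | inj₁ j<i = cell-mono agree′ (n≤1+n (f + i)) (cells j j<i)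
        ... | inj₂ refl = cell

-- No subtree reaches beyond the end of its list, so skipping a vertex stays inside the list even
-- after another one has been appended.
Closed : Forest n → Set
Closed []            = ⊤
Closed ((v , d) ∷ l) = d ≤ length l × Closed l

closed-drop : ∀ k {l : Forest n} → Closed l → Closed (drop k l)
closed-drop zero    c = c
closed-drop (suc k) {[]} c = c
closed-drop (suc k) {_ ∷ _} (_ , c) = closed-drop k c

drop-view : ∀ {A : Set} k (l : List A) → k < length l → ∃[ e ] drop k l ≡ e ∷ drop (suc k) l
drop-view zero    (e ∷ l) _         = e , refl
drop-view (suc k) (e ∷ l) (s≤s k<l) = drop-view k l k<l

-- The subtree of v ends the list, so v connects everything picked after it.
data Spanned {n} (l : Forest n) : List (Fin n) → Set where
  spanned : ∀ k {v m s} → drop k l ≡ (v , length m) ∷ m → Pick m s → Spanned l (v ∷ s)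

Block : Memory → ℕ → Forest n → Set
Block A a []            = ⊤
Block A a ((v , d) ∷ l) = A 5 a ≡ toℕ v × A 6 a ≡ d × Block A (suc a) l

block-at : ∀ {A a} {l : Forest n} k {v d m} → Block A a l → drop k l ≡ (v , d) ∷ m →
           A 5 (a + k) ≡ toℕ v × A 6 (a + k) ≡ d
block-at {A = A} {a} {_ ∷ _} zero (eq₁ , eq₂ , _) refl =
  trans (cong (A 5) (+-identityʳ a)) eq₁ , trans (cong (A 6) (+-identityʳ a)) eq₂
block-at {A = A} {a} {_ ∷ l} (suc k) (_ , _ , b) eq with block-at {A = A} {suc a} {l} k b eq
... | eq₁ , eq₂ = trans (cong (A 5) (+-suc a k)) eq₁ , trans (cong (A 6) (+-suc a k)) eq₂

-- Processing a list from its end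

prepareRow : List Op

computeRow updateBest processRow process : Cmd
prepareRow = get rR1 aRow rJ ∷ minus rJ rJ rOne ∷ plus rT rSA rJ ∷ get rX aVertex rT ∷ get rD aDesc rT
      ∷ plus rS rJ rOne ∷ plus rS rS rD ∷ get rR2 aRow rS ∷ put aRow rJ rF
      ∷ get rP aBlue rX ∷ get rQ aRed rX ∷ plus rX1 rX rOne ∷ plus rW rP rQ
      ∷ plus rI rZero rZero ∷ plus rC rK rOne ∷ []
computeRow = ops prepareRow ⨾ while rC fillCell
updateBest =
  ops (get rA aRow rJ ∷ plus rA rA rO ∷ get rT aWeight rA ∷ get rB aWeight rBest ∷ minus rT rT rB ∷ [])
  ⨾ ifZero rT (ops []) (ops (plus rBest rA rZero ∷ []))
processRow =
  -- `rS` is the position behind the subtree of the vertex. The difference is 0 exactly if the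
  -- subtree ends the list, and only then does the vertex top everything picked after it.
  computeRow ⨾ ops (minus rT rSL rS ∷ []) ⨾ ifZero rT updateBest (ops [])
process =
  -- All lists start from one permanent row of the empty list, which occupies the cells from 0.
  ops (put aRow rSL rZero ∷ plus rJ rSL rZero ∷ []) ⨾ while rJ processRow

-- `Good` is a parameter, later instantiated with connected and free of repetitions, so that the
-- table is verified without reference to a graph.
module Processing (base : ℕ) (p q : Fin n → ℕ) (W : ℕ) (Good : List (Fin n) → Set) where

  open Execution base
  open CostLogic base
  open Rows p q W
  open FillCell base p q W

  record Env (σ : Store) : Set where
    field
      one≡  : var σ rOne ≡ 1
      zero≡ : var σ rZero ≡ 0
      K≡    : var σ rK ≡ K
      O≡    : var σ rO ≡ O
      blue≡ : ∀ v → arr σ 11 (toℕ v) ≡ p v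
      red≡  : ∀ v → arr σ 12 (toℕ v) ≡ q v

  open Env public

  EnvUntouched : Cmd → Set
  EnvUntouched c =
    Untouched (λ o → writesVarOp o rOne) c × Untouched (λ o → writesVarOp o rZero) c ×
    Untouched (λ o → writesVarOp o rK) c × Untouched (λ o → writesVarOp o rO) c ×
    Untouched (λ o → writesArrOp o 11) c × Untouched (λ o → writesArrOp o 12) c

  env-frame : ∀ {c σ τ} {_ : EnvUntouched c} → Frame c σ τ → Env σ → Env τ
  env-frame {_} {_} {_} {u₁ , u₂ , u₃ , u₄ , u₅ , u₆} fr env = record
    { one≡  = trans (keep fr rOne u₁) (one≡ env)
    ; zero≡ = trans (keep fr rZero u₂) (zero≡ env)
    ; K≡    = trans (keep fr rK u₃) (K≡ env)
    ; O≡    = trans (keep fr rO u₄) (O≡ env)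
    ; blue≡ = λ v → trans (cong (λ g → g (toℕ v)) (keepArr fr 11 u₅)) (blue≡ env v)
    ; red≡  = λ v → trans (cong (λ g → g (toℕ v)) (keepArr fr 12 u₆)) (red≡ env v)
    }

  EquallyColoured : List (Fin n) → Set
  EquallyColoured s = total p s ≡ total q s

  -- `rBest` points to a feasible set at all times, at the beginning to the empty one, so there is
  -- no separate case of nothing having been found.
  record Best (A : Memory) (f e : ℕ) : Set where
    field
      {picked} : List (Fin n)
      good     : Good picked
      balanced : EquallyColoured picked
      weight   : weightAt A e ≡ suc (weigh picked)
      chain    : Chain A f e picked
      best<f   : e < f

  open Best public

  best-mono : ∀ {A B f g e} → Agree f A B → f ≤ g → Best A f e → Best B g e
  best-mono a f≤g b = record
    { good = good b
    ; balanced = balanced b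
    ; weight = trans (weight≡ a (best<f b)) (weight b)
    ; chain = chain-mono a f≤g (chain b)
    ; best<f = <-≤-trans (best<f b) f≤g
    }

  module _ {L : Forest n} (closed : Closed L) (light : weigh (vertices L) ≤ W)
           (good-[] : Good []) (sound-L : ∀ {s} → Spanned L s → Good s) where

    ℓ : ℕ
    ℓ = length L

    BeatsFrom : ℕ → Memory → ℕ → Set
    BeatsFrom k A e = ∀ i → k ≤ i → ∀ {v m s} → drop i L ≡ (v , length m) ∷ m → Pick m s →
                      EquallyColoured (v ∷ s) → weigh (v ∷ s) < weightAt A e

    light-drop : ∀ k → weigh (vertices (drop k L)) ≤ W
    light-drop k = ≤-trans (total-drop w k L) light

    record RowsFrom (k f : ℕ) (A : Memory) : Set where
      constructor rowsFrom
      field row : ∀ i → k ≤ i → i ≤ ℓ → Row A f (A 7 i) (drop i L)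

    open RowsFrom

    record Prepared (A : Memory) (k f : ℕ) (v : Fin n) (d a b : ℕ) (ρ : Store) : Set where
      field
        arr≡ : arr ρ ≡ A [ 7 ∙ k ≔ f ]
        F≡   : var ρ rF ≡ f
        J≡   : var ρ rJ ≡ k
        S≡   : var ρ rS ≡ suc k + d
        I≡   : var ρ rI ≡ 0
        C≡   : var ρ rC ≡ suc K
        P≡   : var ρ rP ≡ p v
        Q≡   : var ρ rQ ≡ q v
        W≡   : var ρ rW ≡ w v
        X≡   : var ρ rX1 ≡ suc (toℕ v)
        R₁≡  : var ρ rR1 ≡ a
        R₂≡  : var ρ rR2 ≡ b

    prepareRow-correct : ∀ {k f v d} σ → Env σ → var σ rJ ≡ suc k → var σ rF ≡ f → Block (arr σ) (var σ rSA) L →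
      drop k L ≡ (v , d) ∷ drop (suc k) L →
      Ensures (ops prepareRow) σ 65 (Prepared (arr σ) k f v d (arr σ 7 (suc k)) (arr σ 7 (suc k + d)))
    prepareRow-correct {k} {f} {v} {d} σ env J≡ refl block drop≡ = relax! (ops-rule prepareRow _ (record
      { arr≡ = cong (λ j → arr σ [ 7 ∙ j ≔ f ]) J′≡
      ; F≡   = refl
      ; J≡   = J′≡
      ; S≡   = S≡
      ; I≡   = I≡
      ; C≡   = C≡
      ; P≡   = P≡
      ; Q≡   = Q≡
      ; W≡   = W≡
      ; X≡   = X₁≡
      ; R₁≡  = cong (arr σ 7) J≡
      ; R₂≡  = cong (arr σ 7) S≡
      }))
      where
      J′≡ : var σ rJ ∸ var σ rOne ≡ k
      J′≡ = cong₂ _∸_ J≡ (one≡ env)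
      I≡ : var σ rZero + var σ rZero ≡ 0
      I≡ = cong₂ _+_ (zero≡ env) (zero≡ env)
      C≡ : var σ rK + var σ rOne ≡ suc K
      C≡ = trans (cong₂ _+_ (K≡ env) (one≡ env)) (+-comm K 1)
      entry = block-at k block drop≡
      X≡ : arr σ 5 (var σ rSA + (var σ rJ ∸ var σ rOne)) ≡ toℕ v
      X≡ = trans (cong (λ j → arr σ 5 (var σ rSA + j)) J′≡) (proj₁ entry)
      D≡ : arr σ 6 (var σ rSA + (var σ rJ ∸ var σ rOne)) ≡ d
      D≡ = trans (cong (λ j → arr σ 6 (var σ rSA + j)) J′≡) (proj₂ entry)
      P≡ : arr σ 11 (arr σ 5 (var σ rSA + (var σ rJ ∸ var σ rOne))) ≡ p v
      P≡ = trans (cong (arr σ 11) X≡) (blue≡ env v)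
      Q≡ : arr σ 12 (arr σ 5 (var σ rSA + (var σ rJ ∸ var σ rOne))) ≡ q v
      Q≡ = trans (cong (arr σ 12) X≡) (red≡ env v)
      W≡ : arr σ 11 (arr σ 5 (var σ rSA + (var σ rJ ∸ var σ rOne))) +
           arr σ 12 (arr σ 5 (var σ rSA + (var σ rJ ∸ var σ rOne))) ≡ w v
      W≡ = cong₂ _+_ P≡ Q≡
      X₁≡ : arr σ 5 (var σ rSA + (var σ rJ ∸ var σ rOne)) + var σ rOne ≡ suc (toℕ v)
      X₁≡ = trans (cong₂ _+_ X≡ (one≡ env)) (+-comm (toℕ v) 1)
      S≡ : (var σ rJ ∸ var σ rOne) + var σ rOne + arr σ 6 (var σ rSA + (var σ rJ ∸ var σ rOne)) ≡ suc k + d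
      S≡ = cong₂ _+_ (trans (cong₂ _+_ J′≡ (one≡ env)) (+-comm k 1)) D≡

    computeRow-correct : ∀ {k f v d} σ → Env σ → var σ rJ ≡ suc k → var σ rF ≡ f → Block (arr σ) (var σ rSA) L →
      k < ℓ → drop k L ≡ (v , d) ∷ drop (suc k) L → RowsFrom (suc k) f (arr σ) →
      Ensures computeRow σ (65 + rowCost)
        (λ τ → Agree f (arr σ) (arr τ) × var τ rF ≡ f + suc K × var τ rJ ≡ k × var τ rS ≡ suc k + d ×
               RowsFrom k (f + suc K) (arr τ))
    computeRow-correct {k} {f} {v} {d} σ env J≡ F≡ block k<ℓ drop≡ rows =
      ⨾-rule (framed fill (prepareRow-correct σ env J≡ F≡ block drop≡))
      where
      S≤ℓ : suc k + d ≤ ℓ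
      S≤ℓ = ≤-trans (+-monoʳ-≤ (suc k) (proj₁ (subst Closed drop≡ (closed-drop k closed))))
        (≤-reflexive (trans (cong (suc k +_) (length-drop (suc k) L)) (m+[n∸m]≡n k<ℓ)))
      fill : ∀ ρ → Frame (ops prepareRow) σ ρ → Prepared (arr σ) k f v d (arr σ 7 (suc k)) (arr σ 7 (suc k + d)) ρ →
             Ensures (while rC fillCell) ρ rowCost _
      fill ρ fr prep =
        framed finish (fillRow-correct {v} {d} {drop (suc k) L} ρ
          (subst (λ l → weigh (vertices l) ≤ W) drop≡ (light-drop k))
          F≡′ I≡ C≡ (one≡ env′) (K≡ env′) P≡ Q≡ W≡ X≡ R₁≡ R₂≡
          (row-mono agree-put′ ≤-refl (row rows (suc k) ≤-refl k<ℓ))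
          -- Leaving out `v` continues in a row computed earlier, that of the suffix at position
          -- `suc k + d`.
          (subst (Row (arr ρ) f (arr σ 7 (suc k + d))) (sym (drop-drop (suc k) d L))
            (row-mono agree-put′ ≤-refl (row rows (suc k + d) (m≤m+n (suc k) d) S≤ℓ))))
        where
        open Prepared prep renaming (F≡ to F≡′; J≡ to J≡′)
        env′ : Env ρ
        env′ = env-frame fr env
        agree-put′ : Agree f (arr σ) (arr ρ)
        agree-put′ = record
          { weight≡ = λ {e} _ → cong (λ A → A 8 e) arr≡
          ; next≡   = λ {e} _ → cong (λ A → A 9 e) arr≡
          ; node≡   = λ {e} _ → cong (λ A → A 10 e) arr≡
          }
        finish : ∀ τ → Frame (while rC fillCell) ρ τ →
          Agree f (arr ρ) (arr τ) × var τ rF ≡ f + suc K × Row (arr τ) (f + suc K) f ((v , d) ∷ drop (suc k) L) →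
          Agree f (arr σ) (arr τ) × var τ rF ≡ f + suc K × var τ rJ ≡ k × var τ rS ≡ suc k + d ×
          RowsFrom k (f + suc K) (arr τ)
        finish τ fr′ (agree , F≡″ , new) =
          agree-trans ≤-refl agree-put′ agree , F≡″ ,
          trans (keep fr′ rJ tt) J≡′ , trans (keep fr′ rS tt) S≡ , rowsFrom rows′
          where
          row≡ : ∀ i → arr τ 7 i ≡ (arr σ 7 [ k ≔ f ]) i
          row≡ i = trans (cong (λ g → g i) (keepArr fr′ 7 tt)) (cong (λ A → A 7 i) arr≡)
          rows′ : ∀ i → k ≤ i → i ≤ ℓ → Row (arr τ) (f + suc K) (arr τ 7 i) (drop i L)
          rows′ i k≤i i≤ℓ with m≤n⇒m<n∨m≡n k≤i
          ... | inj₂ refl = subst₂ (Row (arr τ) (f + suc K)) (sym (trans (row≡ k) (≔-same (arr σ 7) k))) (sym drop≡) new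
          ... | inj₁ k<i = subst (λ a → Row (arr τ) (f + suc K) a (drop i L))
              (sym (trans (row≡ i) (≔-other (arr σ 7) (λ i≡k → <⇒≢ k<i (sym i≡k)))))
              (row-mono agree (m≤m+n f (suc K)) (row-mono agree-put′ ≤-refl (row rows i k<i i≤ℓ)))

    updateBest-correct : ∀ {k f v m e} σ → Env σ → var σ rJ ≡ k → var σ rBest ≡ e →
      Row (arr σ) f (arr σ 7 k) (drop k L) → drop k L ≡ (v , length m) ∷ m → Best (arr σ) f e →
      Ensures updateBest σ 40 (λ τ → arr τ ≡ arr σ × var τ rF ≡ var σ rF × Best (arr σ) f (var τ rBest) ×
        weightAt (arr σ) e ≤ weightAt (arr σ) (var τ rBest) ×
        (∀ {s} → Pick m s → EquallyColoured (v ∷ s) → weigh (v ∷ s) < weightAt (arr σ) (var τ rBest)))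
    updateBest-correct {k} {f} {v} {m} {e} σ env refl refl row drop≡ best =
      relax! (⨾-rule (ops-rule _ _ (ifZero-rule
        (λ t≡0 → relax {b′ = 2} z≤n (ops-rule [] _ (refl , refl , best , ≤-refl ,
          λ pk bal → <-≤-trans (beats pk bal) (subst (λ a → weightAt (arr σ) a ≤ weightAt (arr σ) e) cand≡ (m∸n≡0⇒m≤n t≡0)))))
        (λ t≢0 → relax! (ops-rule _ _ (refl , refl , subst (Best (arr σ) f) (sym moved≡) (improved (better t≢0)) ,
          subst (λ a → weightAt (arr σ) e ≤ weightAt (arr σ) a) (sym moved≡) (<⇒≤ (better t≢0)) ,
          λ {s} pk bal → subst (λ a → weigh (v ∷ s) < weightAt (arr σ) a) (sym moved≡) (beats pk bal)))))))
      where
      a : ℕ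
      -- Index `O` stands for equal weights of the colours.
      a = arr σ 7 k + O
      cand≡ : arr σ 7 k + var σ rO ≡ a
      cand≡ = cong (arr σ 7 k +_) (O≡ env)
      moved≡ : arr σ 7 k + var σ rO + var σ rZero ≡ a
      moved≡ = trans (cong₂ _+_ cand≡ (zero≡ env)) (+-identityʳ a)
      cell : Cell (arr σ) f a ((v , length m) ∷ m) O
      cell = subst (λ l → Cell (arr σ) f a l O) drop≡ (row O (m≤m+n O O))
      beats : ∀ {s} → Pick m s → EquallyColoured (v ∷ s) → weigh (v ∷ s) < weightAt (arr σ) a
      beats pk bal = complete cell (take pk , cong (O +_) bal)
      better : weightAt (arr σ) (arr σ 7 k + var σ rO) ∸ weightAt (arr σ) e ≢ 0 → weightAt (arr σ) e < weightAt (arr σ) a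
      better t≢0 = subst (λ a → weightAt (arr σ) e < weightAt (arr σ) a) cand≡ (≰⇒> λ le → t≢0 (m≤n⇒m∸n≡0 le))
      allGood : ∀ {s} → Pick ((v , length m) ∷ m) s → Good s
      allGood (take pk) = sound-L (spanned k drop≡ pk)
      -- The subtree of `v` is the whole rest of the list, so without `v` only the empty set
      -- remains.
      allGood (skip pk) with drop (length m) m | length-drop (length m) m | pk
      ... | []    | _  | done = good-[]
      ... | _ ∷ _ | eq | _ with trans eq (n∸n≡0 (length m))
      ... | ()
      improved : weightAt (arr σ) e < weightAt (arr σ) a → Best (arr σ) f a
      improved e<a with weightAt (arr σ) a in eq
      ... | suc x with sound cell eq
      ... | s , (pk , bal) , x≡ , ch = record
        { good = allGood pk ; balanced = +-cancelˡ-≡ O _ _ bal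
        ; weight = trans eq (cong suc x≡) ; chain = ch ; best<f = e<f cell }

    block-frame : ∀ {A B a} (l : Forest n) → A 5 ≡ B 5 → A 6 ≡ B 6 → Block A a l → Block B a l
    block-frame [] eq₁ eq₂ b = tt
    block-frame ((v , d) ∷ l) eq₁ eq₂ (x , y , b) =
      trans (cong (λ g → g _) (sym eq₁)) x , trans (cong (λ g → g _) (sym eq₂)) y , block-frame l eq₁ eq₂ b

    record Progress (σ : Store) (k : ℕ) (τ : Store) : Set where
      field
        k≤ℓ     : k ≤ ℓ
        J≡      : var τ rJ ≡ k
        f≤      : var σ rF ≤ var τ rF
        agree   : Agree (var σ rF) (arr σ) (arr τ)
        rows    : RowsFrom k (var τ rF) (arr τ)
        best    : Best (arr τ) (var τ rF) (var τ rBest)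
        better  : weightAt (arr σ) (var σ rBest) ≤ weightAt (arr τ) (var τ rBest)
        beats   : BeatsFrom k (arr τ) (var τ rBest)

    processRow-correct : ∀ {σ k ρ} → Env σ → Block (arr σ) (var σ rSA) L → var σ rSL ≡ ℓ →
      Frame processRow σ ρ → Progress σ (suc k) ρ → Ensures processRow ρ (110 + rowCost) (Progress σ k)
    processRow-correct {σ} {k} {ρ} env block SL≡ fr prog with drop-view k L (Progress.k≤ℓ prog)
    ... | (v , d) , drop≡ =
      relax (≤-trans (≤-reflexive (lemma rowCost)) (+-monoˡ-≤ rowCost (≤ᵇ⇒≤ 109 110 tt)))
        (⨾-rule (framed update (computeRow-correct ρ (env-frame fr env) J≡ refl
          (subst (λ a → Block (arr ρ) a L) (sym (keep fr rSA tt)) (block-frame L (sym (keepArr fr 5 tt)) (sym (keepArr fr 6 tt)) block))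
          k≤ℓ drop≡ rows)))
      where
      open Progress prog
      lemma : ∀ x → 65 + x + (2 + 42) ≡ 109 + x
      lemma = solve-∀
      update : ∀ τ → Frame computeRow ρ τ →
        Agree (var ρ rF) (arr ρ) (arr τ) × var τ rF ≡ var ρ rF + suc K × var τ rJ ≡ k × var τ rS ≡ suc k + d ×
        RowsFrom k (var ρ rF + suc K) (arr τ) →
        Ensures (ops (minus rT rSL rS ∷ []) ⨾ ifZero rT updateBest (ops [])) τ (2 + 42) (Progress σ k)
      update τ fr′ (agree′ , F≡ , J≡′ , S≡ , rows′) =
        ops-then _ 2 _ (ifZero-rule improve (λ t≢0 → relax {b′ = 40} z≤n (ops-rule [] _ (unchanged t≢0))))
        where
        f<F : var ρ rF ≤ var τ rF
        f<F = subst (var ρ rF ≤_) (sym F≡) (m≤m+n _ _)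
        best≡ : var τ rBest ≡ var ρ rBest
        best≡ = keep fr′ rBest tt
        best′ : Best (arr τ) (var τ rF) (var τ rBest)
        best′ = subst (Best (arr τ) (var τ rF)) (sym best≡) (best-mono agree′ f<F best)
        weight′ : weightAt (arr τ) (var τ rBest) ≡ weightAt (arr ρ) (var ρ rBest)
        weight′ = trans (cong (weightAt (arr τ)) best≡) (weight≡ agree′ (best<f best))
        rows″ : RowsFrom k (var τ rF) (arr τ)
        rows″ = subst (λ f → RowsFrom k f (arr τ)) (sym F≡) rows′
        gap≡ : var τ rSL ∸ var τ rS ≡ ℓ ∸ (suc k + d)
        gap≡ = cong₂ _∸_ (trans (keep fr′ rSL tt) (trans (keep fr rSL tt) SL≡)) S≡
        rest≡ : length (drop (suc k) L) ≡ ℓ ∸ suc k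
        rest≡ = length-drop (suc k) L
        d≤ : d ≤ length (drop (suc k) L)
        d≤ = proj₁ (subst Closed drop≡ (closed-drop k closed))
        unchanged : ∀ {τ′} → var τ rSL ∸ var τ rS ≢ 0 → Progress σ k (mk (var τ [ rT ≔ τ′ ]) (inp τ) (arr τ))
        unchanged t≢0 = record
          { k≤ℓ = <⇒≤ k≤ℓ ; J≡ = J≡′ ; f≤ = ≤-trans f≤ f<F ; agree = agree-trans f≤ agree agree′
          ; rows = rows″ ; best = best′ ; better = subst (_ ≤_) (sym weight′) better
          ; beats = beats′
          }
          where
          beats′ : BeatsFrom k (arr τ) (var τ rBest)
          beats′ i k≤i dr pk bal with m≤n⇒m<n∨m≡n k≤i
          ... | inj₁ k<i = subst (_ <_) (sym weight′) (beats i k<i dr pk bal)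
          ... | inj₂ refl with trans (sym drop≡) dr
          -- A subtree that fills the rest of the list would have made the tested gap 0.
          ... | refl = ⊥-elim (t≢0 (trans gap≡ (trans (sym (∸-+-assoc ℓ (suc k) d))
                  (trans (cong (_∸ d) (sym rest≡)) (n∸n≡0 d)))))
        improve : var τ rSL ∸ var τ rS ≡ 0 → Ensures updateBest _ 40 (Progress σ k)
        improve t≡0 = framed improved (updateBest-correct {k} {var τ rF} {v} {drop (suc k) L} {var τ rBest} _
            (env-frame (frame-ops (minus rT rSL rS ∷ [])) (env-frame fr′ (env-frame fr env))) J≡′ refl
            (RowsFrom.row rows″ k ≤-refl (<⇒≤ k≤ℓ))
            (trans drop≡ (cong (λ x → (v , x) ∷ drop (suc k) L) d≡)) best′)
          where
          d≡ : d ≡ length (drop (suc k) L)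
          d≡ = ≤-antisym d≤ (subst (_≤ d) (sym rest≡) (m∸n≡0⇒m≤n
            (trans (∸-+-assoc ℓ (suc k) d) (trans (sym gap≡) t≡0))))
          improved : ∀ τ′ → Frame updateBest (evals (minus rT rSL rS ∷ []) τ) τ′ → _ → Progress σ k τ′
          improved τ′ fr″ (arr≡ , F≡′ , best″ , mono , new) = record
            { k≤ℓ = <⇒≤ k≤ℓ ; J≡ = trans (keep fr″ rJ tt) J≡′ ; f≤ = subst (_ ≤_) (sym F≡′) (≤-trans f≤ f<F)
            ; agree = subst (Agree _ _) (sym arr≡) (agree-trans f≤ agree agree′)
            ; rows = subst₂ (RowsFrom k) (sym F≡′) (sym arr≡) rows″
            ; best = subst₂ (λ f A → Best A f (var τ′ rBest)) (sym F≡′) (sym arr≡) best″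
            ; better = subst (λ A → _ ≤ weightAt A (var τ′ rBest)) (sym arr≡)
                (≤-trans better (≤-trans (≤-reflexive (sym weight′)) mono))
            ; beats = subst (λ A → BeatsFrom k A (var τ′ rBest)) (sym arr≡) beats′
            }
            where
            beats′ : BeatsFrom k (arr τ) (var τ′ rBest)
            beats′ i k≤i {v′} {m} {s} dr pk bal with m≤n⇒m<n∨m≡n k≤i
            ... | inj₁ k<i = <-≤-trans (beats i k<i dr pk bal) (≤-trans (≤-reflexive (sym weight′)) mono)
            ... | inj₂ refl with trans (sym drop≡) dr
            ... | refl = new pk bal

    processCost : ℕ
    processCost = 8 + (ℓ * (2 + (110 + rowCost)) + 1)

    record Processed (σ τ : Store) : Set where
      field
        f≤     : var σ rF ≤ var τ rF
        agree  : Agree (var σ rF) (arr σ) (arr τ)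
        best   : Best (arr τ) (var τ rF) (var τ rBest)
        better : weightAt (arr σ) (var σ rBest) ≤ weightAt (arr τ) (var τ rBest)
        beats  : ∀ {s} → Spanned L s → EquallyColoured s → weigh s < weightAt (arr τ) (var τ rBest)

    process-correct : ∀ σ → Env σ → Block (arr σ) (var σ rSA) L → var σ rSL ≡ ℓ → Row (arr σ) (var σ rF) 0 [] →
      Best (arr σ) (var σ rF) (var σ rBest) → Ensures process σ processCost (Processed σ)
    process-correct σ env block SL≡ unit best₀ =
      ops-then startOps 8 _ (weaken finish (while-rule (Progress σ₁) (λ k τ → Progress.J≡)
        (λ k ρ fr → processRow-correct env₁ (block-frame L refl refl block) SL≡ fr) ℓ start))
      where
      startOps : List Op
      startOps = put aRow rSL rZero ∷ plus rJ rSL rZero ∷ []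
      σ₁ : Store
      σ₁ = evals startOps σ
      env₁ : Env σ₁
      env₁ = env-frame (frame-ops startOps) env
      agree₁ : Agree (var σ rF) (arr σ) (arr σ₁)
      agree₁ = record { weight≡ = λ _ → refl ; next≡ = λ _ → refl ; node≡ = λ _ → refl }
      J≡ : var σ rSL + var σ rZero ≡ ℓ
      J≡ = trans (cong₂ _+_ SL≡ (zero≡ env)) (+-identityʳ ℓ)
      row≡ : (arr σ 7 [ var σ rSL ≔ var σ rZero ]) ℓ ≡ 0
      row≡ = trans (cong (λ j → (arr σ 7 [ j ≔ var σ rZero ]) ℓ) SL≡) (trans (≔-same (arr σ 7) ℓ) (zero≡ env))
      drop-all : drop ℓ L ≡ []
      drop-all = go L
        where
        go : ∀ {A : Set} (l : List A) → drop (length l) l ≡ []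
        go []      = refl
        go (_ ∷ l) = go l
      rows₁ : ∀ i → ℓ ≤ i → i ≤ ℓ → Row (arr σ₁) (var σ rF) (arr σ₁ 7 i) (drop i L)
      rows₁ i ℓ≤i i≤ℓ with ≤-antisym ℓ≤i i≤ℓ
      ... | refl = subst₂ (Row (arr σ₁) (var σ rF)) (sym row≡) (sym drop-all) (row-mono agree₁ ≤-refl unit)
      start : Progress σ₁ ℓ σ₁
      start = record
        { k≤ℓ = ≤-refl ; J≡ = J≡ ; f≤ = ≤-refl ; agree = agree-refl ; rows = rowsFrom rows₁
        ; best = best-mono agree₁ ≤-refl best₀ ; better = ≤-refl
        ; beats = λ i ℓ≤i dr → ⊥-elim (no-entry i ℓ≤i dr)
        }
        where
        no-entry : ∀ i → ℓ ≤ i → ∀ {e m} → drop i L ≢ e ∷ m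
        no-entry i ℓ≤i {e} {m} dr = 0≢1+n (trans (sym (m≤n⇒m∸n≡0 ℓ≤i)) (trans (sym (length-drop i L)) (cong length dr)))
      finish : ∀ τ → Progress σ₁ 0 τ → Processed σ τ
      finish τ prog = record
        { f≤ = f≤ ; agree = agree-trans ≤-refl agree₁ agree ; best = best ; better = better
        ; beats = λ { (spanned k dr pk) bal → beats k z≤n dr pk bal }
        }
        where open Progress prog

-- Merging the forests of a tree

drop-++ : ∀ {A : Set} k (l : List A) {m} → k ≤ length l → drop k (l ++ m) ≡ drop k l ++ m
drop-++ zero    l       _         = refl
drop-++ (suc k) (_ ∷ l) (s≤s k≤) = drop-++ k l k≤

drop-length+ : ∀ {A : Set} (l : List A) k {m} → drop (length l + k) (l ++ m) ≡ drop k m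
drop-length+ []      k = refl
drop-length+ (_ ∷ l) k = drop-length+ l k

-- Closedness keeps every skip inside the first list, so the choices in the two lists are
-- independent.
pick-++⁺ : ∀ {a b : Forest n} {s t} → Closed a → Pick a s → Pick b t → Pick (a ++ b) (s ++ t)
pick-++⁺ c done pt = pt
pick-++⁺ {b = b} (d≤ , c) (skip {d = d} {l} ps) pt =
  skip (subst (λ m → Pick m _) (sym (drop-++ d l d≤)) (pick-++⁺ (closed-drop d c) ps pt))
pick-++⁺ (_ , c) (take ps) pt = take (pick-++⁺ c ps pt)

-- The number `k` is fuel: a skip continues with `drop d a`, which is not a structural part of the
-- list.
pick-++⁻ : ∀ k (a : Forest n) {b s} → length a ≤ k → Closed a → Pick (a ++ b) s →
           ∃[ t ] ∃[ u ] s ≡ t ++ u × Pick a t × Pick b u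
pick-++⁻ k [] _ c pk = [] , _ , refl , done , pk
pick-++⁻ (suc k) ((v , d) ∷ a) (s≤s le) (d≤ , c) (skip pk)
  with pick-++⁻ k (drop d a) (≤-trans (≤-trans (≤-reflexive (length-drop d a)) (m∸n≤m _ d)) le) (closed-drop d c)
         (subst (λ m → Pick m _) (drop-++ d a d≤) pk)
... | t , u , eq , pt , pu = t , u , eq , skip pt , pu
pick-++⁻ (suc k) ((v , d) ∷ a) (s≤s le) (d≤ , c) (take pk) with pick-++⁻ k a le c pk
... | t , u , eq , pt , pu = v ∷ t , u , cong (v ∷_) eq , take pt , pu

-- A subtree of the first list ends within that list. If it also ends the concatenation, the second
-- list must be empty.
spanned-++⁻ : ∀ (a : Forest n) {b s} → Closed a → Spanned (a ++ b) s → Spanned a s ⊎ Spanned b s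
spanned-++⁻ [] c sp = inj₂ sp
spanned-++⁻ ((v , d) ∷ a) {b} (d≤ , c) (spanned zero refl pk) = inj₁ (spanned zero
    (cong (λ m → (v , length m) ∷ a) (trans (cong (a ++_) b≡[]) (++-identityʳ a)))
    (subst (λ m → Pick m _) (trans (cong (a ++_) b≡[]) (++-identityʳ a)) pk))
  where
  length≡0 : ∀ {A : Set} {l : List A} → length l ≤ 0 → l ≡ []
  length≡0 {l = []} _ = refl
  b≡[] : b ≡ []
  b≡[] = length≡0 (+-cancelˡ-≤ (length a) _ _
    (≤-trans (≤-reflexive (sym (length-++ a))) (≤-trans d≤ (≤-reflexive (sym (+-identityʳ _))))))
spanned-++⁻ ((v , d) ∷ a) (d≤ , c) (spanned (suc k) eq pk) with spanned-++⁻ a c (spanned k eq pk)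
... | inj₁ (spanned k eq pk) = inj₁ (spanned (suc k) eq pk)
... | inj₂ sp = inj₂ sp

spanned-++⁺ : ∀ (a : Forest n) {b s} → Spanned b s → Spanned (a ++ b) s
spanned-++⁺ a (spanned k eq pk) = spanned (length a + k) (trans (drop-length+ a k) eq) pk

spanned-∷ : ∀ {e} {b : Forest n} {s} → Spanned b s → Spanned (e ∷ b) s
spanned-∷ (spanned k eq pk) = spanned (suc k) eq pk

closed-++ : ∀ (a : Forest n) {b} → Closed a → Closed b → Closed (a ++ b)
closed-++ [] _ cb = cb
closed-++ ((v , d) ∷ a) (d≤ , ca) cb =
  ≤-trans d≤ (≤-trans (m≤m+n _ _) (≤-reflexive (sym (length-++ a)))) , closed-++ a ca cb

∈-drop : ∀ {A : Set} k {l : List A} {a} → a ∈ drop k l → a ∈ l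
∈-drop zero    a∈ = a∈
∈-drop (suc k) {_ ∷ l} a∈ = there (∈-drop k a∈)

vertices-drop : ∀ k (l : Forest n) → vertices (drop k l) ≡ drop k (vertices l)
vertices-drop zero    l       = refl
vertices-drop (suc k) []      = refl
vertices-drop (suc k) (_ ∷ l) = vertices-drop k l

pick-⊆ : ∀ {l : Forest n} {s a} → Pick l s → a ∈ s → a ∈ vertices l
pick-⊆ (skip {d = d} {l} pk) a∈ = there (∈-drop d (subst (_ ∈_) (vertices-drop d l) (pick-⊆ pk a∈)))
pick-⊆ (take pk) (here eq) = here eq
pick-⊆ (take pk) (there a∈) = there (pick-⊆ pk a∈)

pick-unique : ∀ {l : Forest n} {s} → Unique (vertices l) → Pick l s → Unique s
pick-unique u done = []
pick-unique (_ ∷ u) (skip {d = d} {l} pk) = pick-unique (subst Unique (sym (vertices-drop d l)) (Unique.drop⁺ d u)) pk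
pick-unique (v∉ ∷ u) (take pk) = All.tabulate (λ a∈ → All.lookup v∉ (pick-⊆ pk a∈)) ∷ pick-unique u pk

spanned-unique : ∀ {l : Forest n} {s} → Unique (vertices l) → Spanned l s → Unique s
spanned-unique {l = l} u (spanned k {m = m} eq pk) =
  pick-unique (subst (λ m → Unique (vertices m)) eq (subst Unique (sym (vertices-drop k l)) (Unique.drop⁺ k u))) (take {d = length m} pk)

spanned-⊆ : ∀ {l : Forest n} {s a} → Spanned l s → a ∈ s → a ∈ vertices l
spanned-⊆ {l = l} (spanned k {m = m} eq pk) a∈ = ∈-drop k (subst (_ ∈_) (vertices-drop k l)
  (subst (λ m → _ ∈ vertices m) (sym eq) (pick-⊆ (take {d = length m} pk) a∈)))

tail : {A : Set} → List A → List A
tail = drop 1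

smaller : Forest n → Forest n → Forest n
smaller a b with length a ≤? length b
... | yes _ = a
... | no  _ = b

-- The larger list comes last, so that its suffixes remain suffixes.
below : Forest n → Forest n → Forest n
below a b with length a ≤? length b
... | yes _ = tail a ++ b
... | no  _ = b ++ tail a

smaller-below : ∀ (a b : Forest n) →
  (length a ≤ length b × smaller a b ≡ a × below a b ≡ tail a ++ b) ⊎
  (length b < length a × smaller a b ≡ b × below a b ≡ b ++ tail a)
smaller-below a b with length a ≤? length b
... | yes a≤b = inj₁ (a≤b , refl , refl)
... | no  a≰b = inj₂ (≰⇒> a≰b , refl , refl)

_[_↦_] : {A : Set} → (Fin n → A) → Fin n → A → Fin n → A
(f [ v ↦ x ]) u with u Fin.≟ v
... | yes _ = x
... | no  _ = f u

↦-same : ∀ {A : Set} (f : Fin n → A) v {x} → (f [ v ↦ x ]) v ≡ x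
↦-same f v with v Fin.≟ v
... | yes _  = refl
... | no v≢v = ⊥-elim (v≢v refl)

↦-other : ∀ {A : Set} (f : Fin n → A) {u v x} → u ≢ v → (f [ v ↦ x ]) u ≡ f u
↦-other f {u} {v} u≢v with u Fin.≟ v
... | yes u≡v = ⊥-elim (u≢v u≡v)
... | no _    = refl

↦-map : ∀ {A B : Set} (h : A → B) (f : Fin n → A) {v x} u → h ((f [ v ↦ x ]) u) ≡ ((λ u → h (f u)) [ v ↦ h x ]) u
↦-map h f {v} u with u Fin.≟ v
... | yes _ = refl
... | no _  = refl

↦-cong : ∀ {A : Set} {f g : Fin n → A} {v x y} → (∀ u → f u ≡ g u) → x ≡ y → ∀ u → (f [ v ↦ x ]) u ≡ (g [ v ↦ y ]) u
↦-cong {v = v} f≡g x≡y u with u Fin.≟ v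
... | yes _ = x≡y
... | no _  = f≡g u

rooted : Fin n → Forest n → Forest n
rooted v m = (v , length m) ∷ m

-- `below` drops the head of the list of `p`, because `p` returns as the head of the joint list with
-- its new number of descendants.
merge : Fin n → Fin n → (Fin n → Forest n) → Fin n → Forest n
merge x p L = (L [ x ↦ [] ]) [ p ↦ rooted p (below (L p) (L x)) ]

-- Not computed by the program: it records which lists will be processed, and both the running time
-- and the completeness of the search are stated for it. The last list is the one of the root.
schedule : List (Fin n × Fin n) → (Fin n → Forest n) → List (Forest n)
schedule [] L = []
schedule ((r , _) ∷ []) L = L r ∷ []
schedule ((x , p) ∷ xs@(_ ∷ _)) L = smaller (L p) (L x) ∷ schedule xs (merge x p L)

-- The invariant of the merges

module Connectivity (Adj : Fin n → Fin n → Set) (sym-Adj : ∀ {u v} → Adj u v → Adj v u) where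

  -- Predicates take the place of subsets because connected sets will be cut down to the vertices of
  -- a list. For membership in a subset this is `InducedAdj`.
  Within : (Fin n → Set) → Fin n → Fin n → Set
  Within Q u v = Q u × Q v × Adj u v

  ConnectedOn : (Fin n → Set) → Set
  ConnectedOn Q = ∀ {u v} → Q u → Q v → Star (Within Q) u v

  within-reverse : ∀ {Q u v} → Star (Within Q) u v → Star (Within Q) v u
  within-reverse = Star.reverse λ (qu , qv , uv) → qv , qu , sym-Adj uv

  within-mono : ∀ {Q R} → (∀ {a} → Q a → R a) → ∀ {u v} → Star (Within Q) u v → Star (Within R) u v
  within-mono f = Star.map λ (qu , qv , uv) → f qu , f qv , uv

  connected-join : ∀ {Q Q₁ Q₂ : Fin n → Set} {p x} → ConnectedOn Q₁ → ConnectedOn Q₂ → Q₁ p → Q₂ x → Adj p x →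
                   (∀ {a} → Q a → Q₁ a ⊎ Q₂ a) → (∀ {a} → Q₁ a → Q a) → (∀ {a} → Q₂ a → Q a) → ConnectedOn Q
  connected-join {Q} {Q₁} {Q₂} {p} {x} c₁ c₂ q₁p q₂x px split i₁ i₂ qu qv = to qu ◅◅ within-reverse (to qv)
    where
    to : ∀ {u} → Q u → Star (Within Q) u p
    to qu with split qu
    ... | inj₁ q₁u = within-mono i₁ (c₁ q₁u q₁p)
    ... | inj₂ q₂u = within-mono i₂ (c₂ q₂u q₂x) ◅◅ (i₂ q₂x , i₁ q₁p , sym-Adj px) ◅ ε

  connected-stay : ∀ {Q A : Fin n → Set} → (∀ {a b} → Q a → Q b → Adj a b → A a → A b) →
                   ∀ {u v} → Star (Within Q) u v → A u → A v
  connected-stay h ε au = au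
  connected-stay h ((qa , qb , ab) ◅ r) au = connected-stay h r (h qa qb ab au)

  -- A path to p can leave the set A only at p itself, and is then cut short.
  restrict : ∀ {Q A : Fin n → Set} {p} → (∀ {a b} → Adj a b → A a → Q b → A b ⊎ a ≡ p) →
             ∀ {u} → Star (Within Q) u p → A u → Star (Within (λ a → Q a × A a)) u p
  restrict exit ε au = ε
  restrict exit ((qu , qc , uc) ◅ r) au with exit uc au qc
  ... | inj₁ ac   = ((qu , au) , (qc , ac) , uc) ◅ restrict exit r ac
  ... | inj₂ refl = ε

  restrict-connected : ∀ {Q A : Fin n → Set} {p} → (∀ {a b} → Adj a b → A a → Q b → A b ⊎ a ≡ p) →
                       ConnectedOn Q → Q p → ConnectedOn (λ a → Q a × A a)
  restrict-connected exit c qp (qu , au) (qv , av) =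
    restrict exit (c qu qp) au ◅◅ within-reverse (restrict exit (c qv qp) av)

  record Enumerates (Q : Fin n → Set) (s : List (Fin n)) : Set where
    field
      to   : ∀ {a} → Q a → a ∈ s
      from : ∀ {a} → a ∈ s → Q a

  Spans : Forest n → (Fin n → Set) → Set
  Spans l Q = ∃[ s ] Spanned l s × Enumerates Q s

  enumerates-trans : ∀ {Q : Fin n → Set} {s t} → Enumerates Q s →
                     (∀ {a} → a ∈ s → a ∈ t) → (∀ {a} → a ∈ t → a ∈ s) → Enumerates Q t
  enumerates-trans e i j = record { to = λ qa → i (Enumerates.to e qa) ; from = λ a∈ → Enumerates.from e (j a∈) }

  -- Q either is found by processing one of the present lists or still has to be
  -- put together by a merge.
  Pending : (Fin n → Forest n) → (Fin n → Set) → Set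
  Pending L Q = (∃[ v ] Spans (L v) Q) ⊎ (∀ v → ¬ (∀ {a} → Q a → a ∈ vertices (L v)))

  -- `cross` says that different lists are joined only through their roots, so a merge adds a single
  -- edge between two parts. `complete` speaks only of sets that contain the root of a list; all
  -- other sets are followed by `Pending`.
  record Invariant (live : List (Fin n)) (L : Fin n → Forest n) : Set₁ where
    field
      alive    : ∀ {v} → v ∈ live → ∃[ m ] L v ≡ rooted v m
      dead     : ∀ {v} → v ∉ live → L v ≡ []
      cover    : ∀ a → ∃[ v ] a ∈ vertices (L v)
      disjoint : ∀ {a u v} → a ∈ vertices (L u) → a ∈ vertices (L v) → u ≡ v
      unique   : ∀ v → Unique (vertices (L v))
      closed   : ∀ v → Closed (L v)
      cross    : ∀ {a b u v} → Adj a b → a ∈ vertices (L u) → b ∈ vertices (L v) → u ≢ v → a ≡ u × b ≡ v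
      sound    : ∀ v {s} → Spanned (L v) s → ConnectedOn (_∈ s)
      complete : ∀ v {Q : Fin n → Set} → Decidable Q → ConnectedOn Q → Q v → (∀ {a} → Q a → a ∈ vertices (L v)) →
                 ∃[ s ] Pick (tail (L v)) s × Enumerates Q (v ∷ s)

  open Invariant public

  -- Symmetric in a and b, and hence indifferent to the order of concatenation.
  record Below (a b m : Forest n) : Set where
    field
      vertices⁺ˡ : ∀ {v} → v ∈ vertices a → v ∈ vertices m
      vertices⁺ʳ : ∀ {v} → v ∈ vertices b → v ∈ vertices m
      vertices⁻  : ∀ {v} → v ∈ vertices m → v ∈ vertices a ⊎ v ∈ vertices b
      uniques    : (∀ {v} → v ∈ vertices a → v ∉ vertices b) → Unique (vertices a) → Unique (vertices b) → Unique (vertices m)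
      closeds    : Closed m
      picks⁺     : ∀ {s t} → Pick a s → Pick b t →
                   ∃[ u ] Pick m u × (∀ {v} → v ∈ s ⊎ v ∈ t → v ∈ u) × (∀ {v} → v ∈ u → v ∈ s ⊎ v ∈ t)
      picks⁻     : ∀ {u} → Pick m u → ∃[ s ] ∃[ t ] Pick a s × Pick b t ×
                   (∀ {v} → v ∈ s ⊎ v ∈ t → v ∈ u) × (∀ {v} → v ∈ u → v ∈ s ⊎ v ∈ t)
      spans⁻     : ∀ {s} → Spanned m s → Spanned a s ⊎ Spanned b s

  open Below

  from-⊎ : ∀ {s t : List (Fin n)} {v} → v ∈ s ⊎ v ∈ t → v ∈ s ++ t
  from-⊎ (inj₁ v∈) = ∈-++⁺ˡ v∈
  from-⊎ {s} (inj₂ v∈) = ∈-++⁺ʳ s v∈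

  below-++ : ∀ (a b : Forest n) → Closed a → Closed b → Below a b (a ++ b)
  below-++ a b ca cb = record
    { vertices⁺ˡ = λ v∈ → subst (_ ∈_) (sym (map-++ proj₁ a b)) (∈-++⁺ˡ v∈)
    ; vertices⁺ʳ = λ v∈ → subst (_ ∈_) (sym (map-++ proj₁ a b)) (∈-++⁺ʳ (vertices a) v∈)
    ; vertices⁻ = λ v∈ → ∈-++⁻ (vertices a) (subst (_ ∈_) (map-++ proj₁ a b) v∈)
    ; uniques = λ dis ua ub → subst Unique (sym (map-++ proj₁ a b)) (Unique.++⁺ ua ub λ (x , y) → dis x y)
    ; closeds = closed-++ a ca cb
    ; picks⁺ = λ ps pt → _ , pick-++⁺ ca ps pt , from-⊎ , ∈-++⁻ _
    ; picks⁻ = λ pk → let s , t , eq , ps , pt = pick-++⁻ (length a) a ≤-refl ca pk in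
        s , t , ps , pt , (λ v∈ → subst (_ ∈_) (sym eq) (from-⊎ v∈)) , λ v∈ → ∈-++⁻ s (subst (_ ∈_) eq v∈)
    ; spans⁻ = spanned-++⁻ a ca
    }

  swap-⊎ : {A B : Set} → A ⊎ B → B ⊎ A
  swap-⊎ (inj₁ x) = inj₂ x
  swap-⊎ (inj₂ x) = inj₁ x

  below-swap : ∀ {a b m} → Below b a m → Below a b m
  below-swap r = record
    { vertices⁺ˡ = vertices⁺ʳ r
    ; vertices⁺ʳ = vertices⁺ˡ r
    ; vertices⁻ = λ v∈ → swap-⊎ (vertices⁻ r v∈)
    ; uniques = λ dis ua ub → uniques r (λ v∈b v∈a → dis v∈a v∈b) ub ua
    ; closeds = closeds r
    ; picks⁺ = λ ps pt → let u , pu , i , j = picks⁺ r pt ps in u , pu , (λ x → i (swap-⊎ x)) , λ x → swap-⊎ (j x)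
    ; picks⁻ = λ pu → let t , s , pt , ps , i , j = picks⁻ r pu in s , t , ps , pt , (λ x → i (swap-⊎ x)) , λ x → swap-⊎ (j x)
    ; spans⁻ = λ sp → swap-⊎ (spans⁻ r sp)
    }

  below-spec : ∀ a b → Closed a → Closed b → Below (tail a) b (below a b)
  below-spec a b ca cb with length a ≤? length b
  ... | yes _ = below-++ (tail a) b (closed-drop 1 ca) cb
  ... | no  _ = below-swap (below-++ b (tail a) cb (closed-drop 1 ca))

  pick-none : ∀ {v} (m : Forest n) → Pick (rooted v m) []
  pick-none m = skip (go m)
    where
    go : ∀ m → Pick (drop (length m) m) []
    go []      = done
    go (_ ∷ m) = go m

  -- Acyclicity enters through `only`: among the vertices still alive, `x` has no neighbour but its
  -- parent.
  module Step {live : List (Fin n)} {L : Fin n → Forest n} {x p : Fin n} (inv : Invariant (x ∷ live) L)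
              (p∈ : p ∈ live) (x∉ : x ∉ live) (px : Adj p x) (only : ∀ {a} → a ∈ live → Adj a x → a ≡ p) where

    private
      x≢p : x ≢ p
      x≢p refl = x∉ p∈

      L′ : Fin n → Forest n
      L′ = merge x p L

      m : Forest n
      m = below (L p) (L x)

      spec : Below (tail (L p)) (L x) m
      spec = below-spec (L p) (L x) (closed inv p) (closed inv x)

      Mp = proj₁ (alive inv (there p∈))
      Mx = proj₁ (alive inv (here refl))

      Lp≡ : L p ≡ rooted p (tail (L p))
      Lp≡ = trans (proj₂ (alive inv (there p∈))) (cong (rooted p) (sym (cong tail (proj₂ (alive inv (there p∈))))))

      Lx≡ : L x ≡ rooted x (tail (L x))
      Lx≡ = trans (proj₂ (alive inv (here refl))) (cong (rooted x) (sym (cong tail (proj₂ (alive inv (here refl))))))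

      ∈p : ∀ {a} → a ∈ vertices (L p) → a ≡ p ⊎ a ∈ vertices (tail (L p))
      ∈p a∈ with subst (λ l → _ ∈ vertices l) Lp≡ a∈
      ... | here a≡p = inj₁ a≡p
      ... | there a∈ = inj₂ a∈

      tail⊆ : ∀ {a} → a ∈ vertices (tail (L p)) → a ∈ vertices (L p)
      tail⊆ a∈ = subst (λ l → _ ∈ vertices l) (sym Lp≡) (there a∈)

      p∈Lp : p ∈ vertices (L p)
      p∈Lp = subst (λ l → p ∈ vertices l) (sym Lp≡) (here refl)

      x∈Lx : x ∈ vertices (L x)
      x∈Lx = subst (λ l → x ∈ vertices l) (sym Lx≡) (here refl)

      at-p : L′ p ≡ rooted p m
      at-p = ↦-same _ p

      at-x : L′ x ≡ []
      at-x = trans (↦-other _ x≢p) (↦-same L x)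

      at-other : ∀ {u} → u ≢ p → u ≢ x → L′ u ≡ L u
      at-other u≢p u≢x = trans (↦-other _ u≢p) (↦-other L u≢x)

      data Place (u : Fin n) : Set where
        is-p     : u ≡ p → Place u
        is-x     : u ≡ x → Place u
        is-other : u ≢ p → u ≢ x → Place u

      place : ∀ u → Place u
      place u with u Fin.≟ p | u Fin.≟ x
      ... | yes u≡p | _ = is-p u≡p
      ... | no u≢p | yes u≡x = is-x u≡x
      ... | no u≢p | no u≢x = is-other u≢p u≢x

      data Origin (u a : Fin n) : Set where
        from-p     : u ≡ p → a ∈ vertices (L p) → Origin u a
        from-x     : u ≡ p → a ∈ vertices (L x) → Origin u a
        from-other : u ≢ p → u ≢ x → a ∈ vertices (L u) → Origin u a

      origin : ∀ {u a} → a ∈ vertices (L′ u) → Origin u a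
      origin {u} a∈ with place u
      ... | is-other u≢p u≢x = from-other u≢p u≢x (subst (λ l → _ ∈ vertices l) (at-other u≢p u≢x) a∈)
      ... | is-x refl with subst (λ l → _ ∈ vertices l) at-x a∈
      ... | ()
      origin {u} a∈ | is-p refl with subst (λ l → _ ∈ vertices l) at-p a∈
      ... | here refl = from-p refl p∈Lp
      ... | there a∈m with vertices⁻ spec a∈m
      ... | inj₁ a∈p = from-p refl (tail⊆ a∈p)
      ... | inj₂ a∈x = from-x refl a∈x

      place-p : ∀ {a} → a ∈ vertices (L p) → a ∈ vertices (L′ p)
      place-p a∈ = subst (λ l → _ ∈ vertices l) (sym at-p) (lemma (∈p a∈))
        where
        lemma : ∀ {a} → a ≡ p ⊎ a ∈ vertices (tail (L p)) → a ∈ vertices (rooted p m)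
        lemma (inj₁ eq) = here eq
        lemma (inj₂ a∈) = there (vertices⁺ˡ spec a∈)

      place-x : ∀ {a} → a ∈ vertices (L x) → a ∈ vertices (L′ p)
      place-x a∈ = subst (λ l → _ ∈ vertices l) (sym at-p) (there (vertices⁺ʳ spec a∈))

      live-of : ∀ {a v} → v ≢ x → a ∈ vertices (L v) → v ∈ live
      live-of {a} {v} v≢x a∈ with DecMembership._∈?_ Fin._≟_ v live
      ... | yes v∈ = v∈
      ... | no v∉ with subst (λ l → a ∈ vertices l) (dead inv λ { (here eq) → v≢x eq ; (there v∈) → v∉ v∈ }) a∈
      ... | ()

      -- By `cross` such an edge would join `x` to a third live root, which `only` identifies with
      -- `p`.
      no-bridge : ∀ {a b v} → Adj a b → a ∈ vertices (L x) → b ∈ vertices (L v) → v ≢ p → v ≢ x → ⊥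
      no-bridge ab a∈ b∈ v≢p v≢x with cross inv ab a∈ b∈ (λ eq → v≢x (sym eq))
      ... | refl , refl = v≢p (only (live-of v≢x b∈) (sym-Adj ab))

      cross′ : ∀ {a b u v} → Adj a b → a ∈ vertices (L′ u) → b ∈ vertices (L′ v) → u ≢ v → a ≡ u × b ≡ v
      cross′ ab a∈ b∈ u≢v with origin a∈ | origin b∈
      ... | from-other _ _ a∈ | from-other _ _ b∈ = cross inv ab a∈ b∈ u≢v
      ... | from-other _ _ a∈ | from-p refl b∈ = cross inv ab a∈ b∈ u≢v
      ... | from-other u≢p u≢x a∈ | from-x refl b∈ = ⊥-elim (no-bridge (sym-Adj ab) b∈ a∈ u≢p u≢x)
      ... | from-p refl a∈ | from-other _ _ b∈ = cross inv ab a∈ b∈ u≢v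
      ... | from-x refl a∈ | from-other v≢p v≢x b∈ = ⊥-elim (no-bridge ab a∈ b∈ v≢p v≢x)
      ... | from-p refl _ | from-p refl _ = ⊥-elim (u≢v refl)
      ... | from-p refl _ | from-x refl _ = ⊥-elim (u≢v refl)
      ... | from-x refl _ | from-p refl _ = ⊥-elim (u≢v refl)
      ... | from-x refl _ | from-x refl _ = ⊥-elim (u≢v refl)

      disjoint′ : ∀ {a u v} → a ∈ vertices (L′ u) → a ∈ vertices (L′ v) → u ≡ v
      disjoint′ a∈ a∈′ with origin a∈ | origin a∈′
      ... | from-other _ _ a∈ | from-other _ _ b∈ = disjoint inv a∈ b∈
      ... | from-other _ _ a∈ | from-p refl b∈ = disjoint inv a∈ b∈
      ... | from-other u≢p u≢x a∈ | from-x refl b∈ = ⊥-elim (u≢x (disjoint inv a∈ b∈))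
      ... | from-p refl a∈ | from-other _ _ b∈ = disjoint inv a∈ b∈
      ... | from-x refl a∈ | from-other v≢p v≢x b∈ = ⊥-elim (v≢x (disjoint inv b∈ a∈))
      ... | from-p refl _ | from-p refl _ = refl
      ... | from-p refl _ | from-x refl _ = refl
      ... | from-x refl _ | from-p refl _ = refl
      ... | from-x refl _ | from-x refl _ = refl

      unique′ : ∀ v → Unique (vertices (L′ v))
      unique′ v with place v
      ... | is-other v≢p v≢x = subst (λ l → Unique (vertices l)) (sym (at-other v≢p v≢x)) (unique inv v)
      ... | is-x refl = subst (λ l → Unique (vertices l)) (sym at-x) []
      ... | is-p refl with subst (λ l → Unique (vertices l)) Lp≡ (unique inv p)
      ... | p∉ ∷ uniq = subst (λ l → Unique (vertices l)) (sym at-p)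
              (All.tabulate (λ a∈ → fresh (vertices⁻ spec a∈)) ∷
               uniques spec (λ a∈ b∈ → x≢p (disjoint inv b∈ (tail⊆ a∈))) uniq (unique inv x))
        where
        fresh : ∀ {a} → a ∈ vertices (tail (L p)) ⊎ a ∈ vertices (L x) → p ≢ a
        fresh (inj₁ a∈) = All.lookup p∉ a∈
        fresh (inj₂ a∈) refl = x≢p (disjoint inv a∈ p∈Lp)

      closed′ : ∀ v → Closed (L′ v)
      closed′ v with place v
      ... | is-other v≢p v≢x = subst Closed (sym (at-other v≢p v≢x)) (closed inv v)
      ... | is-x refl = subst Closed (sym at-x) tt
      ... | is-p refl = subst Closed (sym at-p) (≤-refl , closeds spec)

      -- The pick splits into one below `p` and one from the list of `x`. The latter either contains
      -- `x`, which hangs on `p` by an edge, or is empty, as leaving out a root leaves out its list.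
      sound-p : ∀ {s} → Pick m s → ConnectedOn (_∈ p ∷ s)
      sound-p {s} pk with picks⁻ spec pk
      ... | s₁ , s₂ , pk₁ , pk₂ , i , j = lemma (subst (λ l → Pick l s₂) Lx≡ pk₂)
        where
        c₁ : ConnectedOn (_∈ p ∷ s₁)
        c₁ = sound inv p (spanned 0 Lp≡ pk₁)
        lemma : Pick (rooted x (tail (L x))) s₂ → ConnectedOn (_∈ p ∷ s)
        lemma (take pk) = connected-join c₁ (sound inv x (spanned 0 Lx≡ pk)) (here refl) (here refl) px
          (λ { (here eq) → inj₁ (here eq) ; (there a∈) → split (j a∈) })
          (λ { (here eq) → here eq ; (there a∈) → there (i (inj₁ a∈)) })
          (λ a∈ → there (i (inj₂ a∈)))
          where
          split : ∀ {a} → a ∈ s₁ ⊎ a ∈ s₂ → a ∈ p ∷ s₁ ⊎ a ∈ s₂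
          split (inj₁ a∈) = inj₁ (there a∈)
          split (inj₂ a∈) = inj₂ a∈
        lemma (skip pk) = λ u∈ v∈ → within-mono widen (c₁ (narrow u∈) (narrow v∈))
          where
          s₂≡[] : ∀ {s} (l : Forest n) → Pick (drop (length l) l) s → s ≡ []
          s₂≡[] [] done = refl
          s₂≡[] (_ ∷ l) pk = s₂≡[] l pk
          narrow : ∀ {a} → a ∈ p ∷ s → a ∈ p ∷ s₁
          narrow (here eq) = here eq
          narrow (there a∈) with j a∈
          ... | inj₁ a∈₁ = there a∈₁
          ... | inj₂ a∈₂ with subst (_ ∈_) (s₂≡[] (tail (L x)) pk) a∈₂
          ... | ()
          widen : ∀ {a} → a ∈ p ∷ s₁ → a ∈ p ∷ s
          widen (here eq) = here eq
          widen (there a∈) = there (i (inj₁ a∈))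

      sound′ : ∀ v {s} → Spanned (L′ v) s → ConnectedOn (_∈ s)
      sound′ v sp with place v
      ... | is-other v≢p v≢x = sound inv v (subst (λ l → Spanned l _) (at-other v≢p v≢x) sp)
      ... | is-x refl with subst (λ l → Spanned l _) at-x sp
      ... | spanned zero () _
      ... | spanned (suc _) () _
      sound′ v sp | is-p refl with subst (λ l → Spanned l _) at-p sp
      ... | spanned zero refl pk = sound-p pk
      ... | spanned (suc k) eq pk with spans⁻ spec (spanned k eq pk)
      ... | inj₁ sp′ = sound inv p (subst (λ l → Spanned l _) (sym Lp≡) (spanned-∷ sp′))
      ... | inj₂ sp′ = sound inv x sp′

    module _ {Q : Fin n → Set} (Q? : Decidable Q) (conn : ConnectedOn Q)
             (inside : ∀ {a} → Q a → a ∈ vertices (L p) ⊎ a ∈ vertices (L x)) where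

      exit-p : ∀ {a b} → Adj a b → a ∈ vertices (L p) → Q b → b ∈ vertices (L p) ⊎ (a ≡ p × b ≡ x)
      exit-p ab a∈ qb with inside qb
      ... | inj₁ b∈ = inj₁ b∈
      ... | inj₂ b∈ = inj₂ (cross inv ab a∈ b∈ λ eq → x≢p (sym eq))

      exit-x : ∀ {a b} → Adj a b → a ∈ vertices (L x) → Q b → b ∈ vertices (L x) ⊎ (a ≡ x × b ≡ p)
      exit-x ab a∈ qb with inside qb
      ... | inj₁ b∈ = inj₂ (cross inv ab a∈ b∈ x≢p)
      ... | inj₂ b∈ = inj₁ b∈

      -- The edge between `p` and `x` is the only way out of the list, and `Q` misses one of its
      -- ends.
      stay-p : ¬ (Q p × Q x) → ∀ {a} → Q a → a ∈ vertices (L p) → ∀ {b} → Q b → b ∈ vertices (L p)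
      stay-p ¬both qa a∈ qb = connected-stay keep-in (conn qa qb) a∈
        where
        keep-in : ∀ {a b} → Q a → Q b → Adj a b → a ∈ vertices (L p) → b ∈ vertices (L p)
        keep-in qa qb ab a∈ with exit-p ab a∈ qb
        ... | inj₁ b∈ = b∈
        ... | inj₂ (refl , refl) = ⊥-elim (¬both (qa , qb))

      stay-x : ¬ (Q p × Q x) → ∀ {a} → Q a → a ∈ vertices (L x) → ∀ {b} → Q b → b ∈ vertices (L x)
      stay-x ¬both qa a∈ qb = connected-stay keep-in (conn qa qb) a∈
        where
        keep-in : ∀ {a b} → Q a → Q b → Adj a b → a ∈ vertices (L x) → b ∈ vertices (L x)
        keep-in qa qb ab a∈ with exit-x ab a∈ qb
        ... | inj₁ b∈ = b∈
        ... | inj₂ (refl , refl) = ⊥-elim (¬both (qb , qa))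

      private
        _∈L?_ : ∀ a v → Dec (a ∈ vertices (L v))
        a ∈L? v = DecMembership._∈?_ Fin._≟_ a (vertices (L v))

      -- If `x` is missing, `Q` lies in the list of `p` and is combined with the empty pick.
      -- Otherwise `Q` falls into its parts in the two lists. Each part is connected, because a path
      -- can leave it only at `p` or `x`, respectively, and so is found by the old invariant.
      complete-p : Q p → ∃[ s ] Pick m s × Enumerates Q (p ∷ s)
      complete-p qp with Q? x
      ... | no ¬qx with complete inv p Q? conn qp (stay-p (λ (_ , qx) → ¬qx qx) qp p∈Lp)
      ... | s , pk , enum with picks⁺ spec pk (subst (λ l → Pick l []) (sym Lx≡) (pick-none (tail (L x))))
      ... | u , pk′ , i , j = u , pk′ , record
        { to = λ qa → widen (Enumerates.to enum qa) ; from = λ a∈ → Enumerates.from enum (narrow a∈) }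
        where
        widen : ∀ {a} → a ∈ p ∷ s → a ∈ p ∷ u
        widen (here eq) = here eq
        widen (there a∈) = there (i (inj₁ a∈))
        narrow : ∀ {a} → a ∈ p ∷ u → a ∈ p ∷ s
        narrow (here eq) = here eq
        narrow (there a∈) with j a∈
        ... | inj₁ a∈ = there a∈
        ... | inj₂ ()
      complete-p qp | yes qx
        with complete inv p (λ a → Q? a ×-dec (a ∈L? p)) conn-p (qp , p∈Lp) proj₂
           | complete inv x (λ a → Q? a ×-dec (a ∈L? x)) conn-x (qx , x∈Lx) proj₂
        where
        conn-p : ConnectedOn (λ a → Q a × a ∈ vertices (L p))
        conn-p = restrict-connected {p = p} (λ ab a∈ qb → Sum.map₂ proj₁ (exit-p ab a∈ qb)) conn qp
        conn-x : ConnectedOn (λ a → Q a × a ∈ vertices (L x))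
        conn-x = restrict-connected {p = x} (λ ab a∈ qb → Sum.map₂ proj₁ (exit-x ab a∈ qb)) conn qx
      ... | s₁ , pk₁ , enum₁ | s₂ , pk₂ , enum₂ with picks⁺ spec pk₁ (subst (λ l → Pick l (x ∷ s₂)) (sym Lx≡) (take pk₂))
      ... | u , pk , i , j = u , pk , record { to = to′ ; from = from′ }
        where
        widen : ∀ {a} → a ∈ p ∷ s₁ → a ∈ p ∷ u
        widen (here eq) = here eq
        widen (there a∈) = there (i (inj₁ a∈))
        to′ : ∀ {a} → Q a → a ∈ p ∷ u
        to′ qa with inside qa
        ... | inj₁ a∈ = widen (Enumerates.to enum₁ (qa , a∈))
        ... | inj₂ a∈ = there (i (inj₂ (Enumerates.to enum₂ (qa , a∈))))
        from′ : ∀ {a} → a ∈ p ∷ u → Q a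
        from′ (here refl) = qp
        from′ (there a∈) with j a∈
        ... | inj₁ a∈ = proj₁ (Enumerates.from enum₁ (there a∈))
        ... | inj₂ a∈ = proj₁ (Enumerates.from enum₂ a∈)

    private
      inside-p : ∀ {Q : Fin n → Set} → (∀ {a} → Q a → a ∈ vertices (L′ p)) → ∀ {a} → Q a → a ∈ vertices (L p) ⊎ a ∈ vertices (L x)
      inside-p ⊆l qa with origin (⊆l qa)
      ... | from-p _ a∈ = inj₁ a∈
      ... | from-x _ a∈ = inj₂ a∈
      ... | from-other p≢p _ _ = ⊥-elim (p≢p refl)

    merged : Invariant live L′
    merged = record
      { alive    = alive′
      ; dead     = dead′
      ; cover    = cover′
      ; disjoint = disjoint′
      ; unique   = unique′
      ; closed   = closed′
      ; cross    = cross′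
      ; sound    = sound′
      ; complete = complete′
      }
      where
      alive′ : ∀ {v} → v ∈ live → ∃[ m ] L′ v ≡ rooted v m
      alive′ {v} v∈ with place v
      ... | is-p refl = _ , at-p
      ... | is-x refl = ⊥-elim (x∉ v∈)
      ... | is-other v≢p v≢x = proj₁ (alive inv (there v∈)) , trans (at-other v≢p v≢x) (proj₂ (alive inv (there v∈)))
      dead′ : ∀ {v} → v ∉ live → L′ v ≡ []
      dead′ {v} v∉ with place v
      ... | is-p refl = ⊥-elim (v∉ p∈)
      ... | is-x refl = at-x
      ... | is-other v≢p v≢x = trans (at-other v≢p v≢x) (dead inv λ { (here eq) → v≢x eq ; (there v∈) → v∉ v∈ })
      cover′ : ∀ a → ∃[ v ] a ∈ vertices (L′ v)
      cover′ a with cover inv a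
      ... | v , a∈ with place v
      ... | is-p refl = p , place-p a∈
      ... | is-x refl = p , place-x a∈
      ... | is-other v≢p v≢x = v , subst (λ l → a ∈ vertices l) (sym (at-other v≢p v≢x)) a∈
      complete′ : ∀ v {Q : Fin n → Set} → Decidable Q → ConnectedOn Q → Q v → (∀ {a} → Q a → a ∈ vertices (L′ v)) →
                  ∃[ s ] Pick (tail (L′ v)) s × Enumerates Q (v ∷ s)
      complete′ v Q? conn qv ⊆l with place v
      ... | is-other v≢p v≢x with complete inv v Q? conn qv (λ qa → subst (λ l → _ ∈ vertices l) (at-other v≢p v≢x) (⊆l qa))
      ... | s , pk , enum = s , subst (λ l → Pick (tail l) s) (sym (at-other v≢p v≢x)) pk , enum
      complete′ v Q? conn qv ⊆l | is-x refl with subst (λ l → _ ∈ vertices l) at-x (⊆l qv)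
      ... | ()
      complete′ v Q? conn qv ⊆l | is-p refl with complete-p Q? conn (inside-p ⊆l) qv
      ... | s , pk , enum = s , subst (λ l → Pick (tail l) s) (sym at-p) pk , enum

    private
      -- With the list of `p` at the end its suffixes persist, except for the whole list: its head
      -- moves to the front, and the pick has to leave out the inserted list of `x`.
      keep-p : ∀ {Q : Fin n → Set} → below (L p) (L x) ≡ L x ++ tail (L p) → Spans (L p) Q → Spans (L′ p) Q
      keep-p {Q} eq (s , sp , enum) with subst (λ l → Spanned l s) Lp≡ sp
      ... | spanned (suc k) eq′ pk = s , subst (λ l → Spanned l s) (sym at-p)
              (spanned-∷ (subst (λ l → Spanned l s) (sym eq) (spanned-++⁺ (L x) (spanned k eq′ pk)))) , enum
      ... | spanned zero refl pk
        with picks⁺ spec pk (subst (λ l → Pick l []) (sym Lx≡) (pick-none (tail (L x))))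
      ... | u , pk′ , i , j =
        p ∷ u , subst (λ l → Spanned l (p ∷ u)) (sym at-p) (spanned zero refl pk′) , enumerates-trans enum widen narrow
        where
        widen : ∀ {a} → a ∈ s → a ∈ p ∷ u
        widen (here eq) = here eq
        widen (there a∈) = there (i (inj₁ a∈))
        narrow : ∀ {a} → a ∈ p ∷ u → a ∈ s
        narrow (here eq) = here eq
        narrow (there a∈) with j a∈
        ... | inj₁ a∈ = there a∈
        ... | inj₂ ()

      keep-x : ∀ {Q : Fin n → Set} → below (L p) (L x) ≡ tail (L p) ++ L x → Spans (L x) Q → Spans (L′ p) Q
      keep-x eq (s , sp , enum) = s , subst (λ l → Spanned l s) (sym at-p)
        (spanned-∷ (subst (λ l → Spanned l s) (sym eq) (spanned-++⁺ (tail (L p)) sp))) , enum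

    -- Sets spanned by the front list are found now, and those of the rear list stay spanned. A set
    -- that fitted into no list before but fits into the joint one must use the new edge, so it
    -- contains `p`, whose subtree is all of the joint list.
    pending : ∀ {Q : Fin n → Set} → Decidable Q → ConnectedOn Q → ∀ {a} → Q a → Pending L Q →
              Spans (smaller (L p) (L x)) Q ⊎ Pending L′ Q
    pending {Q} Q? conn qa (inj₁ (v , spans)) with place v | smaller-below (L p) (L x)
    ... | is-other v≢p v≢x | _ = inj₂ (inj₁ (v , subst (λ l → Spans l Q) (sym (at-other v≢p v≢x)) spans))
    ... | is-p refl | inj₁ (_ , eq , _) = inj₁ (subst (λ l → Spans l Q) (sym eq) spans)
    ... | is-p refl | inj₂ (_ , _ , eq) = inj₂ (inj₁ (p , keep-p eq spans))
    ... | is-x refl | inj₁ (_ , _ , eq) = inj₂ (inj₁ (p , keep-x eq spans))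
    ... | is-x refl | inj₂ (_ , eq , _) = inj₁ (subst (λ l → Spans l Q) (sym eq) spans)
    pending {Q} Q? conn {a} qa (inj₂ outside) = inj₂ decide
      where
      other-outside : ¬ (∀ b → Q b → b ∈ vertices (L′ p)) → ∀ v → ¬ (∀ {b} → Q b → b ∈ vertices (L′ v))
      other-outside ¬in v ⊆l with place v
      ... | is-p refl = ¬in (λ b → ⊆l)
      ... | is-other v≢p v≢x = outside v (λ qb → subst (λ l → _ ∈ vertices l) (at-other v≢p v≢x) (⊆l qb))
      ... | is-x refl with subst (λ l → _ ∈ vertices l) at-x (⊆l qa)
      ... | ()
      both : (∀ {b} → Q b → b ∈ vertices (L p) ⊎ b ∈ vertices (L x)) → ¬ ¬ (Q p × Q x)
      both inside ¬both with inside qa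
      ... | inj₁ a∈ = outside p (stay-p Q? conn inside ¬both qa a∈)
      ... | inj₂ a∈ = outside x (stay-x Q? conn inside ¬both qa a∈)
      decide : Pending L′ Q
      decide with Fin.all? (λ b → Q? b →-dec DecMembership._∈?_ Fin._≟_ b (vertices (L′ p)))
      ... | no ¬in = inj₂ (other-outside ¬in)
      -- `both` only refutes that an end of the edge is missing; decidability of `Q` removes the
      -- double negation.
      ... | yes ⊆l with decidable-stable (Q? p ×-dec Q? x) (both (inside-p (⊆l _)))
      ... | qp , _ with complete-p Q? conn (inside-p (⊆l _)) qp
      ... | s , pk , enum = inj₁ (p , p ∷ s , subst (λ l → Spanned l (p ∷ s)) (sym at-p) (spanned zero refl pk) , enum)

    length-merged : length (L′ p) ≡ length (L p) + length (L x)
    length-merged = trans (cong length at-p) (lemma (smaller-below (L p) (L x)))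
      where
      lemma : _ → suc (length m) ≡ length (L p) + length (L x)
      lemma (inj₁ (_ , _ , eq)) = trans (cong (λ l → suc (length l)) eq)
        (trans (cong suc (length-++ (tail (L p)))) (cong (λ l → length l + length (L x)) (sym Lp≡)))
      lemma (inj₂ (_ , _ , eq)) = trans (cong (λ l → suc (length l)) eq)
        (trans (cong suc (trans (length-++ (L x)) (+-comm (length (L x)) _))) (cong (λ l → length l + length (L x)) (sym Lp≡)))

-- Sums over the vertices

sum-update : ∀ (f : Fin n → ℕ) v x → sum (f [ v ↦ x ]) + f v ≡ sum f + x
sum-update {suc n} f Fin.zero x = lemma x (sum (λ u → f (Fin.suc u))) (f Fin.zero)
  where
  lemma : ∀ a b c → (a + b) + c ≡ (c + b) + a
  lemma = solve-∀
sum-update {suc n} f (Fin.suc v) x = begin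
    (f Fin.zero + sum (λ u → (f [ Fin.suc v ↦ x ]) (Fin.suc u))) + f (Fin.suc v)
      ≡⟨ cong (λ k → (f Fin.zero + k) + f (Fin.suc v)) (sum-cong-≗ shifted) ⟩
    (f Fin.zero + sum ((λ u → f (Fin.suc u)) [ v ↦ x ])) + f (Fin.suc v)
      ≡⟨ +-assoc (f Fin.zero) _ _ ⟩
    f Fin.zero + (sum ((λ u → f (Fin.suc u)) [ v ↦ x ]) + f (Fin.suc v))
      ≡⟨ cong (f Fin.zero +_) (sum-update (λ u → f (Fin.suc u)) v x) ⟩
    f Fin.zero + (sum (λ u → f (Fin.suc u)) + x)
      ≡⟨ +-assoc (f Fin.zero) _ x ⟨
    f Fin.zero + sum (λ u → f (Fin.suc u)) + x ∎
  where
  open ≡-Reasoning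
  shifted : ∀ u → (f [ Fin.suc v ↦ x ]) (Fin.suc u) ≡ ((λ u → f (Fin.suc u)) [ v ↦ x ]) u
  shifted u with u Fin.≟ v
  ... | yes _ = refl
  ... | no _  = refl

sum-zero : ∀ {f : Fin n → ℕ} → (∀ v → f v ≡ 0) → sum f ≡ 0
sum-zero {zero}  z = refl
sum-zero {suc n} z = cong₂ _+_ (z Fin.zero) (sum-zero (λ v → z (Fin.suc v)))

sum-single : ∀ (f : Fin n → ℕ) v → (∀ u → u ≢ v → f u ≡ 0) → sum f ≡ f v
sum-single f v z = begin
    sum f                        ≡⟨ +-identityʳ _ ⟨
    sum f + 0                    ≡⟨ sum-update f v 0 ⟨
    sum (f [ v ↦ 0 ]) + f v      ≡⟨ cong (_+ f v) (sum-zero rest) ⟩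
    f v ∎
  where
  open ≡-Reasoning
  rest : ∀ u → (f [ v ↦ 0 ]) u ≡ 0
  rest u with u Fin.≟ v
  ... | yes _ = refl
  ... | no u≢v = z u u≢v

sum-mono : ∀ {f g : Fin n → ℕ} → (∀ v → f v ≤ g v) → sum f ≤ sum g
sum-mono {zero}  le = z≤n
sum-mono {suc n} le = +-mono-≤ (le Fin.zero) (sum-mono (λ v → le (Fin.suc v)))

sum-const : ∀ n c → sum {n} (λ _ → c) ≡ n * c
sum-const zero    c = refl
sum-const (suc n) c = cong (c +_) (sum-const n c)

_∈?_ : ∀ (v : Fin n) s → Dec (v ∈ s)
_∈?_ = DecMembership._∈?_ Fin._≟_

-- By induction on the list: the summand for `a ∷ s` arises from the one for `s` by an update at
-- `a`, where it was 0 because `a` does not occur in `s`.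
total-sum : ∀ (g : Fin n → ℕ) {s} → Unique s → (χ : Fin n → Bool) →
            (∀ {v} → T (χ v) → v ∈ s) → (∀ {v} → v ∈ s → T (χ v)) → sum (λ v → if χ v then g v else 0) ≡ total g s
total-sum g {[]} _ χ χ⇒ _ = sum-zero λ v → empty v
  where
  empty : ∀ v → (if χ v then g v else 0) ≡ 0
  empty v with χ v | χ⇒ {v}
  ... | false | _ = refl
  ... | true  | f with f tt
  ... | ()
total-sum g {a ∷ s} (a∉ ∷ u) χ χ⇒ ⇒χ = begin
    sum (λ v → if χ v then g v else 0) ≡⟨ sum-cong-≗ split ⟩
    sum (h [ a ↦ g a ])                ≡⟨ +-identityʳ _ ⟨
    sum (h [ a ↦ g a ]) + 0            ≡⟨ cong (sum (h [ a ↦ g a ]) +_) (sym h-a) ⟩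
    sum (h [ a ↦ g a ]) + h a          ≡⟨ sum-update h a (g a) ⟩
    sum h + g a                        ≡⟨ +-comm (sum h) (g a) ⟩
    g a + sum h                        ≡⟨ cong (g a +_) (total-sum g u χ′ to from) ⟩
    g a + total g s ∎
  where
  open ≡-Reasoning
  χ′ : Fin _ → Bool
  χ′ v = does (v ∈? s)
  h : Fin _ → ℕ
  h v = if χ′ v then g v else 0
  to : ∀ {v} → T (χ′ v) → v ∈ s
  to {v} t with v ∈? s
  ... | yes v∈ = v∈
  from : ∀ {v} → v ∈ s → T (χ′ v)
  from {v} v∈ = subst T (sym (dec-true (v ∈? s) v∈)) tt
  a∉s : a ∉ s
  a∉s a∈ = All.lookup a∉ a∈ refl
  h-a : h a ≡ 0
  h-a = cong (λ b → if b then g a else 0) (dec-false (a ∈? s) a∉s)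
  T-eq : ∀ {x y : Bool} → (T x → T y) → (T y → T x) → x ≡ y
  T-eq {false} {false} _ _ = refl
  T-eq {false} {true}  _ g = ⊥-elim (g tt)
  T-eq {true}  {false} f _ = ⊥-elim (f tt)
  T-eq {true}  {true}  _ _ = refl
  split : ∀ v → (if χ v then g v else 0) ≡ (h [ a ↦ g a ]) v
  split v with v Fin.≟ a
  ... | yes refl = cong (λ b → if b then g v else 0) (T-eq {χ v} {true} (λ _ → tt) (λ _ → ⇒χ (here refl)))
  ... | no v≢a = cong (λ b → if b then g v else 0) (T-eq (λ t → from (narrow (χ⇒ t))) (λ t → ⇒χ (there (to t))))
    where
    narrow : v ∈ a ∷ s → v ∈ s
    narrow (here eq)  = ⊥-elim (v≢a eq)
    narrow (there v∈) = v∈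

total≤sum : ∀ (g : Fin n → ℕ) {s} → Unique s → total g s ≤ sum g
total≤sum g {s} u = ≤-trans
  (≤-reflexive (sym (total-sum g u (λ v → does (v ∈? s)) to (λ {v} v∈ → subst T (sym (dec-true (v ∈? s) v∈)) tt))))
  (sum-mono below′)
  where
  to : ∀ {v} → T (does (v ∈? s)) → v ∈ s
  to {v} t with v ∈? s
  ... | yes v∈ = v∈
  below′ : ∀ v → (if does (v ∈? s) then g v else 0) ≤ g v
  below′ v with does (v ∈? s)
  ... | true  = ≤-refl
  ... | false = z≤n

-- The pigeonhole principle, as the case of weight 1 everywhere.
length-unique : ∀ {s : List (Fin n)} → Unique s → length s ≤ n
length-unique {n} {s} u = subst₂ _≤_ (count s) (trans (sum-const n 1) (*-identityʳ n)) (total≤sum (λ _ → 1) u)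
  where
  count : ∀ (s : List (Fin n)) → total (λ _ → 1) s ≡ length s
  count []      = refl
  count (_ ∷ s) = cong suc (count s)

-- Superadditive with room for the length of the smaller list.
potential : ℕ → ℕ
potential a = a * ⌊log₂ a ⌋

potential-mono : ∀ {a b} → a ≤ b → potential a ≤ potential b
potential-mono le = *-mono-≤ le (⌊log₂⌋-mono-≤ le)

-- Since `2 * a ≤ a + b`, the logarithm that goes with the shorter part grows by at least 1, and
-- this pays for the additional `a`.
potential-merge : ∀ {a b} → 1 ≤ a → a ≤ b → a + (potential a + potential b) ≤ potential (a + b)
potential-merge {a@(suc _)} {b} _ a≤b = begin
    a + (potential a + potential b)          ≡⟨ +-assoc a _ _ ⟨
    (a + potential a) + potential b          ≡⟨ cong (_+ potential b) (sym (*-suc a ⌊log₂ a ⌋)) ⟩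
    a * suc ⌊log₂ a ⌋ + potential b          ≡⟨ cong (λ k → a * k + potential b) (sym (⌊log₂[2*b]⌋≡1+⌊log₂b⌋ a)) ⟩
    a * ⌊log₂ (2 * a) ⌋ + potential b        ≤⟨ +-mono-≤ (*-monoʳ-≤ a (⌊log₂⌋-mono-≤ 2a≤)) (*-monoʳ-≤ b (⌊log₂⌋-mono-≤ (m≤n+m b a))) ⟩
    a * ⌊log₂ (a + b) ⌋ + b * ⌊log₂ (a + b) ⌋ ≡⟨ *-distribʳ-+ ⌊log₂ (a + b) ⌋ a b ⟨
    potential (a + b) ∎
  where
  open ≤-Reasoning
  2a≤ : 2 * a ≤ a + b
  2a≤ = +-monoʳ-≤ a (≤-trans (≤-reflexive (+-identityʳ a)) a≤b)

log< : ∀ n → ⌊log₂ suc n ⌋ ≤ n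
log< n = ≤-trans (⌊log₂⌋-mono-≤ (below-power n)) (≤-reflexive (⌊log₂[2^n]⌋≡n n))
  where
  below-power : ∀ n → suc n ≤ 2 ^ n
  below-power zero    = ≤-refl
  below-power (suc n) = +-mono-≤ (m^n>0 2 n) (≤-trans (below-power n) (m≤m+n (2 ^ n) 0))

-- By halving: with l = `⌊log₂ n ⌋` the induction hypothesis gives l² ≤ 4 ⌊n/2⌋ ≤ 2 n, and 2 l + 1 ≤
-- 2 n because l < n.
square-log : ∀ n → 1 ≤ n → suc ⌊log₂ n ⌋ * suc ⌊log₂ n ⌋ ≤ 4 * n
square-log = <-rec _ go
  where
  go : ∀ n → (∀ {m} → m < n → 1 ≤ m → suc ⌊log₂ m ⌋ * suc ⌊log₂ m ⌋ ≤ 4 * m) → 1 ≤ n → suc ⌊log₂ n ⌋ * suc ⌊log₂ n ⌋ ≤ 4 * n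
  go (suc zero) _ _ = s≤s z≤n
  go n@(suc (suc k)) rec _ = begin
      suc ⌊log₂ n ⌋ * suc ⌊log₂ n ⌋       ≡⟨ lemma ⌊log₂ n ⌋ ⟩
      suc (⌊log₂ n ⌋ * ⌊log₂ n ⌋ + 2 * ⌊log₂ n ⌋) ≤⟨ s≤s (+-mono-≤ (≤-trans square half) (*-monoʳ-≤ 2 (log< (suc k)))) ⟩
      suc (2 * n + 2 * suc k)              ≤⟨ ≤-trans (n≤1+n _) (≤-reflexive (lemma′ k)) ⟩
      4 * n ∎
    where
    open ≤-Reasoning
    lemma : ∀ l → suc l * suc l ≡ suc (l * l + 2 * l)
    lemma = solve-∀
    lemma′ : ∀ k → suc (suc (2 * suc (suc k) + 2 * suc k)) ≡ 4 * suc (suc k)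
    lemma′ = solve-∀
    log≡ : ⌊log₂ n ⌋ ≤ suc ⌊log₂ ⌊ n /2⌋ ⌋
    log≡ = ≤-trans (m≤n+m∸n ⌊log₂ n ⌋ 1) (≤-reflexive (cong suc (sym (⌊log₂⌊n/2⌋⌋≡⌊log₂n⌋∸1 n))))
    square : ⌊log₂ n ⌋ * ⌊log₂ n ⌋ ≤ 4 * ⌊ n /2⌋
    square = ≤-trans (*-mono-≤ log≡ log≡) (rec (s≤s (s≤s (⌊n/2⌋≤n k))) (s≤s z≤n))
    half : 4 * ⌊ n /2⌋ ≤ 2 * n
    half = begin
      4 * ⌊ n /2⌋                   ≡⟨ *-assoc 2 2 ⌊ n /2⌋ ⟩
      2 * (2 * ⌊ n /2⌋)             ≤⟨ *-monoʳ-≤ 2 (+-monoʳ-≤ ⌊ n /2⌋ (≤-trans (≤-reflexive (+-identityʳ _)) (⌊n/2⌋≤⌈n/2⌉ n))) ⟩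
      2 * (⌊ n /2⌋ + ⌈ n /2⌉)       ≡⟨ cong (2 *_) (⌊n/2⌋+⌈n/2⌉≡n n) ⟩
      2 * n ∎

-- Growing the tree, and the total length of the processed lists

totalLength : List (Forest n) → ℕ
totalLength []       = 0
totalLength (l ∷ ls) = length l + totalLength ls

module Growth {n} (G : BicoloredGraph n) (tree : BicoloredGraph.IsTree G) where

  open BicoloredGraph G hiding (w)
  open IsTree tree

  sym-Adj : ∀ {u v} → Adj u v → Adj v u
  sym-Adj = Sum.swap

  open Connectivity Adj sym-Adj public

  visited : List (Fin n × Fin n) → List (Fin n)
  visited = List.map proj₁

  -- Every vertex comes with its parent, the latest one first.
  data Grown : List (Fin n × Fin n) → Set where
    root : ∀ r → Grown ((r , r) ∷ [])
    grow : ∀ {xs x p} → Grown xs → p ∈ visited xs → x ∉ visited xs → Adj p x → Grown ((x , p) ∷ xs)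

  grown-unique : ∀ {xs} → Grown xs → Unique (visited xs)
  grown-unique (root r) = All.[] ∷ []
  grown-unique (grow g _ x∉ _) = All.tabulate (λ a∈ → λ { refl → x∉ a∈ }) ∷ grown-unique g

  data Path : Fin n → Fin n → List (Fin n) → Set where
    stop : ∀ {a} → Path a a (a ∷ [])
    go   : ∀ {a b c l} → Adj a c → Path c b l → Path a b (a ∷ l)

  path-snoc : ∀ {a b c l} → Path a b l → Adj b c → Path a c (l ∷ʳ c)
  path-snoc stop bc = go bc stop
  path-snoc (go ac r) bc = go ac (path-snoc r bc)

  path-linked : ∀ {a b l} → Path a b l → Linked Adj l
  path-linked stop = [-]
  path-linked (go ac stop) = ac ∷ [-]
  path-linked (go ac (go cd r)) = ac ∷ path-linked (go cd r)

  SimplePath : List (Fin n × Fin n) → Fin n → Fin n → Set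
  SimplePath xs a b = ∃[ l ] Path a b l × Unique l × (∀ {v} → v ∈ l → v ∈ visited xs)

  simple-path : ∀ {xs a b} → Grown xs → a ∈ visited xs → b ∈ visited xs → SimplePath xs a b
  simple-path (root r) (here refl) (here refl) = r ∷ [] , stop , All.[] ∷ [] , id
  simple-path (grow g p∈ x∉ px) (here refl) (here refl) =
    _ , stop , All.[] ∷ [] , λ { (here eq) → here eq }
  simple-path (grow g p∈ x∉ px) (here refl) (there b∈) with simple-path g p∈ b∈
  ... | l , path , u , ⊆xs =
    _ , go (sym-Adj px) path , All.tabulate (λ v∈ → λ { refl → x∉ (⊆xs v∈) }) ∷ u ,
    λ { (here eq) → here eq ; (there v∈) → there (⊆xs v∈) }
  simple-path (grow g p∈ x∉ px) (there a∈) (here refl) with simple-path g a∈ p∈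
  ... | l , path , u , ⊆xs =
    _ , path-snoc path px ,
    Unique.++⁺ u (All.[] ∷ []) (λ { (v∈ , here refl) → x∉ (⊆xs v∈) }) ,
    λ v∈ → Sum.[ (λ v∈l → there (⊆xs v∈l)) , (λ { (here eq) → here eq }) ]′ (∈-++⁻ l v∈)
  simple-path (grow g p∈ x∉ px) (there a∈) (there b∈) with simple-path g a∈ b∈
  ... | l , path , u , ⊆xs = l , path , u , λ v∈ → there (⊆xs v∈)

  -- The visited vertices are connected among themselves, so a second neighbour of `x` would be
  -- joined to `p` by a simple path avoiding `x`, and `x` would close a cycle.
  only-parent : ∀ {xs x p a} → Grown xs → p ∈ visited xs → x ∉ visited xs → Adj p x → a ∈ visited xs → Adj a x → a ≡ p
  only-parent {xs} {x} {p} {a} g p∈ x∉ px a∈ ax with simple-path g p∈ a∈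
  ... | _ , stop , _ = refl
  ... | p ∷ l , go pc path , u , ⊆xs = ⊥-elim (acyclic (close pc path u ⊆xs))
    where
    outside : ∀ {l} → (∀ {v} → v ∈ l → v ∈ visited xs) → Unique l → Unique (x ∷ l)
    outside ⊆xs u = All.tabulate (λ v∈ → λ { refl → x∉ (⊆xs v∈) }) ∷ u
    close : ∀ {c l} → Adj p c → Path c a l → Unique (p ∷ l) → (∀ {v} → v ∈ p ∷ l → v ∈ visited xs) → Cycle
    close {c} pc stop u ⊆xs = cycle x p c [] (outside ⊆xs u) (path-linked (go (sym-Adj px) (go pc (path-snoc stop ax))))
    close {c} pc (go cd r) u ⊆xs = cycle x p c _ (outside ⊆xs u) (path-linked (go (sym-Adj px) (go pc (path-snoc (go cd r) ax))))

  spanned-single : ∀ {v : Fin n} {s} → Spanned (rooted v []) s → s ≡ v ∷ []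
  spanned-single (spanned zero refl done) = refl
  spanned-single (spanned (suc zero) () _)
  spanned-single (spanned (suc (suc _)) () _)

  initial-invariant : ∀ {xs} → (∀ v → v ∈ visited xs) → Invariant (visited xs) (λ v → rooted v [])
  initial-invariant all = record
    { alive    = λ _ → [] , refl
    ; dead     = λ {v} v∉ → ⊥-elim (v∉ (all v))
    ; cover    = λ a → a , here refl
    ; disjoint = λ { (here refl) (here refl) → refl }
    ; unique   = λ v → All.[] ∷ []
    ; closed   = λ v → z≤n , tt
    ; cross    = λ { _ (here refl) (here refl) _ → refl , refl }
    ; sound    = λ v sp → subst (λ s → ConnectedOn (_∈ s)) (sym (spanned-single sp)) λ { (here refl) (here refl) → ε }
    ; complete = λ v Q? conn qv ⊆v → [] , done , record { to = ⊆v ; from = λ { (here refl) → qv } }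
    }

  module MergeStep {xs L x p} (g : Grown xs) (p∈ : p ∈ visited xs) (x∉ : x ∉ visited xs) (px : Adj p x)
                   (inv : Invariant (x ∷ visited xs) L) =
    Step inv p∈ x∉ px (only-parent g p∈ x∉ px)

  record Sound (l : Forest n) : Set where
    field
      closed  : Closed l
      unique  : Unique (vertices l)
      spans   : ∀ {s} → Spanned l s → ConnectedOn (_∈ s)

  sound-list : ∀ {xs L} → Invariant xs L → ∀ v → Sound (L v)
  sound-list inv v = record { closed = closed inv v ; unique = unique inv v ; spans = sound inv v }

  sound-smaller : ∀ {xs L} → Invariant xs L → ∀ u v → Sound (smaller (L u) (L v))
  sound-smaller {L = L} inv u v with smaller-below (L u) (L v)
  ... | inj₁ (_ , eq , _) = subst Sound (sym eq) (sound-list inv u)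
  ... | inj₂ (_ , eq , _) = subst Sound (sym eq) (sound-list inv v)

  -- At the end the list of the root contains all vertices. No set can then still be waiting to be
  -- put together, so whatever was not found earlier is spanned by this list, which is processed
  -- last.
  schedule-complete : ∀ {xs L} {Q : Fin n → Set} {a} → Grown xs → Invariant (visited xs) L →
                      Decidable Q → ConnectedOn Q → Q a → Pending L Q → ∃[ l ] l ∈ schedule xs L × Spans l Q
  schedule-complete {L = L} {Q} {a} (root r) inv Q? conn qa pend = L r , here refl , at-root pend
    where
    root-only : ∀ {v b} → b ∈ vertices (L v) → v ≡ r
    root-only {v} {b} b∈ with v Fin.≟ r
    ... | yes v≡r = v≡r
    ... | no v≢r with subst (λ l → b ∈ vertices l) (dead inv λ { (here eq) → v≢r eq }) b∈
    ... | ()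
    at-root : Pending L Q → Spans (L r) Q
    at-root (inj₁ (v , s , sp , enum)) with root-only (spanned-⊆ sp (Enumerates.to enum qa))
    ... | refl = s , sp , enum
    at-root (inj₂ outside) = ⊥-elim (outside r λ {b} _ →
      let v , b∈ = cover inv b in subst (λ v → b ∈ vertices (L v)) (root-only b∈) b∈)
  schedule-complete {L = L} (grow {xs = _ ∷ _} g p∈ x∉ px) inv Q? conn qa pend
    with MergeStep.pending g p∈ x∉ px inv Q? conn qa pend
  ... | inj₁ spans = _ , here refl , spans
  ... | inj₂ pend′ with schedule-complete g (MergeStep.merged g p∈ x∉ px inv) Q? conn qa pend′
  ... | l , l∈ , spans = l , there l∈ , spans

  -- The initial lists are single vertices: singletons are spanned, and every larger set fits into
  -- none of them.
  initially-pending : ∀ {Q : Fin n → Set} {a} → Decidable Q → Q a → Pending (λ v → rooted v []) Q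
  initially-pending {Q} {a} Q? qa with Fin.all? (λ b → Q? b →-dec (b Fin.≟ a))
  ... | yes only = inj₁ (a , a ∷ [] , spanned zero refl done , record
          { to = λ {b} qb → here (only b qb) ; from = λ { (here refl) → qa } })
  ... | no ¬only = inj₂ λ v ⊆v → ¬only λ b qb → lemma (⊆v qb) (⊆v qa)
    where
    lemma : ∀ {v b : Fin n} → b ∈ v ∷ [] → a ∈ v ∷ [] → b ≡ a
    lemma (here refl) (here refl) = refl

  -- Every processed list is paid for by the growth of the total potential, which at the root is at
  -- most `potential n`; the list of the root itself contributes the `n`.
  schedule-length : ∀ {xs L} → Grown xs → Invariant (visited xs) L →
    totalLength (schedule xs L) + sum (λ v → potential (length (L v))) ≤ n + potential n
  schedule-length {L = L} (root r) inv = +-mono-≤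
    (≤-trans (≤-reflexive (+-identityʳ _)) small)
    (≤-trans (≤-reflexive (sum-single (λ v → potential (length (L v))) r others)) (potential-mono small))
    where
    small : length (L r) ≤ n
    small = ≤-trans (≤-reflexive (sym (length-map proj₁ (L r)))) (length-unique (unique inv r))
    others : ∀ v → v ≢ r → potential (length (L v)) ≡ 0
    others v v≢r = cong (λ l → potential (length l)) (dead inv λ { (here eq) → v≢r eq })
  schedule-length {L = L} (grow {xs = xs@(_ ∷ _)} {x} {p} g p∈ x∉ px) inv = begin
      (length small + rest) + sum F        ≡⟨ lemma (length small) rest (sum F) ⟩
      rest + (length small + sum F)        ≤⟨ +-monoʳ-≤ rest paid ⟩
      rest + sum F′                        ≤⟨ schedule-length g inv′ ⟩
      n + potential n ∎
    where
    open ≤-Reasoning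
    open MergeStep g p∈ x∉ px inv using (length-merged) renaming (merged to inv′)
    L′ = merge x p L
    small = smaller (L p) (L x)
    rest = totalLength (schedule xs L′)
    height : Forest n → ℕ
    height l = potential (length l)
    F F₁ F′ : Fin n → ℕ
    F v = potential (length (L v))
    F₁ = F [ x ↦ 0 ]
    F′ v = potential (length (L′ v))
    lemma : ∀ a b c → (a + b) + c ≡ b + (a + c)
    lemma = solve-∀
    F′≡ : ∀ v → F′ v ≡ (F₁ [ p ↦ F′ p ]) v
    F′≡ v = trans (↦-map height (L [ x ↦ [] ]) v)
      (↦-cong {f = λ u → height ((L [ x ↦ [] ]) u)} (↦-map height L) (cong height (sym (↦-same (L [ x ↦ [] ]) p))) v)
    x≢p : p ≢ x
    x≢p refl = x∉ p∈
    alive≥1 : ∀ {v} → v ∈ x ∷ visited xs → 1 ≤ length (L v)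
    alive≥1 v∈ = ≤-trans (s≤s z≤n) (≤-reflexive (sym (cong length (proj₂ (alive inv v∈)))))
    gain : length small + (F p + F x) ≤ F′ p
    gain with smaller-below (L p) (L x)
    ... | inj₁ (le , eq , _) = begin
        length small + (F p + F x)       ≡⟨ cong (λ l → length l + (F p + F x)) eq ⟩
        length (L p) + (F p + F x)       ≤⟨ potential-merge (alive≥1 (there p∈)) le ⟩
        potential (length (L p) + length (L x)) ≡⟨ cong potential length-merged ⟨
        F′ p ∎
    ... | inj₂ (lt , eq , _) = begin
        length small + (F p + F x)       ≡⟨ cong₂ (λ l k → length l + k) eq (+-comm (F p) (F x)) ⟩
        length (L x) + (F x + F p)       ≤⟨ potential-merge (alive≥1 (here refl)) (<⇒≤ lt) ⟩
        potential (length (L x) + length (L p)) ≡⟨ cong potential (trans (+-comm (length (L x)) _) (sym length-merged)) ⟩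
        F′ p ∎
    balance : sum F′ + (F p + F x) ≡ sum F + F′ p
    balance = begin-equality
        sum F′ + (F p + F x)                    ≡⟨ cong₂ (λ s f → s + (f + F x)) (sum-cong-≗ F′≡) (sym (↦-other F x≢p)) ⟩
        sum (F₁ [ p ↦ F′ p ]) + (F₁ p + F x)    ≡⟨ +-assoc (sum (F₁ [ p ↦ F′ p ])) (F₁ p) (F x) ⟨
        (sum (F₁ [ p ↦ F′ p ]) + F₁ p) + F x    ≡⟨ cong (_+ F x) (sum-update F₁ p (F′ p)) ⟩
        (sum F₁ + F′ p) + F x                   ≡⟨ lemma′ (sum F₁) (F′ p) (F x) ⟩
        (sum F₁ + F x) + F′ p                   ≡⟨ cong (_+ F′ p) (trans (sum-update F x 0) (+-identityʳ (sum F))) ⟩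
        sum F + F′ p ∎
      where
      lemma′ : ∀ a b c → (a + b) + c ≡ (a + c) + b
      lemma′ = solve-∀
    paid : length small + sum F ≤ sum F′
    paid = +-cancelʳ-≤ (F p + F x) _ _ (begin
        (length small + sum F) + (F p + F x) ≡⟨ lemma″ (length small) (sum F) (F p + F x) ⟩
        sum F + (length small + (F p + F x)) ≤⟨ +-monoʳ-≤ (sum F) gain ⟩
        sum F + F′ p                         ≡⟨ balance ⟨
        sum F′ + (F p + F x) ∎)
      where
      lemma″ : ∀ a b c → (a + b) + c ≡ b + (a + c)
      lemma″ = solve-∀

-- The program

drop-suc : ∀ {A : Set} k {l : List A} {x m} → drop k l ≡ x ∷ m → drop (suc k) l ≡ m
drop-suc zero    {_ ∷ l} refl = refl
drop-suc (suc k) {_ ∷ l} eq   = drop-suc k eq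

drop-< : ∀ {A : Set} k {l : List A} {x m} → drop k l ≡ x ∷ m → k < length l
drop-< zero    {_ ∷ l} eq = s≤s z≤n
drop-< (suc k) {_ ∷ l} eq = s≤s (drop-< k eq)

drop-tabulate : ∀ {A : Set} {n} (f : Fin n → A) v m → ∃[ r ] drop (toℕ v) (tabulate f ++ m) ≡ f v ∷ r
drop-tabulate f Fin.zero    m = _ , refl
drop-tabulate f (Fin.suc v) m = drop-tabulate (λ u → f (Fin.suc u)) v m

-- Positions in the input word

module Encoding {n} (G : BicoloredGraph n) where

  open BicoloredGraph G

  blue red : Fin n → ℕ
  blue v = if lookup B v then w v else 0
  red  v = if lookup B v then 0 else w v

  word : List ℕ
  word = encode G

  ends : List (Fin n × Fin n) → List ℕ
  ends = concatMap (λ (u , v) → toℕ u ∷ toℕ v ∷ [])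

  bits : List ℕ
  bits = tabulate (λ v → bit (lookup B v))

  inputAt : ℕ → ℕ
  inputAt i = fromMaybe 0 (word at i)

  read : ∀ k {x m} → drop k word ≡ x ∷ m → inputAt k ≡ x
  read k eq = cong (λ l → fromMaybe 0 (head l)) eq

  drop-weights : ∀ k → drop (2 + (n + k)) word ≡ drop k (bits ++ ends edges)
  drop-weights k = subst (λ j → drop (j + k) (tabulate w ++ bits ++ ends edges) ≡ drop k (bits ++ ends edges))
    (length-tabulate w) (drop-length+ (tabulate w) k)

  at-weight : ∀ v → ∃[ r ] drop (2 + toℕ v) word ≡ w v ∷ r
  at-weight v = drop-tabulate w v (bits ++ ends edges)

  at-bit : ∀ v → ∃[ r ] drop (2 + toℕ v + n) word ≡ bit (lookup B v) ∷ r
  at-bit v = let r , eq = drop-tabulate (λ v → bit (lookup B v)) v (ends edges) in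
    r , trans (cong (λ k → drop (2 + k) word) (+-comm (toℕ v) n)) (trans (drop-weights (toℕ v)) eq)

  at-edges : drop (2 + n + n) word ≡ ends edges
  at-edges = trans (drop-weights n) (trans
    (subst (λ k → drop k (bits ++ ends edges) ≡ ends edges)
      (trans (+-identityʳ _) (length-tabulate (λ v → bit (lookup B v)))) (drop-length+ bits 0)) refl)

  length-ends : ∀ es → length (ends es) ≡ length es + length es
  length-ends [] = refl
  length-ends (e ∷ es) = cong suc (trans (cong suc (length-ends es)) (sym (+-suc (length es) (length es))))

  length-word : length word ≡ 2 + n + n + length edges + length edges
  length-word = cong (2 +_) (begin
      length (tabulate w ++ bits ++ ends edges)            ≡⟨ length-++ (tabulate w) ⟩
      length (tabulate w) + length (bits ++ ends edges)    ≡⟨ cong₂ _+_ (length-tabulate w) (length-++ bits) ⟩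
      n + (length bits + length (ends edges))              ≡⟨ cong₂ (λ x y → n + (x + y)) (length-tabulate (λ v → bit (lookup B v))) (length-ends edges) ⟩
      n + (n + (length edges + length edges))              ≡⟨ lemma n (length edges) ⟩
      n + n + length edges + length edges ∎)
    where
    open ≡-Reasoning
    lemma : ∀ n m → n + (n + (m + m)) ≡ n + n + m + m
    lemma = solve-∀

-- Reading the vertices and laying out the memory

rTwo rTot rCnt rPass rE rPtr rU rV rY : ℕ
rTwo  = 28
rTot  = 29
rCnt  = 30
rPass = 31
rE    = 32
rPtr  = 33
rU    = 34
rV    = 35
rY    = 36

-- Marks of visited vertices, the vertices in the order of growth and their parents, and for every
-- vertex the position and length of its list in `aVertex` and `aDesc`.
aVis aOrd aPar aAddr aLen : Fin 16
aVis  = # 0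
aOrd  = # 1
aPar  = # 2
aAddr = # 3
aLen  = # 4

-- The colour stands `n` cells behind the weight. Every vertex also receives its initial list, of
-- length 1 at the position given by its number; its count of descendants is already 0 in the fresh
-- memory.
readVertex : List Op
readVertex = minus rC rC rOne ∷ plus rT rTwo rC ∷ input rW rT ∷ plus rT rT rN ∷ input rB rT ∷ plus rTot rTot rW
  ∷ put aAddr rC rC ∷ put aLen rC rOne ∷ put aVertex rC rC ∷ []

-- The cells 0 to `K` become the row of the empty list. Its single nonzero value is at index `O`:
-- the empty set, of weight 0, stored as 1. It is also the first best set.
startOps layoutOps : List Op
startOps  = set rOne 1 ∷ set rTwo 2 ∷ plus rC rN rZero ∷ []
layoutOps = plus rO rTot rOne ∷ plus rK rO rO ∷ plus rH rN rZero ∷ put aWeight rO rOne ∷ plus rF rK rOne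
  ∷ plus rBest rO rZero ∷ []

initVertex initialise : Cmd
initVertex = ops readVertex
  ⨾ ifZero rB (ops (put aRed rC rW ∷ put aBlue rC rZero ∷ [])) (ops (put aBlue rC rW ∷ put aRed rC rZero ∷ []))
initialise = ops startOps ⨾ while rC initVertex ⨾ ops layoutOps

module Initialisation {n} (G : BicoloredGraph n) where

  open BicoloredGraph G
  open Encoding G
  open Execution (length word)
  open CostLogic (length word)

  σ₀ : Store
  σ₀ = mk (((λ _ → 0) [ rN ≔ n ]) [ rM ≔ length edges ]) inputAt (λ _ _ → 0)

  weights : List ℕ
  weights = tabulate w

  record Entered (k : ℕ) (τ : Store) : Set where
    field
      k≤n    : k ≤ n
      C≡     : var τ rC ≡ k
      tot≡   : var τ rTot ≡ ListAction.sum (drop k weights)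
      addr   : ∀ (v : Fin n) → k ≤ toℕ v → arr τ 3 (toℕ v) ≡ toℕ v
      len    : ∀ (v : Fin n) → k ≤ toℕ v → arr τ 4 (toℕ v) ≡ 1
      vertex : ∀ (v : Fin n) → k ≤ toℕ v → arr τ 5 (toℕ v) ≡ toℕ v
      blues  : ∀ v → k ≤ toℕ v → arr τ 11 (toℕ v) ≡ blue v
      reds   : ∀ v → k ≤ toℕ v → arr τ 12 (toℕ v) ≡ red v

  extend : ∀ {f : ℕ → ℕ} {g : Fin n → ℕ} {k x} v₀ → toℕ v₀ ≡ k → x ≡ g v₀ →
           (∀ v → suc k ≤ toℕ v → f (toℕ v) ≡ g v) → ∀ v → k ≤ toℕ v → (f [ k ≔ x ]) (toℕ v) ≡ g v
  extend {f} v₀ refl refl h v k≤ with m≤n⇒m<n∨m≡n k≤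
  ... | inj₁ k< = trans (≔-other f (λ eq → <⇒≢ k< (sym eq))) (h v k<)
  ... | inj₂ eq with toℕ-injective eq
  ... | refl = ≔-same f (toℕ v)

  record ReadVertex (ρ : Store) (v : Fin n) (τ : Store) : Set where
    field
      C≡   : var τ rC ≡ toℕ v
      W≡   : var τ rW ≡ w v
      B≡   : var τ rB ≡ bit (lookup B v)
      tot≡ : var τ rTot ≡ var ρ rTot + w v
      arr≡ : arr τ ≡ ((arr ρ [ 3 ∙ toℕ v ≔ toℕ v ]) [ 4 ∙ toℕ v ≔ 1 ]) [ 5 ∙ toℕ v ≔ toℕ v ]

  readVertex-correct : ∀ {v} ρ → var ρ rOne ≡ 1 → var ρ rTwo ≡ 2 → var ρ rN ≡ n → inp ρ ≡ inputAt →
                       var ρ rC ≡ suc (toℕ v) → Ensures (ops readVertex) ρ 40 (ReadVertex ρ v)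
  readVertex-correct {v} ρ one≡ two≡ N≡ inp≡ c≡ = relax! (ops-rule readVertex
      (tt , tt , safe-w , tt , safe-b , tt , tt , tt , tt , tt) (record
      { C≡ = C≡ ; W≡ = W≡ ; B≡ = B≡ ; tot≡ = cong (var ρ rTot +_) W≡ ; arr≡ = arr≡ }))
    where
    C≡ : var ρ rC ∸ var ρ rOne ≡ toℕ v
    C≡ = cong₂ _∸_ c≡ one≡
    T≡ : var ρ rTwo + (var ρ rC ∸ var ρ rOne) ≡ 2 + toℕ v
    T≡ = cong₂ _+_ two≡ C≡
    T′≡ : var ρ rTwo + (var ρ rC ∸ var ρ rOne) + var ρ rN ≡ 2 + toℕ v + n
    T′≡ = cong₂ _+_ T≡ N≡
    safe-w : var ρ rTwo + (var ρ rC ∸ var ρ rOne) < length word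
    safe-w = subst (_< length word) (sym T≡) (drop-< (2 + toℕ v) {word} {m = proj₁ (at-weight v)} (proj₂ (at-weight v)))
    safe-b : var ρ rTwo + (var ρ rC ∸ var ρ rOne) + var ρ rN < length word
    safe-b = subst (_< length word) (sym T′≡) (drop-< (2 + toℕ v + n) {word} {m = proj₁ (at-bit v)} (proj₂ (at-bit v)))
    W≡ : inp ρ (var ρ rTwo + (var ρ rC ∸ var ρ rOne)) ≡ w v
    W≡ = trans (cong₂ (λ (f : ℕ → ℕ) k → f k) inp≡ T≡) (read (2 + toℕ v) {m = proj₁ (at-weight v)} (proj₂ (at-weight v)))
    B≡ : inp ρ (var ρ rTwo + (var ρ rC ∸ var ρ rOne) + var ρ rN) ≡ bit (lookup B v)
    B≡ = trans (cong₂ (λ (f : ℕ → ℕ) k → f k) inp≡ T′≡) (read (2 + toℕ v + n) {m = proj₁ (at-bit v)} (proj₂ (at-bit v)))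
    c′ : ℕ
    c′ = var ρ rC ∸ var ρ rOne
    arr≡ : ((arr ρ [ 3 ∙ c′ ≔ c′ ]) [ 4 ∙ c′ ≔ var ρ rOne ]) [ 5 ∙ c′ ≔ c′ ] ≡
           ((arr ρ [ 3 ∙ toℕ v ≔ toℕ v ]) [ 4 ∙ toℕ v ≔ 1 ]) [ 5 ∙ toℕ v ≔ toℕ v ]
    arr≡ = cong₂ (λ c o → ((arr ρ [ 3 ∙ c ≔ c ]) [ 4 ∙ c ≔ o ]) [ 5 ∙ c ≔ c ]) C≡ one≡

  initVertex-correct : ∀ {k} ρ → var ρ rOne ≡ 1 → var ρ rTwo ≡ 2 → var ρ rN ≡ n → var ρ rZero ≡ 0 → inp ρ ≡ inputAt →
                       Entered (suc k) ρ → Ensures initVertex ρ 60 (Entered k)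
  initVertex-correct {k} ρ one≡ two≡ N≡ zero≡ inp≡ ent =
    relax! (⨾-rule (framed rest (readVertex-correct {v} ρ one≡ two≡ N≡ inp≡ (trans C≡ (cong suc (sym v≡))))))
    where
    open Entered ent
    v : Fin n
    v = fromℕ< k≤n
    v≡ : toℕ v ≡ k
    v≡ = toℕ-fromℕ< k≤n
    sum≡ : ListAction.sum (drop k weights) ≡ w v + ListAction.sum (drop (suc k) weights)
    sum≡ with drop-tabulate w v []
    ... | r , eq = trans (cong ListAction.sum here≡) (cong (λ l → w v + ListAction.sum l) (sym (drop-suc k here≡)))
      where
      here≡ : drop k weights ≡ w v ∷ r
      here≡ = trans (cong₂ drop (sym v≡) (sym (++-identityʳ weights))) eq
    rest : ∀ τ → Frame (ops readVertex) ρ τ → ReadVertex ρ v τ →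
           Ensures (ifZero rB (ops (put aRed rC rW ∷ put aBlue rC rZero ∷ [])) (ops (put aBlue rC rW ∷ put aRed rC rZero ∷ []))) τ 14 (Entered k)
    rest τ fr rd = ifZero-rule (λ b≡0 → ops-rule _ _ (entered-red b≡0)) (λ b≢0 → ops-rule _ _ (entered-blue b≢0))
      where
      open ReadVertex rd renaming (C≡ to C≡′; tot≡ to tot≡′)
      zero≡′ : var τ rZero ≡ 0
      zero≡′ = trans (keep fr rZero tt) zero≡
      common : ∀ {τ′ : Store} → (∀ {r} → var τ′ r ≡ var τ r) → arr τ′ 3 ≡ arr τ 3 → arr τ′ 4 ≡ arr τ 4 → arr τ′ 5 ≡ arr τ 5 →
               arr τ′ 11 ≡ arr ρ 11 [ toℕ v ≔ blue v ] → arr τ′ 12 ≡ arr ρ 12 [ toℕ v ≔ red v ] → Entered k τ′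
      common vs eq₃ eq₄ eq₅ eq₁₁ eq₁₂ = record
        { k≤n = <⇒≤ k≤n
        ; C≡ = trans vs (trans C≡′ v≡)
        ; tot≡ = trans vs (trans tot≡′ (trans (cong (_+ w v) tot≡) (trans (+-comm _ (w v)) (sym sum≡))))
        ; addr = λ u k≤ → trans (cong (λ f → f (toℕ u)) (trans eq₃ (cong (λ A → A 3) arr≡))) (ext (arr ρ 3) addr refl u k≤)
        ; len = λ u k≤ → trans (cong (λ f → f (toℕ u)) (trans eq₄ (cong (λ A → A 4) arr≡))) (ext (arr ρ 4) len refl u k≤)
        ; vertex = λ u k≤ → trans (cong (λ f → f (toℕ u)) (trans eq₅ (cong (λ A → A 5) arr≡))) (ext (arr ρ 5) vertex refl u k≤)
        ; blues = λ u k≤ → trans (cong (λ f → f (toℕ u)) eq₁₁) (ext (arr ρ 11) blues refl u k≤)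
        ; reds = λ u k≤ → trans (cong (λ f → f (toℕ u)) eq₁₂) (ext (arr ρ 12) reds refl u k≤)
        }
        where
        ext : ∀ (f : ℕ → ℕ) {g : Fin n → ℕ} {x} → (∀ u → suc k ≤ toℕ u → f (toℕ u) ≡ g u) → x ≡ g v →
              ∀ u → k ≤ toℕ u → (f [ toℕ v ≔ x ]) (toℕ u) ≡ g u
        ext f h eq u k≤ = extend {f} v refl eq (λ u lt → h u (subst (λ j → suc j ≤ toℕ u) v≡ lt)) u (subst (_≤ toℕ u) (sym v≡) k≤)
      entered-red : var τ rB ≡ 0 → Entered k (mk (var τ) (inp τ) ((arr τ [ 12 ∙ var τ rC ≔ var τ rW ]) [ 11 ∙ var τ rC ≔ var τ rZero ]))
      entered-red b≡0 = common refl refl refl refl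
        (trans (cong₂ (λ c x → arr τ 11 [ c ≔ x ]) C≡′ (trans zero≡′ (sym (proj₁ red′)))) (cong (λ A → A 11 [ toℕ v ≔ blue v ]) arr≡))
        (trans (cong₂ (λ c x → arr τ 12 [ c ≔ x ]) C≡′ (trans W≡ (sym (proj₂ red′)))) (cong (λ A → A 12 [ toℕ v ≔ red v ]) arr≡))
        where
        red′ : blue v ≡ 0 × red v ≡ w v
        red′ with lookup B v | B≡
        ... | false | _  = refl , refl
        ... | true  | b≡ = ⊥-elim (0≢1+n (trans (sym b≡0) b≡))
      entered-blue : var τ rB ≢ 0 → Entered k (mk (var τ) (inp τ) ((arr τ [ 11 ∙ var τ rC ≔ var τ rW ]) [ 12 ∙ var τ rC ≔ var τ rZero ]))
      entered-blue b≢0 = common refl refl refl refl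
        (trans (cong₂ (λ c x → arr τ 11 [ c ≔ x ]) C≡′ (trans W≡ (sym (proj₁ blue′)))) (cong (λ A → A 11 [ toℕ v ≔ blue v ]) arr≡))
        (trans (cong₂ (λ c x → arr τ 12 [ c ≔ x ]) C≡′ (trans zero≡′ (sym (proj₂ blue′)))) (cong (λ A → A 12 [ toℕ v ≔ red v ]) arr≡))
        where
        blue′ : blue v ≡ w v × red v ≡ 0
        blue′ with lookup B v | B≡
        ... | true  | _  = refl , refl
        ... | false | b≡ = ⊥-elim (b≢0 b≡)

  sum-weights : ∀ {k} (f : Fin k → ℕ) → ListAction.sum (tabulate f) ≡ sum f
  sum-weights {zero}  f = refl
  sum-weights {suc k} f = cong (f Fin.zero +_) (sum-weights (λ v → f (Fin.suc v)))

  W : ℕ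
  W = totalWeight

  open Rows blue red W using (K; O)

  record Initialised (τ : Store) : Set where
    field
      one≡    : var τ rOne ≡ 1
      two≡    : var τ rTwo ≡ 2
      zero≡   : var τ rZero ≡ 0
      N≡      : var τ rN ≡ n
      M≡      : var τ rM ≡ length edges
      K≡      : var τ rK ≡ K
      O≡      : var τ rO ≡ O
      H≡      : var τ rH ≡ n
      F≡      : var τ rF ≡ suc K
      best≡   : var τ rBest ≡ O
      inp≡    : inp τ ≡ inputAt
      addr    : ∀ (v : Fin n) → arr τ 3 (toℕ v) ≡ toℕ v
      len     : ∀ (v : Fin n) → arr τ 4 (toℕ v) ≡ 1
      vertex  : ∀ (v : Fin n) → arr τ 5 (toℕ v) ≡ toℕ v
      desc    : ∀ i → arr τ 6 i ≡ 0
      blue≡   : ∀ v → arr τ 11 (toℕ v) ≡ blue v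
      red≡    : ∀ v → arr τ 12 (toℕ v) ≡ red v
      vis     : ∀ i → arr τ 0 i ≡ 0
      ord     : ∀ i → arr τ 1 i ≡ 0
      par     : ∀ i → arr τ 2 i ≡ 0
      nodes   : ∀ i → arr τ 10 i ≡ 0
      weights≡ : ∀ i → arr τ 8 i ≡ ((λ _ → 0) [ O ≔ 1 ]) i

  initialise-correct : Ensures initialise σ₀ (3 + ((n * 62 + 1) + 20)) Initialised
  initialise-correct =
    ops-then startOps 3 _ (⨾-rule (framed finish (while-rule Entered (λ _ _ → Entered.C≡)
      (λ k ρ fr ent → initVertex-correct ρ (keep fr rOne tt) (keep fr rTwo tt) (keep fr rN tt) (keep fr rZero tt)
         (keepInp fr tt) ent) n start)))
    where
    past : ∀ (v : Fin n) → n ≤ toℕ v → ⊥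
    past v le = <⇒≱ (toℕ<n v) le
    drop-all : ∀ k (l : List ℕ) → length l ≡ k → drop k l ≡ []
    drop-all zero    []      _  = refl
    drop-all (suc k) (_ ∷ l) eq = drop-all k l (suc-injective eq)
    start : Entered n (evals startOps σ₀)
    start = record
      { k≤n = ≤-refl ; C≡ = +-identityʳ n
      ; tot≡ = cong ListAction.sum (sym (drop-all n weights (length-tabulate w)))
      ; addr = λ v le → ⊥-elim (past v le)
      ; len = λ v le → ⊥-elim (past v le)
      ; vertex = λ v le → ⊥-elim (past v le)
      ; blues = λ v le → ⊥-elim (past v le)
      ; reds = λ v le → ⊥-elim (past v le)
      }
    finish : ∀ τ → Frame (while rC initVertex) (evals startOps σ₀) τ → Entered 0 τ →
             Ensures (ops layoutOps) τ 20 Initialised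
    finish τ fr ent = relax! (ops-rule layoutOps _ (record
        { one≡ = one≡ ; two≡ = keep fr rTwo tt ; zero≡ = zero≡ ; N≡ = N≡ ; M≡ = keep fr rM tt
        ; K≡ = cong₂ _+_ O≡ O≡ ; O≡ = O≡ ; H≡ = H≡ ; F≡ = F≡ ; best≡ = best≡
        ; inp≡ = keepInp fr tt
        ; addr = λ v → addr v z≤n ; len = λ v → len v z≤n ; vertex = λ v → vertex v z≤n
        ; desc = zeros 6 ; blue≡ = λ v → blues v z≤n ; red≡ = λ v → reds v z≤n
        ; vis = zeros 0 ; ord = zeros 1 ; par = zeros 2 ; nodes = zeros 10 ; weights≡ = weights≡
        }))
      where
      open Entered ent
      one≡ : var τ rOne ≡ 1
      one≡ = keep fr rOne tt
      zero≡ : var τ rZero ≡ 0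
      zero≡ = keep fr rZero tt
      N≡ : var τ rN ≡ n
      N≡ = keep fr rN tt
      O≡ : var τ rTot + var τ rOne ≡ O
      O≡ = trans (cong₂ _+_ (trans tot≡ (sum-weights w)) one≡) (+-comm W 1)
      H≡ : var τ rN + var τ rZero ≡ n
      H≡ = trans (cong₂ _+_ N≡ zero≡) (+-identityʳ n)
      F≡ : var τ rTot + var τ rOne + (var τ rTot + var τ rOne) + var τ rOne ≡ suc K
      F≡ = trans (cong₂ _+_ (cong₂ _+_ O≡ O≡) one≡) (+-comm K 1)
      best≡ : var τ rTot + var τ rOne + var τ rZero ≡ O
      best≡ = trans (cong₂ _+_ O≡ zero≡) (+-identityʳ O)
      zeros : ∀ a {_ : Untouched (λ o → writesArrOp o a) (while rC initVertex)} → ∀ i → arr τ a i ≡ 0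
      zeros a {u} i = cong (λ f → f i) (keepArr fr a u)
      weights≡ : ∀ i → (arr τ 8 [ var τ rTot + var τ rOne ≔ var τ rOne ]) i ≡ ((λ _ → 0) [ O ≔ 1 ]) i
      weights≡ i = trans (cong₂ (λ k x → (arr τ 8 [ k ≔ x ]) i) O≡ one≡) (cong (λ f → (f [ O ≔ 1 ]) i) (keepArr fr 8 tt))

-- Growing the tree by scans of the edge list

visitOps probeOps passOps : List Op
visitOps = put aVis rX rOne ∷ put aOrd rCnt rX ∷ put aPar rCnt rY ∷ plus rCnt rCnt rOne ∷ []
probeOps = input rU rPtr ∷ plus rPtr rPtr rOne ∷ input rV rPtr ∷ plus rPtr rPtr rOne ∷ minus rE rE rOne
  ∷ get rA aVis rU ∷ get rB aVis rV ∷ []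
passOps = minus rPass rPass rOne ∷ plus rPtr rTwo rN ∷ plus rPtr rPtr rN ∷ plus rE rM rZero ∷ []

-- Repeated scans spare the construction of adjacency lists. There are `n` passes over fewer than a
-- constant times `n` edges, which the final bound can afford.
branchEdge tryEdge scanEdges growTree : Cmd
branchEdge = ifZero rA
  (ifZero rB (ops []) (ops (plus rX rU rZero ∷ plus rY rV rZero ∷ visitOps)))
  (ifZero rB (ops (plus rX rV rZero ∷ plus rY rU rZero ∷ visitOps)) (ops []))
tryEdge = ops probeOps ⨾ branchEdge
scanEdges = ops passOps ⨾ while rE tryEdge
growTree = ops (put aVis rZero rOne ∷ plus rCnt rOne rZero ∷ plus rPass rN rZero ∷ []) ⨾ while rPass scanEdges

-- The list has the latest vertex first while the arrays have it last, so the head stands at the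
-- index given by the length of the tail.
Ordered : ∀ {n} → Memory → List (Fin n × Fin n) → Set
Ordered A []             = ⊤
Ordered A ((x , p) ∷ xs) = A 1 (length xs) ≡ toℕ x × A 2 (length xs) ≡ toℕ p × Ordered A xs

ordered-put : ∀ {n A B k x y} (xs : List (Fin n × Fin n)) → length xs ≤ k → B 1 ≡ A 1 [ k ≔ x ] → B 2 ≡ A 2 [ k ≔ y ] →
              Ordered A xs → Ordered B xs
ordered-put [] _ _ _ _ = tt
ordered-put {A = A} (_ ∷ xs) lt eq₁ eq₂ (x≡ , y≡ , o) =
  trans (cong (λ f → f (length xs)) eq₁) (trans (≔-other (A 1) (<⇒≢ lt)) x≡) ,
  trans (cong (λ f → f (length xs)) eq₂) (trans (≔-other (A 2) (<⇒≢ lt)) y≡) ,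
  ordered-put xs (<⇒≤ lt) eq₁ eq₂ o

ordered-cong : ∀ {n A B} (xs : List (Fin n × Fin n)) → B 1 ≡ A 1 → B 2 ≡ A 2 → Ordered A xs → Ordered B xs
ordered-cong [] _ _ _ = tt
ordered-cong (_ ∷ xs) eq₁ eq₂ (x≡ , y≡ , o) =
  trans (cong (λ f → f _) eq₁) x≡ , trans (cong (λ f → f _) eq₂) y≡ , ordered-cong xs eq₁ eq₂ o

module GrowPhase {n} (G : BicoloredGraph n) (tree : BicoloredGraph.IsTree G) where

  open BicoloredGraph G
  open IsTree tree using (connected)
  open Encoding G
  open Growth G tree
  open Execution (length word)
  open CostLogic (length word)

  Flag : List (Fin n) → Fin n → ℕ → Set
  Flag vs v b = (v ∈ vs × b ≡ 1) ⊎ (v ∉ vs × b ≡ 0)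

  record Visits (xs : List (Fin n × Fin n)) (τ : Store) : Set where
    field
      Cnt≡    : var τ rCnt ≡ length xs
      vis     : ∀ v → Flag (visited xs) v (arr τ 0 (toℕ v))
      ordered : Ordered (arr τ) xs

  visited-step : ∀ {xs x p} ρ → x ∉ visited xs → Visits xs ρ → var ρ rX ≡ toℕ x → var ρ rY ≡ toℕ p → var ρ rOne ≡ 1 →
                 Visits ((x , p) ∷ xs) (evals visitOps ρ)
  visited-step {xs} {x} {p} ρ x∉ vs X≡ Y≡ one≡ = record { Cnt≡ = Cnt≡′ ; vis = vis′ ; ordered = x≡ , p≡ , ordered′ }
    where
    open Visits vs
    Cnt≡′ : var ρ rCnt + var ρ rOne ≡ suc (length xs)
    Cnt≡′ = trans (cong₂ _+_ Cnt≡ one≡) (+-comm (length xs) 1)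
    vis≡ : ∀ i → (arr ρ 0 [ var ρ rX ≔ var ρ rOne ]) i ≡ (arr ρ 0 [ toℕ x ≔ 1 ]) i
    vis≡ i = cong₂ (λ a b → (arr ρ 0 [ a ≔ b ]) i) X≡ one≡
    vis′ : ∀ v → Flag (x ∷ visited xs) v ((arr ρ 0 [ var ρ rX ≔ var ρ rOne ]) (toℕ v))
    vis′ v with v Fin.≟ x
    ... | yes refl = inj₁ (here refl , trans (vis≡ (toℕ v)) (≔-same (arr ρ 0) (toℕ v)))
    ... | no v≢x with vis v
    ... | inj₁ (v∈ , eq) = inj₁ (there v∈ , trans (vis≡ (toℕ v)) (trans (≔-other (arr ρ 0) (λ eq → v≢x (toℕ-injective eq))) eq))
    ... | inj₂ (v∉ , eq) = inj₂ ((λ { (here eq) → v≢x eq ; (there v∈) → v∉ v∈ }) ,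
            trans (vis≡ (toℕ v)) (trans (≔-other (arr ρ 0) (λ eq → v≢x (toℕ-injective eq))) eq))
    x≡ : (arr ρ 1 [ var ρ rCnt ≔ var ρ rX ]) (length xs) ≡ toℕ x
    x≡ = trans (cong (λ k → (arr ρ 1 [ k ≔ var ρ rX ]) (length xs)) Cnt≡) (trans (≔-same (arr ρ 1) (length xs)) X≡)
    p≡ : (arr ρ 2 [ var ρ rCnt ≔ var ρ rY ]) (length xs) ≡ toℕ p
    p≡ = trans (cong (λ k → (arr ρ 2 [ k ≔ var ρ rY ]) (length xs)) Cnt≡) (trans (≔-same (arr ρ 2) (length xs)) Y≡)
    ordered′ : Ordered (arr (evals visitOps ρ)) xs
    ordered′ = ordered-put {A = arr ρ} {B = arr (evals visitOps ρ)} xs (≤-reflexive (sym Cnt≡)) refl refl ordered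

  Settled : List (Fin n) → Fin n × Fin n → Set
  Settled vs (u , v) = (u ∈ vs × v ∈ vs) ⊎ (u ∉ vs × v ∉ vs)

  -- If no edge leaves the visited set, the set is closed under adjacency; it is nonempty, so
  -- connectedness makes it everything.
  settled-complete : ∀ {xs} → Grown xs → (∀ {e} → e ∈ edges → Settled (visited xs) e) → ∀ v → v ∈ visited xs
  settled-complete {xs} g settled v = connected-walk (connected (proj₁ (some g)) v) (proj₂ (some g))
    where
    some : ∀ {xs} → Grown xs → ∃[ r ] r ∈ visited xs
    some (root r) = r , here refl
    some (grow {x = x} _ _ _ _) = x , here refl
    cross-edge : ∀ {u v} → Adj u v → u ∈ visited xs → v ∈ visited xs
    cross-edge (inj₁ e) u∈ with settled e
    ... | inj₁ (_ , v∈) = v∈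
    ... | inj₂ (u∉ , _) = ⊥-elim (u∉ u∈)
    cross-edge (inj₂ e) u∈ with settled e
    ... | inj₁ (v∈ , _) = v∈
    ... | inj₂ (_ , u∉) = ⊥-elim (u∉ u∈)
    connected-walk : ∀ {u v} → Star Adj u v → u ∈ visited xs → v ∈ visited xs
    connected-walk ε u∈ = u∈
    connected-walk (uv ◅ r) u∈ = connected-walk r (cross-edge uv u∈)

  data Outcome (xs : List (Fin n × Fin n)) (e : Fin n × Fin n) (τ : Store) : Set where
    same : Settled (visited xs) e → Visits xs τ → Outcome xs e τ
    more : ∀ {x p} → Grown ((x , p) ∷ xs) → Visits ((x , p) ∷ xs) τ → Outcome xs e τ

  record Probed (xs : List (Fin n × Fin n)) (u v : Fin n) (ρ : Store) : Set where
    field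
      U≡    : var ρ rU ≡ toℕ u
      V≡    : var ρ rV ≡ toℕ v
      A≡    : Flag (visited xs) u (var ρ rA)
      B≡    : Flag (visited xs) v (var ρ rB)
      one≡  : var ρ rOne ≡ 1
      zero≡ : var ρ rZero ≡ 0
      visits : Visits xs ρ

  branchEdge-correct : ∀ {xs u v} ρ → Grown xs → (u , v) ∈ edges → Probed xs u v ρ →
                       Ensures branchEdge ρ 50 (Outcome xs (u , v))
  branchEdge-correct {xs} {u} {v} ρ g e∈ pr = relax! (ifZero-rule
      (λ a≡0 → ifZero-rule
        (λ b≡0 → relax {b′ = 40} z≤n (ops-rule [] _ (same (inj₂ (out A≡ a≡0 , out B≡ b≡0)) visits)))
        (λ b≢0 → relax! (ops-rule _ _ (more (grow g (inn B≡ b≢0) (out A≡ a≡0) (inj₂ e∈))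
          (visited-step (evals (plus rX rU rZero ∷ plus rY rV rZero ∷ []) ρ) (out A≡ a≡0) (visits-evals refl visits) U≡′ V≡′ one≡)))))
      (λ a≢0 → ifZero-rule
        (λ b≡0 → relax! (ops-rule _ _ (more (grow g (inn A≡ a≢0) (out B≡ b≡0) (inj₁ e∈))
          (visited-step (evals (plus rX rV rZero ∷ plus rY rU rZero ∷ []) ρ) (out B≡ b≡0) (visits-evals refl visits) V≡′ U≡′ one≡))))
        (λ b≢0 → relax {b′ = 40} z≤n (ops-rule [] _ (same (inj₁ (inn A≡ a≢0 , inn B≡ b≢0)) visits)))))
    where
    open Probed pr
    out : ∀ {v b} → Flag (visited xs) v b → b ≡ 0 → v ∉ visited xs
    out (inj₁ (_ , b≡1)) b≡0 = ⊥-elim (0≢1+n (trans (sym b≡0) b≡1))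
    out (inj₂ (v∉ , _)) _ = v∉
    inn : ∀ {v b} → Flag (visited xs) v b → b ≢ 0 → v ∈ visited xs
    inn (inj₁ (v∈ , _)) _ = v∈
    inn (inj₂ (_ , b≡0)) b≢0 = ⊥-elim (b≢0 b≡0)
    U≡′ : var ρ rU + var ρ rZero ≡ toℕ u
    U≡′ = trans (cong₂ _+_ U≡ zero≡) (+-identityʳ (toℕ u))
    V≡′ : var ρ rV + var ρ rZero ≡ toℕ v
    V≡′ = trans (cong₂ _+_ V≡ zero≡) (+-identityʳ (toℕ v))
    visits-evals : ∀ {f : ℕ → ℕ} → f rCnt ≡ var ρ rCnt → Visits xs ρ → Visits xs (mk f (inp ρ) (arr ρ))
    visits-evals eq vs = record { Cnt≡ = trans eq (Visits.Cnt≡ vs) ; vis = Visits.vis vs ; ordered = Visits.ordered vs }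

  probe-correct : ∀ {xs u v k es} ρ → Visits xs ρ → drop k word ≡ toℕ u ∷ toℕ v ∷ es → var ρ rPtr ≡ k →
    var ρ rOne ≡ 1 → var ρ rZero ≡ 0 → inp ρ ≡ inputAt →
    Ensures (ops probeOps) ρ 20 (λ τ → Probed xs u v τ × var τ rPtr ≡ 2 + k × var τ rE ≡ var ρ rE ∸ 1)
  probe-correct {xs} {u} {v} {k} {es} ρ vs eq ptr≡ one≡ zero≡ inp≡ =
    relax! (ops-rule probeOps (safe-u , tt , safe-v , tt , tt , tt , tt , tt) (record
      { U≡ = U≡ ; V≡ = V≡
      ; A≡ = subst (λ i → Flag (visited xs) u (arr ρ 0 i)) (sym U≡) (Visits.vis vs u)
      ; B≡ = subst (λ i → Flag (visited xs) v (arr ρ 0 i)) (sym V≡) (Visits.vis vs v)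
      ; one≡ = one≡ ; zero≡ = zero≡
      ; visits = record { Cnt≡ = Visits.Cnt≡ vs ; vis = Visits.vis vs ; ordered = Visits.ordered vs }
      } , ptr≡″ , cong (var ρ rE ∸_) one≡))
    where
    eq′ : drop (suc k) word ≡ toℕ v ∷ es
    eq′ = drop-suc k eq
    ptr≡′ : var ρ rPtr + var ρ rOne ≡ suc k
    ptr≡′ = trans (cong₂ _+_ ptr≡ one≡) (+-comm k 1)
    ptr≡″ : var ρ rPtr + var ρ rOne + var ρ rOne ≡ 2 + k
    ptr≡″ = trans (cong₂ _+_ ptr≡′ one≡) (+-comm (suc k) 1)
    safe-u : var ρ rPtr < length word
    safe-u = subst (_< length word) (sym ptr≡) (drop-< k {word} eq)
    safe-v : var ρ rPtr + var ρ rOne < length word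
    safe-v = subst (_< length word) (sym ptr≡′) (drop-< (suc k) {word} eq′)
    U≡ : inp ρ (var ρ rPtr) ≡ toℕ u
    U≡ = trans (cong₂ (λ (f : ℕ → ℕ) i → f i) inp≡ ptr≡) (read k eq)
    V≡ : inp ρ (var ρ rPtr + var ρ rOne) ≡ toℕ v
    V≡ = trans (cong₂ (λ (f : ℕ → ℕ) i → f i) inp≡ ptr≡′) (read (suc k) eq′)

  -- Here `xs` is the order at the start of the pass. `longer` says that the pass has either added a
  -- vertex or met only edges that do not leave the initial set.
  record Scanned (xs : List (Fin n × Fin n)) (k : ℕ) (τ : Store) : Set where
    field
      {past rest} : List (Fin n × Fin n)
      {now}   : List (Fin n × Fin n)
      {ptr}   : ℕ
      split   : edges ≡ past ++ rest
      rest≡   : length rest ≡ k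
      E≡      : var τ rE ≡ k
      ptr≡    : var τ rPtr ≡ ptr
      at-ptr  : drop ptr word ≡ ends rest
      grown   : Grown now
      visits  : Visits now τ
      grows   : ∀ {v} → v ∈ visited xs → v ∈ visited now
      longer  : length xs < length now ⊎ (now ≡ xs × (∀ {e} → e ∈ past → Settled (visited xs) e))

  tryEdge-correct : ∀ {xs k} ρ → var ρ rOne ≡ 1 → var ρ rZero ≡ 0 → inp ρ ≡ inputAt → Scanned xs (suc k) ρ →
                    Ensures tryEdge ρ 70 (Scanned xs k)
  tryEdge-correct {xs} {k} ρ one≡ zero≡ inp≡ record
    { past = past ; rest = (u , v) ∷ rest ; now = now ; ptr = ptr ; split = split ; rest≡ = rest≡ ; E≡ = E≡ ; ptr≡ = ptr≡
    ; at-ptr = at-ptr ; grown = grown ; visits = visits ; grows = grows ; longer = longer } =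
    ⨾-rule (weaken probed (probe-correct ρ visits at-ptr ptr≡ one≡ zero≡ inp≡))
    where
    split′ : edges ≡ (past ++ (u , v) ∷ []) ++ rest
    split′ = trans split (sym (++-assoc past _ rest))
    probed : ∀ τ → Probed now u v τ × var τ rPtr ≡ 2 + ptr × var τ rE ≡ var ρ rE ∸ 1 → Ensures branchEdge τ 50 (Scanned xs k)
    probed τ (pr , ptr≡′ , E≡′) =
      framed finish (branchEdge-correct τ grown (subst ((u , v) ∈_) (sym split) (∈-++⁺ʳ past (here refl))) pr)
      where
      settle : Settled (visited now) (u , v) →
               length xs < length now ⊎ (now ≡ xs × (∀ {e} → e ∈ past → Settled (visited xs) e)) →
               length xs < length now ⊎ (now ≡ xs × (∀ {e} → e ∈ past ++ (u , v) ∷ [] → Settled (visited xs) e))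
      settle s (inj₁ lt) = inj₁ lt
      settle s (inj₂ (eq , h)) = inj₂ (eq , λ e∈ →
        Sum.[ h , (λ { (here refl) → subst (λ ys → Settled (visited ys) (u , v)) eq s }) ]′ (∈-++⁻ past e∈))
      longer≤ : length xs < length now ⊎ (now ≡ xs × (∀ {e} → e ∈ past → Settled (visited xs) e)) → length xs ≤ length now
      longer≤ (inj₁ lt) = <⇒≤ lt
      longer≤ (inj₂ (eq , _)) = ≤-reflexive (cong length (sym eq))
      scanned : ∀ {τ′ ys} → Frame branchEdge τ τ′ → Grown ys → Visits ys τ′ → (∀ {v} → v ∈ visited xs → v ∈ visited ys) →
                length xs < length ys ⊎ (ys ≡ xs × (∀ {e} → e ∈ past ++ (u , v) ∷ [] → Settled (visited xs) e)) → Scanned xs k τ′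
      scanned fr g vs gr lg = record
        { split = split′ ; rest≡ = suc-injective rest≡
        ; E≡ = trans (keep fr rE tt) (trans E≡′ (cong (_∸ 1) E≡))
        ; ptr≡ = trans (keep fr rPtr tt) ptr≡′
        ; at-ptr = drop-suc (suc ptr) {word} (drop-suc ptr {word} at-ptr)
        ; grown = g ; visits = vs ; grows = gr ; longer = lg }
      finish : ∀ τ′ → Frame branchEdge τ τ′ → Outcome now (u , v) τ′ → Scanned xs k τ′
      finish τ′ fr (same s vs) = scanned fr grown vs grows (settle s longer)
      finish τ′ fr (more g vs) = scanned fr g vs (λ v∈ → there (grows v∈)) (inj₁ (s≤s (longer≤ longer)))

  -- A pass that does not show the tree to be complete adds a vertex, so the length plus the number
  -- of remaining passes stays above `n`. With no pass remaining this would give more than `n`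
  -- distinct vertices.
  record Growing (k : ℕ) (τ : Store) : Set where
    field
      {order}  : List (Fin n × Fin n)
      pass≡    : var τ rPass ≡ k
      grown    : Grown order
      visits   : Visits order τ
      progress : (∀ v → v ∈ visited order) ⊎ n < length order + k

  scanCost : ℕ
  scanCost = 4 + (length edges * 72 + 1)

  scanEdges-correct : ∀ {k} ρ → var ρ rOne ≡ 1 → var ρ rTwo ≡ 2 → var ρ rZero ≡ 0 → var ρ rN ≡ n → var ρ rM ≡ length edges →
                      inp ρ ≡ inputAt → Growing (suc k) ρ → Ensures scanEdges ρ scanCost (Growing k)
  scanEdges-correct {k} ρ one≡ two≡ zero≡ N≡ M≡ inp≡ gr =
    ops-then passOps 4 _ (framed finish (while-rule (Scanned order) (λ _ _ → Scanned.E≡)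
      (λ _ τ fr → tryEdge-correct τ (trans (keep fr rOne tt) one≡) (trans (keep fr rZero tt) zero≡) (trans (keepInp fr tt) inp≡))
      (length edges) start))
    where
    open Growing gr
    ptr≡ : var ρ rTwo + var ρ rN + var ρ rN ≡ 2 + n + n
    ptr≡ = cong₂ _+_ (cong₂ _+_ two≡ N≡) N≡
    E≡ : var ρ rM + var ρ rZero ≡ length edges
    E≡ = trans (cong₂ _+_ M≡ zero≡) (+-identityʳ _)
    start : Scanned order (length edges) (evals passOps ρ)
    start = record
      { past = [] ; split = refl ; rest≡ = refl ; E≡ = E≡ ; ptr≡ = ptr≡ ; at-ptr = at-edges ; grown = grown
      ; visits = record { Cnt≡ = Visits.Cnt≡ visits ; vis = Visits.vis visits ; ordered = Visits.ordered visits }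
      ; grows = id ; longer = inj₂ (refl , λ ()) }
    pass≡′ : var ρ rPass ∸ var ρ rOne ≡ k
    pass≡′ = cong₂ _∸_ pass≡ one≡
    finish : ∀ τ → Frame (while rE tryEdge) (evals passOps ρ) τ → Scanned order 0 τ → Growing k τ
    finish τ fr record { past = past ; rest = [] ; now = now ; split = split ; grown = grown′ ; visits = visits′ ; grows = grows ; longer = longer } =
      record { pass≡ = trans (keep fr rPass tt) pass≡′ ; grown = grown′ ; visits = visits′ ; progress = complete′ progress longer }
      where
      complete′ : (∀ v → v ∈ visited order) ⊎ n < length order + suc k →
                  length order < length now ⊎ (now ≡ order × (∀ {e} → e ∈ past → Settled (visited order) e)) →
                  (∀ v → v ∈ visited now) ⊎ n < length now + k
      complete′ (inj₁ all) _ = inj₁ (λ v → grows (all v))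
      complete′ (inj₂ lt) (inj₁ lt′) = inj₂ (<-≤-trans lt (≤-trans (≤-reflexive (+-suc (length order) k)) (+-monoˡ-≤ k lt′)))
      complete′ (inj₂ lt) (inj₂ (refl , settled)) = inj₁ (settled-complete grown′ λ {e} e∈ →
        settled (subst (e ∈_) (trans split (++-identityʳ past)) e∈))

  record GrownTree (τ : Store) : Set where
    field
      {order}  : List (Fin n × Fin n)
      grown    : Grown order
      Cnt≡     : var τ rCnt ≡ length order
      ordered  : Ordered (arr τ) order
      spanning : ∀ v → v ∈ visited order

  growTree-correct : (∃[ r ] toℕ {n} r ≡ 0) → ∀ σ → var σ rOne ≡ 1 → var σ rTwo ≡ 2 → var σ rZero ≡ 0 → var σ rN ≡ n →
    var σ rM ≡ length edges → inp σ ≡ inputAt → (∀ i → arr σ 0 i ≡ 0) → (∀ i → arr σ 1 i ≡ 0) → (∀ i → arr σ 2 i ≡ 0) →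
    Ensures growTree σ (8 + (n * (2 + scanCost) + 1)) GrownTree
  growTree-correct (r , r≡0) σ one≡ two≡ zero≡ N≡ M≡ inp≡ vis≡ ord≡ par≡ =
    ops-then firstOps 8 _ (weaken finish (while-rule Growing (λ _ _ → Growing.pass≡)
      (λ k ρ fr → scanEdges-correct ρ (trans (keep fr rOne tt) one≡) (trans (keep fr rTwo tt) two≡) (trans (keep fr rZero tt) zero≡)
        (trans (keep fr rN tt) N≡) (trans (keep fr rM tt) M≡) (trans (keepInp fr tt) inp≡))
      n start))
    where
    firstOps : List Op
    firstOps = put aVis rZero rOne ∷ plus rCnt rOne rZero ∷ plus rPass rN rZero ∷ []
    Cnt≡ : var σ rOne + var σ rZero ≡ 1
    Cnt≡ = cong₂ _+_ one≡ zero≡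
    pass≡ : var σ rN + var σ rZero ≡ n
    pass≡ = trans (cong₂ _+_ N≡ zero≡) (+-identityʳ n)
    flag≡ : ∀ i → (arr σ 0 [ var σ rZero ≔ var σ rOne ]) i ≡ (arr σ 0 [ toℕ r ≔ 1 ]) i
    flag≡ i = cong₂ (λ a b → (arr σ 0 [ a ≔ b ]) i) (trans zero≡ (sym r≡0)) one≡
    vis : ∀ v → Flag (r ∷ []) v ((arr σ 0 [ var σ rZero ≔ var σ rOne ]) (toℕ v))
    vis v with v Fin.≟ r
    ... | yes refl = inj₁ (here refl , trans (flag≡ (toℕ v)) (≔-same (arr σ 0) (toℕ v)))
    ... | no v≢r = inj₂ ((λ { (here eq) → v≢r eq }) ,
            trans (flag≡ (toℕ v)) (trans (≔-other (arr σ 0) (λ eq → v≢r (toℕ-injective eq))) (vis≡ (toℕ v))))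
    start : Growing n (evals firstOps σ)
    start = record
      { pass≡ = pass≡ ; grown = root r
      ; visits = record { Cnt≡ = Cnt≡ ; vis = vis ; ordered = trans (ord≡ 0) (sym r≡0) , trans (par≡ 0) (sym r≡0) , tt }
      ; progress = inj₂ ≤-refl }
    finish : ∀ τ → Growing 0 τ → GrownTree τ
    finish τ gr = record { grown = grown ; Cnt≡ = Visits.Cnt≡ visits ; ordered = Visits.ordered visits ; spanning = all progress }
      where
      open Growing gr
      all : (∀ v → v ∈ visited order) ⊎ n < length order + 0 → ∀ v → v ∈ visited order
      all (inj₁ c) = c
      all (inj₂ lt) = ⊥-elim (<⇒≱ lt (≤-trans (≤-reflexive (+-identityʳ _))
        (≤-trans (≤-reflexive (sym (length-map proj₁ order))) (length-unique (grown-unique grown)))))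

-- Joining two lists in memory

rAx rLx rAp rLp rSum rA₁ rL₁ rCA rCL rDA rDL : ℕ
rAx  = 37
rLx  = 38
rAp  = 39
rLp  = 40
rSum = 41
rA₁  = 42
rL₁  = 43
rCA  = 44
rCL  = 45
rDA  = 46
rDL  = 47

-- `rCA` and `rCL` describe the list copied first, `rDA` and `rDL` the one copied second, `rSA` and
-- `rSL` the shorter one, which is processed. `rA₁` and `rL₁` describe the list of the parent
-- without its head.
copyEntry prepareMerge appendOps prependOps secondOps : List Op
copyEntry = get rT aVertex rCA ∷ put aVertex rH rT ∷ get rT aDesc rCA ∷ put aDesc rH rT
  ∷ plus rCA rCA rOne ∷ plus rH rH rOne ∷ minus rCL rCL rOne ∷ []
prepareMerge = get rX aOrd rCnt ∷ get rY aPar rCnt ∷ get rAx aAddr rX ∷ get rLx aLen rX ∷ get rAp aAddr rY ∷ get rLp aLen rY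
  ∷ plus rSum rLp rLx ∷ put aVertex rH rY ∷ minus rT rSum rOne ∷ put aDesc rH rT ∷ put aAddr rY rH ∷ put aLen rY rSum
  ∷ plus rH rH rOne ∷ plus rA₁ rAp rOne ∷ minus rL₁ rLp rOne ∷ minus rCnt rCnt rOne ∷ minus rT rLp rLx ∷ []
appendOps = plus rSA rAp rZero ∷ plus rSL rLp rZero ∷ plus rCA rA₁ rZero ∷ plus rCL rL₁ rZero ∷ plus rDA rAx rZero ∷ plus rDL rLx rZero ∷ []
prependOps = plus rSA rAx rZero ∷ plus rSL rLx rZero ∷ plus rCA rAx rZero ∷ plus rCL rLx rZero ∷ plus rDA rA₁ rZero ∷ plus rDL rL₁ rZero ∷ []
secondOps = plus rCA rDA rZero ∷ plus rCL rDL rZero ∷ []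

-- The joint list goes to fresh memory at `rH` and the old blocks stay intact, so the shorter one
-- can still be processed after the copying.
copyBlock chooseOrder joinLists mergeStep mergeAll : Cmd
copyBlock = while rCL (ops copyEntry)
chooseOrder = ops prepareMerge ⨾ ifZero rT (ops appendOps) (ops prependOps)
joinLists = copyBlock ⨾ ops secondOps ⨾ copyBlock
mergeStep = chooseOrder ⨾ joinLists ⨾ process
mergeAll = while rCnt mergeStep ⨾ ops (get rX aOrd rZero ∷ get rSA aAddr rX ∷ get rSL aLen rX ∷ []) ⨾ process

-- For the lists what `Agree` is for the cells.
record Same (h : ℕ) (A B : Memory) : Set where
  field
    same₅ : ∀ {i} → i < h → B 5 i ≡ A 5 i
    same₆ : ∀ {i} → i < h → B 6 i ≡ A 6 i

open Same

same-refl : ∀ {h A} → Same h A A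
same-refl = record { same₅ = λ _ → refl ; same₆ = λ _ → refl }

same-trans : ∀ {h k A B C} → h ≤ k → Same h A B → Same k B C → Same h A C
same-trans h≤k s t = record
  { same₅ = λ i<h → trans (same₅ t (<-≤-trans i<h h≤k)) (same₅ s i<h)
  ; same₆ = λ i<h → trans (same₆ t (<-≤-trans i<h h≤k)) (same₆ s i<h)
  }

same-put : ∀ {h A B x y} → B 5 ≡ A 5 [ h ≔ x ] → B 6 ≡ A 6 [ h ≔ y ] → Same h A B
same-put {A = A} eq₁ eq₂ = record
  { same₅ = λ i<h → trans (cong (λ f → f _) eq₁) (≔-other (A 5) (<⇒≢ i<h))
  ; same₆ = λ i<h → trans (cong (λ f → f _) eq₂) (≔-other (A 6) (<⇒≢ i<h))
  }

block-same : ∀ {n A B h a} (l : Forest n) → Same h A B → a + length l ≤ h → Block A a l → Block B a l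
block-same [] s le b = tt
block-same {h = h} {a} ((v , d) ∷ l) s le (x , y , b) =
  trans (same₅ s a<h) x , trans (same₆ s a<h) y , block-same l s (≤-trans (≤-reflexive (sym (+-suc a (length l)))) le) b
  where
  a<h : a < h
  a<h = ≤-trans (s≤s (m≤m+n a (length l))) (≤-trans (≤-reflexive (sym (+-suc a (length l)))) le)

block-++ : ∀ {n A a} (k : Forest n) {l} → Block A a k → Block A (a + length k) l → Block A a (k ++ l)
block-++ {A = A} {a} [] {l} _ b = subst (λ i → Block A i l) (+-identityʳ a) b
block-++ {A = A} {a} (e ∷ k) {l} (x , y , b) b′ = x , y , block-++ k b (subst (λ i → Block A i l) (+-suc a (length k)) b′)

module Copying (base : ℕ) where

  open Execution base
  open CostLogic base

  Copied : ∀ {n} → Memory → ℕ → Forest n → Store → Set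
  Copied A h l τ = Block (arr τ) h l × var τ rH ≡ h + length l × Same h A (arr τ)

  record CopyStep (ρ : Store) (a h v d k : ℕ) (τ : Store) : Set where
    field
      five : arr τ 5 ≡ arr ρ 5 [ h ≔ v ]
      six  : arr τ 6 ≡ arr ρ 6 [ h ≔ d ]
      CA≡  : var τ rCA ≡ suc a
      H≡   : var τ rH ≡ suc h
      CL≡  : var τ rCL ≡ k
      one≡ : var τ rOne ≡ 1

  copyStep-correct : ∀ {a h v d k} ρ → var ρ rOne ≡ 1 → var ρ rCA ≡ a → var ρ rH ≡ h → var ρ rCL ≡ suc k →
    arr ρ 5 a ≡ v → arr ρ 6 a ≡ d → Ensures (ops copyEntry) ρ 30 (CopyStep ρ a h v d k)
  copyStep-correct {k = k} ρ one≡ refl refl CL≡ refl refl = relax! (ops-rule copyEntry _ (record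
      { five = refl ; six = refl ; CA≡ = CA≡ ; H≡ = H≡ ; CL≡ = CL≡′ ; one≡ = one≡ }))
    where
    CA≡ : var ρ rCA + var ρ rOne ≡ suc (var ρ rCA)
    CA≡ = trans (cong (var ρ rCA +_) one≡) (+-comm (var ρ rCA) 1)
    H≡ : var ρ rH + var ρ rOne ≡ suc (var ρ rH)
    H≡ = trans (cong (var ρ rH +_) one≡) (+-comm (var ρ rH) 1)
    CL≡′ : var ρ rCL ∸ var ρ rOne ≡ k
    CL≡′ = cong₂ _∸_ CL≡ one≡

  copyBlock-correct : ∀ {n} (l : Forest n) {a h} ρ → var ρ rOne ≡ 1 → var ρ rCA ≡ a → var ρ rH ≡ h → var ρ rCL ≡ length l →
    Block (arr ρ) a l → a + length l ≤ h → Ensures copyBlock ρ (length l * 32 + 1) (Copied (arr ρ) h l)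
  copyBlock-correct [] {a} {h} ρ one≡ CA≡ H≡ CL≡ b le =
    exit-rule CL≡ (tt , trans H≡ (sym (+-identityʳ h)) , same-refl)
  copyBlock-correct ((v , d) ∷ l) {a} {h} ρ one≡ CA≡ H≡ CL≡ (v≡ , d≡ , b) le =
    relax (≤-reflexive (sym (+-assoc 32 (length l * 32) 1)))
      (loop-rule (λ z → 0≢1+n (trans (sym z) CL≡)) (weaken next (copyStep-correct ρ one≡ CA≡ H≡ CL≡ v≡ d≡)))
    where
    le′ : suc a + length l ≤ h
    le′ = ≤-trans (≤-reflexive (sym (+-suc a (length l)))) le
    next : ∀ τ → CopyStep ρ a h (toℕ v) d (length l) τ → Ensures copyBlock τ (length l * 32 + 1) (Copied (arr ρ) h ((v , d) ∷ l))
    next τ st = weaken finish (copyBlock-correct l τ one≡′ CA≡′ H≡′ CL≡′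
        (block-same l same-h le′ b) (≤-trans le′ (n≤1+n h)))
      where
      open CopyStep st renaming (CA≡ to CA≡′; H≡ to H≡′; CL≡ to CL≡′; one≡ to one≡′)
      same-h : Same h (arr ρ) (arr τ)
      same-h = same-put five six
      finish : ∀ τ′ → Copied (arr τ) (suc h) l τ′ → Copied (arr ρ) h ((v , d) ∷ l) τ′
      finish τ′ (b′ , H≡″ , same) =
        ( trans (same₅ same ≤-refl) (trans (cong (λ f → f h) five) (≔-same (arr ρ 5) h))
        , trans (same₆ same ≤-refl) (trans (cong (λ f → f h) six) (≔-same (arr ρ 6) h))
        , b′) , trans H≡″ (sym (+-suc h (length l))) , same-trans (n≤1+n h) same-h same

-- The merging loop

module Merging {n} (G : BicoloredGraph n) (tree : BicoloredGraph.IsTree G) where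

  open BicoloredGraph G
  open Encoding G
  open Growth G tree
  open Execution (length word)
  open CostLogic (length word)
  open Copying (length word)
  open Rows blue red totalWeight using (Row; weigh; row-mono)

  Good : List (Fin n) → Set
  Good s = ConnectedOn (_∈ s) × Unique s

  open Processing (length word) blue red totalWeight Good

  -- `room` keeps all lists below the free memory, out of reach of later copies.
  record Layout (live : List (Fin n)) (L : Fin n → Forest n) (τ : Store) : Set where
    field
      block : ∀ {v} → v ∈ live → Block (arr τ) (arr τ 3 (toℕ v)) (L v)
      len   : ∀ {v} → v ∈ live → arr τ 4 (toℕ v) ≡ length (L v)
      room  : ∀ {v} → v ∈ live → arr τ 3 (toℕ v) + length (L v) ≤ var τ rH

  record MergePrepared (ρ : Store) (xs : List (Fin n × Fin n)) (x p : Fin n) (lp lx : ℕ) (τ : Store) : Set where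
    field
      Ax≡ : var τ rAx ≡ arr ρ 3 (toℕ x)
      Lx≡ : var τ rLx ≡ lx
      Ap≡ : var τ rAp ≡ arr ρ 3 (toℕ p)
      Lp≡ : var τ rLp ≡ lp
      A₁≡ : var τ rA₁ ≡ suc (arr ρ 3 (toℕ p))
      L₁≡ : var τ rL₁ ≡ lp ∸ 1
      T≡  : var τ rT ≡ lp ∸ lx
      Cnt≡ : var τ rCnt ≡ length xs ∸ 1
      H≡  : var τ rH ≡ suc (var ρ rH)
      five : arr τ 5 ≡ arr ρ 5 [ var ρ rH ≔ toℕ p ]
      six  : arr τ 6 ≡ arr ρ 6 [ var ρ rH ≔ lp + lx ∸ 1 ]
      three : arr τ 3 ≡ arr ρ 3 [ toℕ p ≔ var ρ rH ]
      four  : arr τ 4 ≡ arr ρ 4 [ toℕ p ≔ lp + lx ]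

  prepareMerge-correct : ∀ {xs x p lp lx} ρ → var ρ rOne ≡ 1 → var ρ rCnt ≡ length xs → Ordered (arr ρ) ((x , p) ∷ xs) →
    arr ρ 4 (toℕ p) ≡ lp → arr ρ 4 (toℕ x) ≡ lx → Ensures (ops prepareMerge) ρ 80 (MergePrepared ρ xs x p lp lx)
  prepareMerge-correct {xs} {x} {p} {lp} {lx} ρ one≡ Cnt≡ (x≡ , p≡ , _) lp≡ lx≡ = relax! (ops-rule prepareMerge _ (record
      { Ax≡ = Ax≡ ; Lx≡ = Lx≡ ; Ap≡ = Ap≡ ; Lp≡ = Lp≡ ; A₁≡ = A₁≡ ; L₁≡ = L₁≡ ; T≡ = T≡ ; Cnt≡ = Cnt≡′ ; H≡ = H≡
      ; five = five ; six = six ; three = three ; four = four }))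
    where
    vx vp h c : ℕ
    vx = arr ρ 1 (var ρ rCnt)
    vp = arr ρ 2 (var ρ rCnt)
    h = var ρ rH
    c = var ρ rCnt
    X≡ : vx ≡ toℕ x
    X≡ = trans (cong (arr ρ 1) Cnt≡) x≡
    Y≡ : vp ≡ toℕ p
    Y≡ = trans (cong (arr ρ 2) Cnt≡) p≡
    Ax≡ : arr ρ 3 vx ≡ arr ρ 3 (toℕ x)
    Ax≡ = cong (arr ρ 3) X≡
    Ap≡ : arr ρ 3 vp ≡ arr ρ 3 (toℕ p)
    Ap≡ = cong (arr ρ 3) Y≡
    Lx≡ : arr ρ 4 vx ≡ lx
    Lx≡ = trans (cong (arr ρ 4) X≡) lx≡
    Lp≡ : arr ρ 4 vp ≡ lp
    Lp≡ = trans (cong (arr ρ 4) Y≡) lp≡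
    A₁≡ : arr ρ 3 vp + var ρ rOne ≡ suc (arr ρ 3 (toℕ p))
    A₁≡ = trans (cong₂ _+_ Ap≡ one≡) (+-comm (arr ρ 3 (toℕ p)) 1)
    L₁≡ : arr ρ 4 vp ∸ var ρ rOne ≡ lp ∸ 1
    L₁≡ = cong₂ _∸_ Lp≡ one≡
    T≡ : arr ρ 4 vp ∸ arr ρ 4 vx ≡ lp ∸ lx
    T≡ = cong₂ _∸_ Lp≡ Lx≡
    Cnt≡′ : c ∸ var ρ rOne ≡ length xs ∸ 1
    Cnt≡′ = cong₂ _∸_ Cnt≡ one≡
    H≡ : h + var ρ rOne ≡ suc h
    H≡ = trans (cong (h +_) one≡) (+-comm h 1)
    five : arr ρ 5 [ h ≔ vp ] ≡ arr ρ 5 [ h ≔ toℕ p ]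
    five = cong (λ y → arr ρ 5 [ h ≔ y ]) Y≡
    six : arr ρ 6 [ h ≔ arr ρ 4 vp + arr ρ 4 vx ∸ var ρ rOne ] ≡ arr ρ 6 [ h ≔ lp + lx ∸ 1 ]
    six = cong (λ y → arr ρ 6 [ h ≔ y ]) (cong₂ _∸_ (cong₂ _+_ Lp≡ Lx≡) one≡)
    three : arr ρ 3 [ vp ≔ h ] ≡ arr ρ 3 [ toℕ p ≔ h ]
    three = cong (λ y → arr ρ 3 [ y ≔ h ]) Y≡
    four : arr ρ 4 [ vp ≔ arr ρ 4 vp + arr ρ 4 vx ] ≡ arr ρ 4 [ toℕ p ≔ lp + lx ]
    four = cong₂ (λ y z → arr ρ 4 [ y ≔ z ]) Y≡ (cong₂ _+_ Lp≡ Lx≡)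

  -- `first` and `second` hide which of the two lists goes to the front, so the copying is verified
  -- only once.
  record Ready (ρ : Store) (xs : List (Fin n × Fin n)) (x p : Fin n) (lp lx : Forest n) (τ : Store) : Set where
    field
      {first second} : Forest n
      below≡  : below lp lx ≡ first ++ second
      block₁  : Block (arr ρ) (var τ rCA) first
      CL≡     : var τ rCL ≡ length first
      room₁   : var τ rCA + length first ≤ var ρ rH
      block₂  : Block (arr ρ) (var τ rDA) second
      DL≡     : var τ rDL ≡ length second
      room₂   : var τ rDA + length second ≤ var ρ rH
      block₃  : Block (arr ρ) (var τ rSA) (smaller lp lx)
      SL≡     : var τ rSL ≡ length (smaller lp lx)
      room₃   : var τ rSA + length (smaller lp lx) ≤ var ρ rH
      Cnt≡ : var τ rCnt ≡ length xs ∸ 1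
      H≡  : var τ rH ≡ suc (var ρ rH)
      five : arr τ 5 ≡ arr ρ 5 [ var ρ rH ≔ toℕ p ]
      six  : arr τ 6 ≡ arr ρ 6 [ var ρ rH ≔ length (below lp lx) ]
      three : arr τ 3 ≡ arr ρ 3 [ toℕ p ≔ var ρ rH ]
      four  : arr τ 4 ≡ arr ρ 4 [ toℕ p ≔ suc (length (below lp lx)) ]

  chooseOrder-correct : ∀ {xs x p mp lx} ρ → let lp = rooted p mp in
    var ρ rOne ≡ 1 → var ρ rZero ≡ 0 → var ρ rCnt ≡ length xs → Ordered (arr ρ) ((x , p) ∷ xs) →
    arr ρ 4 (toℕ p) ≡ length lp → arr ρ 4 (toℕ x) ≡ length lx →
    Block (arr ρ) (arr ρ 3 (toℕ p)) lp → Block (arr ρ) (arr ρ 3 (toℕ x)) lx →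
    arr ρ 3 (toℕ p) + length lp ≤ var ρ rH → arr ρ 3 (toℕ x) + length lx ≤ var ρ rH →
    Ensures chooseOrder ρ 100 (Ready ρ xs x p lp lx)
  chooseOrder-correct {xs} {x} {p} {mp} {lx} ρ one≡ zero≡ Cnt≡ ord lp≡ lx≡ bp bx roomp roomx =
    relax! (⨾-rule (framed choose (prepareMerge-correct ρ one≡ Cnt≡ ord lp≡ lx≡)))
    where
    lp : Forest n
    lp = rooted p mp
    total-length : length lp + length lx ≡ suc (length (below lp lx))
    total-length with smaller-below lp lx
    ... | inj₁ (_ , _ , eq) = trans (cong suc (sym (length-++ mp))) (cong (λ l → suc (length l)) (sym eq))
    ... | inj₂ (_ , _ , eq) = trans (cong suc (trans (+-comm (length mp) (length lx)) (sym (length-++ lx)))) (cong (λ l → suc (length l)) (sym eq))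
    roomp′ : suc (arr ρ 3 (toℕ p)) + length mp ≤ var ρ rH
    roomp′ = ≤-trans (≤-reflexive (sym (+-suc (arr ρ 3 (toℕ p)) (length mp)))) roomp
    bp′ : Block (arr ρ) (suc (arr ρ 3 (toℕ p))) mp
    bp′ = proj₂ (proj₂ bp)
    choose : ∀ τ → Frame (ops prepareMerge) ρ τ → MergePrepared ρ xs x p (length lp) (length lx) τ →
             Ensures (ifZero rT (ops appendOps) (ops prependOps)) τ 20 (Ready ρ xs x p lp lx)
    choose τ fr pr = relax! (ifZero-rule
        (λ t≡0 → ops-rule appendOps _ (append t≡0))
        (λ t≢0 → ops-rule prependOps _ (prepend t≢0)))
      where
      open MergePrepared pr renaming (Cnt≡ to Cnt≡′)
      plain : ∀ {y z} → y ≡ z → y + var τ rZero ≡ z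
      plain {y} {z} eq = trans (cong₂ _+_ eq (trans (keep fr rZero tt) zero≡)) (+-identityʳ z)
      Ax : var τ rAx + var τ rZero ≡ arr ρ 3 (toℕ x)
      Ax = plain Ax≡
      Lx : var τ rLx + var τ rZero ≡ length lx
      Lx = plain Lx≡
      Ap : var τ rAp + var τ rZero ≡ arr ρ 3 (toℕ p)
      Ap = plain Ap≡
      Lp : var τ rLp + var τ rZero ≡ length lp
      Lp = plain Lp≡
      A₁ : var τ rA₁ + var τ rZero ≡ suc (arr ρ 3 (toℕ p))
      A₁ = plain A₁≡
      L₁ : var τ rL₁ + var τ rZero ≡ length mp
      L₁ = plain L₁≡
      six′ : arr τ 6 ≡ arr ρ 6 [ var ρ rH ≔ length (below lp lx) ]
      six′ = trans six (cong (λ k → arr ρ 6 [ var ρ rH ≔ k ∸ 1 ]) total-length)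
      four′ : arr τ 4 ≡ arr ρ 4 [ toℕ p ≔ suc (length (below lp lx)) ]
      four′ = trans four (cong (λ k → arr ρ 4 [ toℕ p ≔ k ]) total-length)
      block-at≡ : ∀ {a b} {l : Forest n} → b ≡ a → Block (arr ρ) a l → Block (arr ρ) b l
      block-at≡ refl b = b
      room-at≡ : ∀ {a b k} → b ≡ a → a + k ≤ var ρ rH → b + k ≤ var ρ rH
      room-at≡ refl r = r
      append : var τ rT ≡ 0 → Ready ρ xs x p lp lx (evals appendOps τ)
      append t≡0 with smaller-below lp lx
      ... | inj₂ (lt , _ , _) = ⊥-elim (<⇒≱ lt (m∸n≡0⇒m≤n (trans (sym T≡) t≡0)))
      ... | inj₁ (_ , small≡ , eq) = record
        { below≡ = eq
        ; block₁ = block-at≡ A₁ bp′ ; CL≡ = L₁ ; room₁ = room-at≡ A₁ roomp′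
        ; block₂ = block-at≡ Ax bx ; DL≡ = Lx ; room₂ = room-at≡ Ax roomx
        ; block₃ = subst (Block (arr ρ) _) (sym small≡) (block-at≡ Ap bp)
        ; SL≡ = trans Lp (cong length (sym small≡))
        ; room₃ = subst (λ l → _ + length l ≤ var ρ rH) (sym small≡) (room-at≡ Ap roomp)
        ; Cnt≡ = Cnt≡′ ; H≡ = H≡ ; five = five ; six = six′ ; three = three ; four = four′ }
      prepend : var τ rT ≢ 0 → Ready ρ xs x p lp lx (evals prependOps τ)
      prepend t≢0 with smaller-below lp lx
      ... | inj₁ (le , _ , _) = ⊥-elim (t≢0 (trans T≡ (m≤n⇒m∸n≡0 le)))
      ... | inj₂ (_ , small≡ , eq) = record
        { below≡ = eq
        ; block₁ = block-at≡ Ax bx ; CL≡ = Lx ; room₁ = room-at≡ Ax roomx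
        ; block₂ = block-at≡ A₁ bp′ ; DL≡ = L₁ ; room₂ = room-at≡ A₁ roomp′
        ; block₃ = subst (Block (arr ρ) _) (sym small≡) (block-at≡ Ax bx)
        ; SL≡ = trans Lx (cong length (sym small≡))
        ; room₃ = subst (λ l → _ + length l ≤ var ρ rH) (sym small≡) (room-at≡ Ax roomx)
        ; Cnt≡ = Cnt≡′ ; H≡ = H≡ ; five = five ; six = six′ ; three = three ; four = four′ }

  record Joined (ρ : Store) (p : Fin n) (lp lx : Forest n) (τ : Store) : Set where
    field
      joined : Block (arr τ) (var ρ rH) (rooted p (below lp lx))
      H≡     : var τ rH ≡ var ρ rH + suc (length (below lp lx))
      same   : Same (var ρ rH) (arr ρ) (arr τ)

  joinLists-correct : ∀ {xs x p lp lx} ρ σ → var σ rOne ≡ 1 → var σ rZero ≡ 0 → Ready ρ xs x p lp lx σ →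
    Ensures joinLists σ (4 + (length (below lp lx) * 32 + 2)) (Joined ρ p lp lx)
  joinLists-correct {xs} {x} {p} {lp} {lx} ρ σ one≡ zero≡ ready =
    relax bound (⨾-rule (framed second-copy (copyBlock-correct first σ one≡ refl H≡ CL≡
      (block-same first same₀ room₁ block₁) (≤-trans room₁ (n≤1+n h)))))
    where
    open Ready ready
    h : ℕ
    h = var ρ rH
    bound : (length first * 32 + 1) + (2 + (length second * 32 + 1)) ≤ 4 + (length (below lp lx) * 32 + 2)
    bound = ≤-trans (≤-reflexive (lemma (length first) (length second)))
      (≤-trans (≤-reflexive (cong (λ k → 2 + (k * 32 + 2)) (trans (sym (length-++ first)) (cong length (sym below≡)))))
        (+-monoˡ-≤ (length (below lp lx) * 32 + 2) (≤ᵇ⇒≤ 2 4 tt)))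
      where
      lemma : ∀ a b → (a * 32 + 1) + (2 + (b * 32 + 1)) ≡ 2 + ((a + b) * 32 + 2)
      lemma = solve-∀
    same₀ : Same h (arr ρ) (arr σ)
    same₀ = same-put five six
    second-copy : ∀ τ → Frame copyBlock σ τ → Copied (arr σ) (suc h) first τ →
                  Ensures (ops secondOps ⨾ copyBlock) τ (2 + (length second * 32 + 1)) (Joined ρ p lp lx)
    second-copy τ fr (b₁ , H≡′ , same₁) = ops-then secondOps 2 _ (weaken finish
        (copyBlock-correct second _ (trans (keep fr rOne tt) one≡) CA≡ H≡′ CL≡′
          (block-same second same₂ room₂ block₂) (≤-trans room₂ (≤-trans (n≤1+n h) (m≤m+n (suc h) _)))))
      where
      zero≡′ : var τ rZero ≡ 0
      zero≡′ = trans (keep fr rZero tt) zero≡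
      CA≡ : var τ rDA + var τ rZero ≡ var σ rDA
      CA≡ = trans (cong₂ _+_ (keep fr rDA tt) zero≡′) (+-identityʳ _)
      CL≡′ : var τ rDL + var τ rZero ≡ length second
      CL≡′ = trans (cong₂ _+_ (trans (keep fr rDL tt) DL≡) zero≡′) (+-identityʳ _)
      same₂ : Same h (arr ρ) (arr τ)
      same₂ = same-trans (n≤1+n h) same₀ same₁
      finish : ∀ τ′ → Copied (arr τ) (suc h + length first) second τ′ → Joined ρ p lp lx τ′
      finish τ′ (b₂ , H≡″ , same₃) = record
        { joined = head₅ , head₆ , subst (Block (arr τ′) (suc h)) (sym below≡)
            (block-++ first (block-same first same₃ ≤-refl b₁) b₂)
        ; H≡ = trans H≡″ (trans (+-assoc (suc h) _ _) (trans (cong (suc h +_) (trans (sym (length-++ first)) (cong length (sym below≡)))) (sym (+-suc h _))))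
        ; same = same-trans (≤-trans (n≤1+n h) (m≤m+n (suc h) _)) same₂ same₃ }
        where
        same₄ : Same (suc h) (arr σ) (arr τ′)
        same₄ = same-trans (m≤m+n (suc h) _) same₁ same₃
        head₅ : arr τ′ 5 h ≡ toℕ p
        head₅ = trans (same₅ same₄ ≤-refl) (trans (cong (λ f → f h) five) (≔-same (arr ρ 5) h))
        head₆ : arr τ′ 6 h ≡ length (below lp lx)
        head₆ = trans (same₆ same₄ ≤-refl) (trans (cong (λ f → f h) six) (≔-same (arr ρ 6) h))

  open FillCell (length word) blue red totalWeight using (rowCost)

  abstract
    -- The value of `processCost` for a list of length `k`, made abstract so that later sums treat
    -- it as an atom.
    listCost : ℕ → ℕ
    listCost k = 8 + (k * (2 + (110 + rowCost)) + 1)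

    listCost≡ : ∀ k → listCost k ≡ 8 + (k * (2 + (110 + rowCost)) + 1)
    listCost≡ k = refl

    mergeCost : ℕ
    mergeCost = 100 + (4 + (n * 32 + 2))

    mergeCost≡ : mergeCost ≡ 100 + (4 + (n * 32 + 2))
    mergeCost≡ = refl

    listCost-mono : ∀ {j k} → j ≤ k → listCost j ≤ listCost k
    listCost-mono j≤k = +-monoʳ-≤ 8 (+-monoˡ-≤ 1 (*-monoˡ-≤ (2 + (110 + rowCost)) j≤k))

  schedCost : List (Forest n) → ℕ
  schedCost []       = 0
  schedCost (l ∷ ls) = listCost (length l) + schedCost ls

  good-[] : Good []
  good-[] = (λ ()) , []

  weigh≤ : ∀ {s} → Unique s → weigh s ≤ totalWeight
  weigh≤ {s} u = ≤-trans (total≤sum _ u) (≤-reflexive (sum-cong-≗ both))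
    where
    both : ∀ v → blue v + red v ≡ w v
    both v with lookup B v
    ... | true  = +-identityʳ (w v)
    ... | false = refl

  -- The counter serves two purposes: it is the number of merges that remain, and the index of the
  -- latest vertex in `aOrd`.
  record Running (xs : List (Fin n × Fin n)) (L : Fin n → Forest n) (ρ : Store) : Set where
    field
      env     : Env ρ
      layout  : Layout (visited xs) L ρ
      ordered : Ordered (arr ρ) xs
      Cnt≡    : var ρ rCnt ≡ length xs ∸ 1
      unit    : Row (arr ρ) (var ρ rF) 0 []
      best    : Best (arr ρ) (var ρ rF) (var ρ rBest)

  agree-eq : ∀ {f A B} → B 8 ≡ A 8 → B 9 ≡ A 9 → B 10 ≡ A 10 → Agree f A B
  agree-eq e₁ e₂ e₃ = record
    { weight≡ = λ _ → cong (λ g → g _) e₁ ; next≡ = λ _ → cong (λ g → g _) e₂ ; node≡ = λ _ → cong (λ g → g _) e₃ }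

  Beats : Forest n → Store → Set
  Beats l τ = ∀ {s} → Spanned l s → EquallyColoured s → weigh s < weightAt (arr τ) (var τ rBest)

  Rises : Store → Store → Set
  Rises σ τ = weightAt (arr σ) (var σ rBest) ≤ weightAt (arr τ) (var τ rBest)

  process-sound : ∀ {l} → Sound l → ∀ σ → Env σ → Block (arr σ) (var σ rSA) l → var σ rSL ≡ length l →
    Row (arr σ) (var σ rF) 0 [] → Best (arr σ) (var σ rF) (var σ rBest) →
    Ensures process σ (listCost (length l)) (λ τ → Row (arr τ) (var τ rF) 0 [] × Best (arr τ) (var τ rF) (var τ rBest) × Rises σ τ × Beats l τ)
  process-sound {l} snd σ env block SL≡ unit best₀ =
    relax (≤-reflexive (sym (listCost≡ (length l)))) (weaken (λ τ pr → let open Processed pr in row-mono agree f≤ unit , best , better , beats)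
      (process-correct (Sound.closed snd) (weigh≤ (Sound.unique snd)) good-[]
        (λ sp → Sound.spans snd sp , spanned-unique (Sound.unique snd) sp) σ env block SL≡ unit best₀))

  mergeStep-correct : ∀ {xs L x p} (g : Grown xs) (p∈ : p ∈ visited xs) (x∉ : x ∉ visited xs) (px : Adj p x) →
    Invariant (x ∷ visited xs) L → ∀ ρ → Running ((x , p) ∷ xs) L ρ →
    Ensures mergeStep ρ (mergeCost + listCost (length (smaller (L p) (L x))))
      (λ τ → Running xs (merge x p L) τ × Rises ρ τ × Beats (smaller (L p) (L x)) τ)
  mergeStep-correct {xs} {L} {x} {p} g p∈ x∉ px inv ρ run with alive inv (there p∈)
  ... | mp , Lp≡ = relax cost≤ (⨾-rule (framed chosen (chooseOrder-correct {xs} {x} {p} {mp} {L x} ρ (one≡ env) (zero≡ env) Cnt≡ ordered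
      (trans (len (there p∈)) (cong length Lp≡)) (len (here refl))
      (subst (Block (arr ρ) (arr ρ 3 (toℕ p))) Lp≡ (block (there p∈))) (block (here refl))
      (subst (λ l → arr ρ 3 (toℕ p) + length l ≤ var ρ rH) Lp≡ (room (there p∈))) (room (here refl)))))
    where
    open Running run
    open Layout layout
    L′ : Fin n → Forest n
    L′ = merge x p L
    m : Forest n
    m = below (rooted p mp) (L x)
    sm : Forest n
    sm = smaller (rooted p mp) (L x)
    h : ℕ
    h = var ρ rH
    inv′ : Invariant (visited xs) L′
    inv′ = MergeStep.merged g p∈ x∉ px inv
    new≡ : L′ p ≡ rooted p m
    new≡ = trans (↦-same (L [ x ↦ [] ]) p) (cong (λ l → rooted p (below l (L x))) Lp≡)
    small≡ : smaller (L p) (L x) ≡ sm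
    small≡ = cong (λ l → smaller l (L x)) Lp≡
    m≤n : length m ≤ n
    m≤n = ≤-trans (n≤1+n _) (≤-trans (≤-reflexive (trans (cong length (sym new≡)) (sym (length-map proj₁ (L′ p)))))
      (length-unique (unique inv′ p)))
    cost≤ : 100 + ((4 + (length m * 32 + 2)) + listCost (length sm)) ≤ mergeCost + listCost (length (smaller (L p) (L x)))
    cost≤ = ≤-trans (≤-reflexive (sym (+-assoc 100 (4 + (length m * 32 + 2)) (listCost (length sm)))))
      (+-mono-≤ (≤-trans (+-monoʳ-≤ 100 (+-monoʳ-≤ 4 (+-monoˡ-≤ 2 (*-monoˡ-≤ 32 m≤n)))) (≤-reflexive (sym mergeCost≡))) (≤-reflexive (cong (λ l → listCost (length l)) (sym small≡))))
    chosen : ∀ σ → Frame chooseOrder ρ σ → Ready ρ xs x p (rooted p mp) (L x) σ →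
      Ensures (joinLists ⨾ process) σ ((4 + (length m * 32 + 2)) + listCost (length sm))
        (λ τ → Running xs L′ τ × Rises ρ τ × Beats (smaller (L p) (L x)) τ)
    chosen σ fr ready = ⨾-rule (framed run-process
        (joinLists-correct {xs} {x} {p} {rooted p mp} {L x} ρ σ (one≡ env₁) (zero≡ env₁) ready))
      where
      open Ready ready renaming (Cnt≡ to Cnt≡₁; H≡ to H≡₁)
      env₁ : Env σ
      env₁ = env-frame fr env
      run-process : ∀ ρ′ → Frame joinLists σ ρ′ → Joined ρ p (rooted p mp) (L x) ρ′ →
        Ensures process ρ′ (listCost (length sm)) (λ τ → Running xs L′ τ × Rises ρ τ × Beats (smaller (L p) (L x)) τ)
      run-process ρ′ fr₂ jn = framed finish (process-sound sound-sm ρ′ env₂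
          (subst (λ a → Block (arr ρ′) a sm) (sym (keep fr₂ rSA tt)) (block-same sm same room₃ block₃))
          (trans (keep fr₂ rSL tt) SL≡)
          (subst (λ f → Row (arr ρ′) f 0 []) (sym F≡) (row-mono agree ≤-refl unit))
          (subst₂ (Best (arr ρ′)) (sym F≡) (sym best≡) (best-mono agree ≤-refl best)))
        where
        open Joined jn
        sound-sm : Sound sm
        sound-sm = subst Sound small≡ (sound-smaller inv p x)
        env₂ : Env ρ′
        env₂ = env-frame fr₂ env₁
        F≡ : var ρ′ rF ≡ var ρ rF
        F≡ = trans (keep fr₂ rF tt) (keep fr rF tt)
        best≡ : var ρ′ rBest ≡ var ρ rBest
        best≡ = trans (keep fr₂ rBest tt) (keep fr rBest tt)
        agree : ∀ {f} → Agree f (arr ρ) (arr ρ′)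
        agree = agree-eq (trans (keepArr fr₂ 8 tt) (keepArr fr 8 tt)) (trans (keepArr fr₂ 9 tt) (keepArr fr 9 tt))
          (trans (keepArr fr₂ 10 tt) (keepArr fr 10 tt))
        finish : ∀ τ → Frame process ρ′ τ →
          Row (arr τ) (var τ rF) 0 [] × Best (arr τ) (var τ rF) (var τ rBest) × Rises ρ′ τ × Beats sm τ →
          Running xs L′ τ × Rises ρ τ × Beats (smaller (L p) (L x)) τ
        finish τ fr₃ (unit′ , best′ , rises , beats) =
          record
            { env = env-frame fr₃ env₂
            ; layout = record { block = block′ ; len = len′ ; room = room′ }
            ; ordered = ordered-cong xs (trans (keepArr fr₃ 1 tt) (trans (keepArr fr₂ 1 tt) (keepArr fr 1 tt)))
                (trans (keepArr fr₃ 2 tt) (trans (keepArr fr₂ 2 tt) (keepArr fr 2 tt))) (proj₂ (proj₂ ordered))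
            ; Cnt≡ = trans (keep fr₃ rCnt tt) (trans (keep fr₂ rCnt tt) Cnt≡₁)
            ; unit = unit′ ; best = best′ } ,
          subst (_≤ weightAt (arr τ) (var τ rBest))
            (trans (cong (weightAt (arr ρ′)) best≡) (weight≡ agree (best<f best))) rises ,
          subst (λ l → Beats l τ) (sym small≡) beats
          where
          three′ : ∀ i → arr τ 3 i ≡ (arr ρ 3 [ toℕ p ≔ h ]) i
          three′ i = cong (λ f → f i) (trans (keepArr fr₃ 3 tt) (trans (keepArr fr₂ 3 tt) three))
          four′ : ∀ i → arr τ 4 i ≡ (arr ρ 4 [ toℕ p ≔ suc (length m) ]) i
          four′ i = cong (λ f → f i) (trans (keepArr fr₃ 4 tt) (trans (keepArr fr₂ 4 tt) four))
          H≡′ : var τ rH ≡ h + suc (length m)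
          H≡′ = trans (keep fr₃ rH tt) H≡
          same′ : Same h (arr ρ) (arr τ)
          same′ = record
            { same₅ = λ i<h → trans (cong (λ f → f _) (keepArr fr₃ 5 tt)) (same₅ same i<h)
            ; same₆ = λ i<h → trans (cong (λ f → f _) (keepArr fr₃ 6 tt)) (same₆ same i<h) }
          whole : Block (arr τ) h (rooted p m)
          whole = block-same {h = suc (h + suc (length m))} (rooted p m)
            (record { same₅ = λ _ → cong (λ f → f _) (keepArr fr₃ 5 tt) ; same₆ = λ _ → cong (λ f → f _) (keepArr fr₃ 6 tt) })
            (n≤1+n _) joined
          other : ∀ {v} → v ∈ visited xs → v ≢ p → L′ v ≡ L v
          other v∈ v≢p = trans (↦-other (L [ x ↦ [] ]) v≢p) (↦-other L λ { refl → x∉ v∈ })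
          three-other : ∀ {v} → v ≢ p → arr τ 3 (toℕ v) ≡ arr ρ 3 (toℕ v)
          three-other v≢p = trans (three′ _) (≔-other (arr ρ 3) (λ eq → v≢p (toℕ-injective eq)))
          three-p : arr τ 3 (toℕ p) ≡ h
          three-p = trans (three′ (toℕ p)) (≔-same (arr ρ 3) (toℕ p))
          block′ : ∀ {v} → v ∈ visited xs → Block (arr τ) (arr τ 3 (toℕ v)) (L′ v)
          block′ {v} v∈ = lemma (v Fin.≟ p)
            where
            lemma : Dec (v ≡ p) → Block (arr τ) (arr τ 3 (toℕ v)) (L′ v)
            lemma (yes refl) = subst₂ (Block (arr τ)) (sym three-p) (sym new≡) whole
            lemma (no v≢p) = subst₂ (Block (arr τ)) (sym (three-other v≢p)) (sym (other v∈ v≢p))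
              (block-same (L v) same′ (room (there v∈)) (block (there v∈)))
          len′ : ∀ {v} → v ∈ visited xs → arr τ 4 (toℕ v) ≡ length (L′ v)
          len′ {v} v∈ = lemma (v Fin.≟ p)
            where
            lemma : Dec (v ≡ p) → arr τ 4 (toℕ v) ≡ length (L′ v)
            lemma (yes refl) = trans (four′ (toℕ v)) (trans (≔-same (arr ρ 4) (toℕ v)) (cong length (sym new≡)))
            lemma (no v≢p) = trans (four′ _) (trans (≔-other (arr ρ 4) (λ eq → v≢p (toℕ-injective eq)))
              (trans (len (there v∈)) (cong length (sym (other v∈ v≢p)))))
          room′ : ∀ {v} → v ∈ visited xs → arr τ 3 (toℕ v) + length (L′ v) ≤ var τ rH
          room′ {v} v∈ = lemma (v Fin.≟ p)
            where
            lemma : Dec (v ≡ p) → arr τ 3 (toℕ v) + length (L′ v) ≤ var τ rH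
            lemma (yes refl) = ≤-reflexive (trans (cong₂ _+_ three-p (cong length new≡)) (sym H≡′))
            lemma (no v≢p) = ≤-trans (≤-reflexive (cong₂ (λ a l → a + length l) (three-other v≢p) (other v∈ v≢p)))
              (≤-trans (room (there v∈)) (≤-trans (m≤m+n h _) (≤-reflexive (sym H≡′))))

  Finished : List (Forest n) → Store → Store → Set
  Finished ls σ τ = Best (arr τ) (var τ rF) (var τ rBest) × Rises σ τ × (∀ {l} → l ∈ ls → Beats l τ)

  finalOps : List Op
  finalOps = get rX aOrd rZero ∷ get rSA aAddr rX ∷ get rSL aLen rX ∷ []

  beats-rise : ∀ {l} σ τ → Rises σ τ → Beats l σ → Beats l τ
  beats-rise σ τ rise beats sp bal = <-≤-trans (beats sp bal) rise

  -- After the loop only the list of the root is still unprocessed, which is the second alternative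
  -- of `beats`.
  record Rooted (xs : List (Fin n × Fin n)) (L : Fin n → Forest n) (σ τ : Store) : Set₁ where
    field
      {top}    : Fin n
      {forest} : Fin n → Forest n
      running  : Running ((top , top) ∷ []) forest τ
      inv      : Invariant (top ∷ []) forest
      rises    : Rises σ τ
      beats    : ∀ {l} → l ∈ schedule xs L → Beats l τ ⊎ l ≡ forest top

  loopCost : ℕ → List (Forest n) → ℕ
  loopCost k ls = k * (2 + mergeCost) + schedCost ls + 1

  loopCost≥1 : ∀ k ls → 1 ≤ loopCost k ls
  loopCost≥1 k ls = m≤n+m 1 (k * (2 + mergeCost) + schedCost ls)

  -- A copy of `Ensures` one universe higher, because `Rooted` contains `Invariant`, which
  -- quantifies over predicates.
  record Ensures₁ (c : Cmd) (σ : Store) (b : ℕ) (Q : Store → Set₁) : Set₁ where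
    constructor ensures₁
    field
      {final} : Store
      {cost}  : ℕ
      run     : c ∕ σ ⇓[ cost ] final
      bound   : cost ≤ b
      post    : Q final

  -- `while-rule` would charge the same bound for every round. Here the rounds differ and only their
  -- sum is small, so the induction follows `Grown` and adds up `schedCost`.
  mergeLoop-correct : ∀ {xs L} → Grown xs → Invariant (visited xs) L → ∀ ρ → Running xs L ρ →
    Ensures₁ (while rCnt mergeStep) ρ (loopCost (length xs) (schedule xs L)) (Rooted xs L ρ)
  mergeLoop-correct {L = L} (root r) inv ρ run = ensures₁ (exit (Running.Cnt≡ run)) (loopCost≥1 1 (L r ∷ []))
    (record { running = run ; inv = inv ; rises = ≤-refl ; beats = λ { (here refl) → inj₂ refl } })
  mergeLoop-correct {L = L} (grow {xs = xs@(_ ∷ _)} {x} {p} g p∈ x∉ px) inv ρ run =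
    after (mergeStep-correct g p∈ x∉ px inv ρ run)
    where
    sm : Forest n
    sm = smaller (L p) (L x)
    ls : List (Forest n)
    ls = schedule xs (merge x p L)
    Goal : Set₁
    Goal = Ensures₁ (while rCnt mergeStep) ρ (loopCost (suc (length xs)) (sm ∷ ls)) (Rooted ((x , p) ∷ xs) L ρ)
    finish : ∀ {ρ′ t} → mergeStep ∕ ρ ⇓[ t ] ρ′ → t ≤ mergeCost + listCost (length sm) → Rises ρ ρ′ → Beats sm ρ′ →
             Ensures₁ (while rCnt mergeStep) ρ′ (loopCost (length xs) ls) (Rooted xs (merge x p L) ρ′) → Goal
    finish {ρ′} {t} step-run t≤ rise beats (ensures₁ {τ} {u} loop-run u≤ rooted′) =
      ensures₁ (loop (λ z → 0≢1+n (trans (sym z) (Running.Cnt≡ run))) step-run loop-run) cost≤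
        (record { running = running ; inv = inv₁ ; rises = ≤-trans rise rises ; beats = beats′ })
      where
      open Rooted rooted′ renaming (beats to later; inv to inv₁)
      cost≤ : suc (t + suc u) ≤ loopCost (suc (length xs)) (sm ∷ ls)
      cost≤ = ≤-trans (s≤s (+-mono-≤ t≤ (s≤s u≤)))
        (≤-reflexive (lemma (length xs) mergeCost (listCost (length sm)) (schedCost ls)))
        where
        lemma : ∀ k m l s → suc ((m + l) + suc (k * (2 + m) + s + 1)) ≡ suc k * (2 + m) + (l + s) + 1
        lemma = solve-∀
      beats′ : ∀ {l} → l ∈ sm ∷ ls → Beats l τ ⊎ l ≡ forest top
      beats′ (here refl) = inj₁ (beats-rise ρ′ τ rises beats)
      beats′ (there l∈) = later l∈
    after : Ensures mergeStep ρ (mergeCost + listCost (length sm))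
              (λ τ → Running xs (merge x p L) τ × Rises ρ τ × Beats sm τ) → Goal
    after (ensures {ρ′} step-run t≤ (run′ , rise , beats)) =
      finish step-run t≤ rise beats (mergeLoop-correct g (MergeStep.merged g p∈ x∉ px inv) ρ′ run′)

  mergeAll-correct : ∀ {xs L} → Grown xs → Invariant (visited xs) L →
    ∀ ρ → Running xs L ρ →
    Ensures mergeAll ρ (loopCost (length xs) (schedule xs L) + (18 + listCost n)) (Finished (schedule xs L) ρ)
  mergeAll-correct {xs} {L} g inv₀ ρ run₀ = after (mergeLoop-correct g inv₀ ρ run₀)
   where
   after : Ensures₁ (while rCnt mergeStep) ρ (loopCost (length xs) (schedule xs L)) (Rooted xs L ρ) →
           Ensures mergeAll ρ (loopCost (length xs) (schedule xs L) + (18 + listCost n)) (Finished (schedule xs L) ρ)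
   after (ensures₁ {τ} run≤ t≤ rooted′) = ⨾-rule (ensures run≤ t≤ (relax (+-monoʳ-≤ 18 cost≤)
      (ops-then finalOps 18 _ (weaken finish (process-sound (sound-list inv top) (evals finalOps τ)
        (env-frame (frame-ops finalOps) env) block′ len′ (row-mono (agree-eq refl refl refl) ≤-refl unit) best)))))
    where
    open Rooted rooted′
    open Running running
    open Layout layout
    X≡ : arr τ 1 (var τ rZero) ≡ toℕ top
    X≡ = trans (cong (arr τ 1) (zero≡ env)) (proj₁ ordered)
    block′ : Block (arr τ) (arr τ 3 (arr τ 1 (var τ rZero))) (forest top)
    block′ = subst (λ i → Block (arr τ) (arr τ 3 i) (forest top)) (sym X≡) (block (here refl))
    len′ : arr τ 4 (arr τ 1 (var τ rZero)) ≡ length (forest top)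
    len′ = trans (cong (arr τ 4) X≡) (len (here refl))
    length≤ : length (forest top) ≤ n
    length≤ = ≤-trans (≤-reflexive (sym (length-map proj₁ (forest top)))) (length-unique (unique inv top))
    cost≤ : listCost (length (forest top)) ≤ listCost n
    cost≤ = listCost-mono length≤
    finish : ∀ τ′ → _ → Finished (schedule xs L) ρ τ′
    finish τ′ (_ , best′ , rises′ , beats′) = best′ , ≤-trans rises rises′ , all
      where
      all : ∀ {l} → l ∈ schedule xs L → Beats l τ′
      all l∈ with beats l∈
      ... | inj₁ b = beats-rise τ τ′ rises′ b
      ... | inj₂ refl = beats′

-- Printing the best set

clearOps traceOps : List Op
clearOps = minus rC rC rOne ∷ output rC rZero ∷ []
traceOps = minus rT rT rOne ∷ output rT rOne ∷ get rBest aNext rBest ∷ get rT aNode rBest ∷ []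

clearOutput traceBest printBest : Cmd
clearOutput = ops (plus rC rN rZero ∷ []) ⨾ while rC (ops clearOps)
traceBest   = ops (get rT aNode rBest ∷ []) ⨾ while rT (ops traceOps)
printBest   = clearOutput ⨾ traceBest

-- The answer is written over the input word, which has at least `n` cells, so all writes stay below
-- `base`.
module Printing {base n : ℕ} (n≤base : n ≤ base) where

  open Execution base
  open CostLogic base

  record Cleared (k : ℕ) (τ : Store) : Set where
    field
      k≤n   : k ≤ n
      C≡    : var τ rC ≡ k
      clear : ∀ (v : Fin n) → k ≤ toℕ v → inp τ (toℕ v) ≡ 0

  clearStep-correct : ∀ {k} ρ → var ρ rOne ≡ 1 → var ρ rZero ≡ 0 → Cleared (suc k) ρ → Ensures (ops clearOps) ρ 5 (Cleared k)
  clearStep-correct {k} ρ one≡ zero≡ cl = relax! (ops-rule clearOps (tt , safe , tt) (record { k≤n = <⇒≤ k≤n ; C≡ = C≡′ ; clear = clear′ }))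
    where
    open Cleared cl
    C≡′ : var ρ rC ∸ var ρ rOne ≡ k
    C≡′ = cong₂ _∸_ C≡ one≡
    safe : var ρ rC ∸ var ρ rOne < base
    safe = subst (_< base) (sym C≡′) (<-≤-trans k≤n n≤base)
    clear′ : ∀ v → k ≤ toℕ v → (inp ρ [ var ρ rC ∸ var ρ rOne ≔ var ρ rZero ]) (toℕ v) ≡ 0
    clear′ v k≤v = trans (cong₂ (λ i x → (inp ρ [ i ≔ x ]) (toℕ v)) C≡′ zero≡) (lemma (m≤n⇒m<n∨m≡n k≤v))
      where
      lemma : k < toℕ v ⊎ k ≡ toℕ v → (inp ρ [ k ≔ 0 ]) (toℕ v) ≡ 0
      lemma (inj₁ k<v) = trans (≔-other (inp ρ) (λ eq → <⇒≢ k<v (sym eq))) (clear v k<v)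
      lemma (inj₂ eq) rewrite eq = ≔-same (inp ρ) (toℕ v)

  clearOutput-correct : ∀ σ → var σ rOne ≡ 1 → var σ rZero ≡ 0 → var σ rN ≡ n →
                        Ensures clearOutput σ (1 + (n * 7 + 1)) (λ τ → ∀ (v : Fin n) → inp τ (toℕ v) ≡ 0)
  clearOutput-correct σ one≡ zero≡ N≡ =
    ops-then (plus rC rN rZero ∷ []) 1 _ (weaken (λ τ cl v → Cleared.clear cl v z≤n)
      (while-rule Cleared (λ _ _ → Cleared.C≡)
        (λ k ρ fr → clearStep-correct ρ (trans (keep fr rOne tt) one≡) (trans (keep fr rZero tt) zero≡)) n
        (record { k≤n = ≤-refl ; C≡ = C≡ ; clear = λ v le → ⊥-elim (<⇒≱ (toℕ<n v) le) })))
    where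
    C≡ : var σ rN + var σ rZero ≡ n
    C≡ = trans (cong₂ _+_ N≡ zero≡) (+-identityʳ n)

  Traced : (ℕ → ℕ) → List (Fin n) → Store → Set
  Traced i₀ s τ = ∀ v → (v ∈ s → inp τ (toℕ v) ≡ 1) × (v ∉ s → inp τ (toℕ v) ≡ i₀ (toℕ v))

  record TraceStep (ρ : Store) (v : Fin n) (e : ℕ) (τ : Store) : Set where
    field
      inp≡  : inp τ ≡ inp ρ [ toℕ v ≔ 1 ]
      best≡ : var τ rBest ≡ e
      T≡    : var τ rT ≡ nodeAt (arr ρ) e
      one≡  : var τ rOne ≡ 1
      arr≡  : arr τ ≡ arr ρ

  traceStep-correct : ∀ {v e} ρ → var ρ rOne ≡ 1 → var ρ rT ≡ suc (toℕ v) → nextAt (arr ρ) (var ρ rBest) ≡ e →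
                      Ensures (ops traceOps) ρ 20 (TraceStep ρ v e)
  traceStep-correct {v} {e} ρ one≡ T≡ next≡ = relax! (ops-rule traceOps (tt , safe , tt , tt , tt) (record
      { inp≡ = inp≡ ; best≡ = next≡ ; T≡ = cong (nodeAt (arr ρ)) next≡ ; one≡ = one≡ ; arr≡ = refl }))
    where
    T≡′ : var ρ rT ∸ var ρ rOne ≡ toℕ v
    T≡′ = cong₂ _∸_ T≡ one≡
    safe : var ρ rT ∸ var ρ rOne < base
    safe = subst (_< base) (sym T≡′) (<-≤-trans (toℕ<n v) n≤base)
    inp≡ : inp ρ [ var ρ rT ∸ var ρ rOne ≔ var ρ rOne ] ≡ inp ρ [ toℕ v ≔ 1 ]
    inp≡ = cong₂ (λ i x → inp ρ [ i ≔ x ]) T≡′ one≡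

  traceLoop-correct : ∀ {A f e} {s : List (Fin n)} → Chain A f e s → ∀ ρ → arr ρ ≡ A → var ρ rOne ≡ 1 → var ρ rBest ≡ e →
                      var ρ rT ≡ nodeAt A e → Ensures (while rT (ops traceOps)) ρ (length s * 22 + 1) (Traced (inp ρ) s)
  traceLoop-correct ([] e< node≡0) ρ refl one≡ refl T≡ =
    exit-rule (trans T≡ node≡0) (λ v → (λ ()) , λ _ → refl)
  traceLoop-correct (node {v = v} {s} e< node≡v ch) ρ refl one≡ refl T≡ =
    relax (≤-reflexive (sym (+-assoc 22 (length s * 22) 1)))
      (loop-rule (λ z → 0≢1+n (trans (sym z) T≡v)) (weaken next (traceStep-correct ρ one≡ T≡v refl)))
    where
    T≡v : var ρ rT ≡ suc (toℕ v)
    T≡v = trans T≡ node≡v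
    next : ∀ τ → TraceStep ρ v (nextAt (arr ρ) (var ρ rBest)) τ →
           Ensures (while rT (ops traceOps)) τ (length s * 22 + 1) (Traced (inp ρ) (v ∷ s))
    next τ st = weaken finish (traceLoop-correct ch τ arr≡ one≡′ best≡ T≡′)
      where
      open TraceStep st renaming (one≡ to one≡′; T≡ to T≡′)
      finish : ∀ τ′ → Traced (inp τ) s τ′ → Traced (inp ρ) (v ∷ s) τ′
      finish τ′ tr u = ∈-case , ∉-case
        where
        ∈-case : u ∈ v ∷ s → inp τ′ (toℕ u) ≡ 1
        ∈-case (there u∈) = proj₁ (tr u) u∈
        ∈-case (here refl) = lemma (u ∈? s)
          where
          lemma : Dec (u ∈ s) → inp τ′ (toℕ u) ≡ 1
          lemma (yes u∈) = proj₁ (tr u) u∈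
          lemma (no u∉)  = trans (proj₂ (tr u) u∉) (trans (cong (λ f → f (toℕ u)) inp≡) (≔-same (inp ρ) (toℕ u)))
        ∉-case : u ∉ v ∷ s → inp τ′ (toℕ u) ≡ inp ρ (toℕ u)
        ∉-case u∉ = trans (proj₂ (tr u) (λ u∈ → u∉ (there u∈))) (trans (cong (λ f → f (toℕ u)) inp≡)
          (≔-other (inp ρ) (λ eq → u∉ (here (toℕ-injective eq)))))

  printBest-correct : ∀ {f} {s : List (Fin n)} σ → var σ rOne ≡ 1 → var σ rZero ≡ 0 → var σ rN ≡ n →
    Chain (arr σ) f (var σ rBest) s →
    Ensures printBest σ ((1 + (n * 7 + 1)) + (6 + (length s * 22 + 1)))
      (λ τ → ∀ v → inp τ (toℕ v) ≡ bit (does (v ∈? s)))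
  printBest-correct {f} {s} σ one≡ zero≡ N≡ ch =
    ⨾-rule (framed trace (clearOutput-correct σ one≡ zero≡ N≡))
    where
    trace : ∀ τ → Frame clearOutput σ τ → (∀ (v : Fin n) → inp τ (toℕ v) ≡ 0) →
            Ensures traceBest τ (6 + (length s * 22 + 1)) (λ τ → ∀ v → inp τ (toℕ v) ≡ bit (does (v ∈? s)))
    trace τ fr clear = ops-then (get rT aNode rBest ∷ []) 6 _
        (weaken finish (traceLoop-correct ch′ _ refl (trans (keep fr rOne tt) one≡) (keep fr rBest tt)
          (cong (nodeAt (arr τ)) (keep fr rBest tt))))
      where
      agree : Agree f (arr σ) (arr τ)
      agree = record
        { weight≡ = λ _ → cong (λ g → g _) (keepArr fr 8 tt)
        ; next≡   = λ _ → cong (λ g → g _) (keepArr fr 9 tt)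
        ; node≡   = λ _ → cong (λ g → g _) (keepArr fr 10 tt) }
      ch′ : Chain (arr τ) f (var σ rBest) s
      ch′ = chain-mono agree ≤-refl ch
      finish : ∀ τ′ → Traced (inp τ) s τ′ → ∀ v → inp τ′ (toℕ v) ≡ bit (does (v ∈? s))
      finish τ′ tr v = lemma (v ∈? s)
        where
        lemma : (d : Dec (v ∈ s)) → inp τ′ (toℕ v) ≡ bit (does d)
        lemma (yes v∈) = proj₁ (tr v) v∈
        lemma (no v∉)  = trans (proj₂ (tr v) v∉) (clear v)

-- A tree has at most as many edges as vertices

module Counting {n} (G : BicoloredGraph n) (tree : BicoloredGraph.IsTree G) where

  open BicoloredGraph G
  open Growth G tree

  -- Of two adjacent vertices the one grown later has only one earlier neighbour, its parent.
  adjacent-parent : ∀ {xs u v} → Grown xs → Adj u v → u ≢ v → u ∈ visited xs → v ∈ visited xs → (u , v) ∈ xs ⊎ (v , u) ∈ xs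
  adjacent-parent (root r) uv u≢v (here refl) (here refl) = ⊥-elim (u≢v refl)
  adjacent-parent (grow g p∈ x∉ px) uv u≢v (here refl) (here refl) = ⊥-elim (u≢v refl)
  adjacent-parent (grow g p∈ x∉ px) uv u≢v (here refl) (there v∈) with only-parent g p∈ x∉ px v∈ (sym-Adj uv)
  ... | refl = inj₁ (here refl)
  adjacent-parent (grow g p∈ x∉ px) uv u≢v (there u∈) (here refl) with only-parent g p∈ x∉ px u∈ uv
  ... | refl = inj₂ (here refl)
  adjacent-parent (grow g p∈ x∉ px) uv u≢v (there u∈) (there v∈) =
    Sum.map there there (adjacent-parent g uv u≢v u∈ v∈)

  parent-unique : ∀ {xs x p q} → Grown xs → (x , p) ∈ xs → (x , q) ∈ xs → p ≡ q
  parent-unique (root r) (here refl) (here refl) = refl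
  parent-unique (grow g _ _ _) (here refl) (here refl) = refl
  parent-unique (grow g _ x∉ _) (here refl) (there q∈) = ⊥-elim (x∉ (∈-map⁺ proj₁ q∈))
  parent-unique (grow g _ x∉ _) (there p∈) (here refl) = ⊥-elim (x∉ (∈-map⁺ proj₁ p∈))
  parent-unique (grow g _ _ _) (there p∈) (there q∈) = parent-unique g p∈ q∈

  module _ {xs} (g : Grown xs) (all : ∀ v → v ∈ visited xs) where

    Child : Fin n × Fin n → Set
    Child e = ∃[ x ] ∃[ p ] (x , p) ∈ xs × (e ≡ (x , p) ⊎ e ≡ (p , x))

    child : ∀ {e} → e ∈ edges → Child e
    child {u , v} e∈ with adjacent-parent g (inj₁ e∈) (All.lookup loopless e∈) (all u) (all v)
    ... | inj₁ uv∈ = u , v , uv∈ , inj₁ refl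
    ... | inj₂ vu∈ = v , u , vu∈ , inj₂ refl

    children : ∀ {es} → All Child es → List (Fin n)
    children All.[] = []
    children ((x , _) All.∷ cs) = x ∷ children cs

    length-children : ∀ {es} (cs : All Child es) → length (children cs) ≡ length es
    length-children All.[] = refl
    length-children (_ All.∷ cs) = cong suc (length-children cs)

    -- Edges are counted by their child ends. A child determines its parent, so two edges with the
    -- same child agree up to orientation, which `noMultiple` forbids.
    apart : ∀ {e f} → e ≢ f × e ≢ swap f → (c : Child e) (d : Child f) → proj₁ c ≢ proj₁ d
    apart (e≢f , e≢f′) (x , p , xp∈ , eq) (_ , q , xq∈ , eq′) refl with parent-unique g xp∈ xq∈
    apart (e≢f , e≢f′) (x , p , _ , inj₁ refl) (_ , _ , _ , inj₁ refl) refl | refl = e≢f refl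
    apart (e≢f , e≢f′) (x , p , _ , inj₁ refl) (_ , _ , _ , inj₂ refl) refl | refl = e≢f′ refl
    apart (e≢f , e≢f′) (x , p , _ , inj₂ refl) (_ , _ , _ , inj₁ refl) refl | refl = e≢f′ refl
    apart (e≢f , e≢f′) (x , p , _ , inj₂ refl) (_ , _ , _ , inj₂ refl) refl | refl = e≢f refl

    children-unique : ∀ {es} (cs : All Child es) → AllPairs (λ e f → e ≢ f × e ≢ swap f) es → Unique (children cs)
    children-unique All.[] _ = []
    children-unique (c All.∷ cs) (ne ∷ nes) = heads cs ne ∷ children-unique cs nes
      where
      heads : ∀ {es} (cs : All Child es) → All (λ f → _ ≢ f × _ ≢ swap f) es → All (proj₁ c ≢_) (children cs)
      heads All.[] All.[] = All.[]
      heads (d All.∷ cs) (n All.∷ ns) = apart n c d All.∷ heads cs ns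

    edges≤n : length edges ≤ n
    edges≤n = ≤-trans (≤-reflexive (sym (length-children cs))) (length-unique (children-unique cs noMultiple))
      where
      cs : All Child edges
      cs = All.tabulate child

-- From the table to an optimal subgraph

module Optimality {n} (G : BicoloredGraph n) (tree : BicoloredGraph.IsTree G) where

  open BicoloredGraph G
  open Encoding G
  open Growth G tree
  open Rows blue red totalWeight using (weigh)
  open Merging G tree using (Good; good-[])

  T⇒∈ : ∀ {S : Subset n} {v} → T (lookup S v) → v Subset.∈ S
  T⇒∈ {S} {v} t with lookup S v in eq
  ... | true = lookup⇒[]= v S eq

  ∈⇒T : ∀ {S : Subset n} {v} → v Subset.∈ S → T (lookup S v)
  ∈⇒T v∈ = subst T (sym ([]=⇒lookup v∈)) tt

  sum-subset : ∀ (f : Fin n → ℕ) {S s} → Unique s → Enumerates (Subset._∈ S) s →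
               sum (λ v → if lookup S v then f v else 0) ≡ total f s
  sum-subset f {S} u enum = total-sum f u (lookup S) (λ t → Enumerates.to enum (T⇒∈ t)) (λ v∈ → ∈⇒T (Enumerates.from enum v∈))

  blue-weight : ∀ {S s} → Unique s → Enumerates (Subset._∈ S) s → weight (S ∩ B) ≡ total blue s
  blue-weight {S} u enum = trans (sum-cong-≗ λ v → trans (cong (if_then w v else 0) (lookup-zipWith _∧_ v S B)) (lemma (lookup S v)))
                                 (sum-subset blue {S} u enum)
    where
    lemma : ∀ a {b x} → (if a ∧ b then x else 0) ≡ (if a then (if b then x else 0) else 0)
    lemma true  = refl
    lemma false = refl

  red-weight : ∀ {S s} → Unique s → Enumerates (Subset._∈ S) s → weight (S ∩ R) ≡ total red s
  red-weight {S} u enum = trans (sum-cong-≗ λ v → trans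
      (cong (if_then w v else 0) (trans (lookup-zipWith _∧_ v S R) (cong (lookup S v ∧_) (lookup-map v not B))))
      (lemma (lookup S v) (lookup B v)))
    (sum-subset red {S} u enum)
    where
    lemma : ∀ a b {x} → (if a ∧ not b then x else 0) ≡ (if a then (if b then 0 else x) else 0)
    lemma true  true  = refl
    lemma true  false = refl
    lemma false b     = refl

  full-weight : ∀ {S s} → Unique s → Enumerates (Subset._∈ S) s → weight S ≡ weigh s
  full-weight {S} {s} u enum = trans (sum-subset w {S} u enum) (lemma s)
    where
    both : ∀ v → w v ≡ blue v + red v
    both v with lookup B v
    ... | true  = sym (+-identityʳ (w v))
    ... | false = refl
    lemma : ∀ s → total w s ≡ weigh s
    lemma []      = refl
    lemma (v ∷ s) = cong₂ _+_ (both v) (lemma s)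

  toSubset : List (Fin n) → Subset n
  toSubset s = Vec.tabulate (λ v → does (v ∈? s))

  toSubset-enumerates : ∀ s → Enumerates (Subset._∈ toSubset s) s
  toSubset-enumerates s = record
    { to = λ {v} v∈ → to (subst T (lookup∘tabulate _ v) (∈⇒T v∈))
    ; from = λ {v} v∈ → T⇒∈ (subst T (sym (trans (lookup∘tabulate _ v) (dec-true (v ∈? s) v∈))) tt) }
    where
    to : ∀ {v} → T (does (v ∈? s)) → v ∈ s
    to {v} t with v ∈? s
    ... | yes v∈ = v∈

  schedule-sound : ∀ {xs L} → Grown xs → Invariant (visited xs) L → ∀ {l} → l ∈ schedule xs L → Sound l
  schedule-sound (root r) inv (here refl) = sound-list inv r
  schedule-sound (grow {xs = _ ∷ _} {x} {p} g p∈ x∉ px) inv (here refl) = sound-smaller inv p x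
  schedule-sound (grow {xs = _ ∷ _} g p∈ x∉ px) inv (there l∈) = schedule-sound g (MergeStep.merged g p∈ x∉ px inv) l∈

  module _ {xs} (g : Grown xs) (all : ∀ v → v ∈ visited xs) {s : List (Fin n)}
           (beats : ∀ {l} → l ∈ schedule xs (λ v → rooted v []) → ∀ {t} → Spanned l t → total blue t ≡ total red t → weigh t ≤ weigh s) where

    -- A nonempty set is spanned by one of the scheduled lists, and its weights carry over to the
    -- spanning pick. The empty set has no top, but weighs 0.
    maximal : ∀ S → InducesConnected S → Balanced S → weight S ≤ weigh s
    maximal S conn bal with Subset.nonempty? S
    ... | no empty = ≤-trans (≤-reflexive (sum-zero outside)) z≤n
      where
      outside : ∀ v → (if lookup S v then w v else 0) ≡ 0
      outside v with lookup S v in eq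
      ... | false = refl
      ... | true  = ⊥-elim (empty (v , lookup⇒[]= v S eq))
    ... | yes (a , a∈) with schedule-complete g (initial-invariant all) (λ v → v Subset.∈? S) conn a∈
                              (initially-pending (λ v → v Subset.∈? S) a∈)
    ... | l , l∈ , t , sp , enum = ≤-trans (≤-reflexive (full-weight {S} u enum))
            (beats l∈ sp (trans (sym (blue-weight {S} u enum)) (trans bal (red-weight {S} u enum))))
      where
      u : Unique t
      u = spanned-unique (Sound.unique (schedule-sound g (initial-invariant all) l∈)) sp

  optimal : ∀ {s} → Good s → total blue s ≡ total red s → (∀ S → InducesConnected S → Balanced S → weight S ≤ weigh s) →
            IsOptimalWBCS (toSubset s)
  optimal {s} (conn , u) bal max = record
    { connected = λ u∈ v∈ → within-mono (Enumerates.from enum) (conn (Enumerates.to enum u∈) (Enumerates.to enum v∈))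
    ; balanced = trans (blue-weight {toSubset s} u enum) (trans bal (sym (red-weight {toSubset s} u enum)))
    ; maximum = λ S c b → ≤-trans (max S c b) (≤-reflexive (sym (full-weight {toSubset s} u enum))) }
    where
    enum : Enumerates (Subset._∈ toSubset s) s
    enum = toSubset-enumerates s

-- Arithmetic of the running time

*-^ : ∀ a b e → (a * b) ^ e ≡ a ^ e * b ^ e
*-^ a b zero    = refl
*-^ a b (suc e) = trans (cong (a * b *_) (*-^ a b e)) (lemma a b (a ^ e) (b ^ e))
  where
  lemma : ∀ a b c d → a * b * (c * d) ≡ (a * c) * (b * d)
  lemma = solve-∀

power-bound : ∀ {t a n} e → t ^ 2 ≤ a ^ 2 * n ^ 3 → t ^ (2 * e) ≤ a ^ (2 * e) * n ^ (3 * e)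
power-bound {t} {a} {n} e le = begin
    t ^ (2 * e)               ≡⟨ ^-*-assoc t 2 e ⟨
    (t ^ 2) ^ e               ≤⟨ ^-monoˡ-≤ e le ⟩
    (a ^ 2 * n ^ 3) ^ e       ≡⟨ *-^ (a ^ 2) (n ^ 3) e ⟩
    (a ^ 2) ^ e * (n ^ 3) ^ e ≡⟨ cong₂ _*_ (^-*-assoc a 2 e) (^-*-assoc n 3 e) ⟩
    a ^ (2 * e) * n ^ (3 * e) ∎
  where open ≤-Reasoning

module _ {n W t : ℕ} (C : ℕ) (1≤n : 1 ≤ n) (n≤W : n ≤ W) (t≤ : t ≤ C * (n * suc ⌊log₂ n ⌋ * W)) where

  private
    λ₂ : ℕ
    λ₂ = suc ⌊log₂ n ⌋

    λ≤n : λ₂ ≤ n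
    λ≤n = lemma n 1≤n
      where
      lemma : ∀ n → 1 ≤ n → suc ⌊log₂ n ⌋ ≤ n
      lemma (suc n) _ = s≤s (log< n)

  cubic-bound : t ≤ C * (n * W ^ 2)
  cubic-bound = ≤-trans t≤ (*-monoʳ-≤ C (≤-trans (*-monoˡ-≤ W (*-monoʳ-≤ n (≤-trans λ≤n n≤W))) (≤-reflexive (lemma n W))))
    where
    lemma : ∀ n w → n * w * w ≡ n * (w * (w * 1))
    lemma = solve-∀

  -- Squaring avoids roots: the 4 of `square-log` becomes the 2 in `2 * C * W`, and its `n` raises
  -- n² to n³.
  square-bound : t ^ 2 ≤ (2 * C * W) ^ 2 * n ^ 3
  square-bound = begin
      t ^ 2                                       ≤⟨ ^-monoˡ-≤ 2 t≤ ⟩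
      (C * (n * λ₂ * W)) ^ 2                      ≡⟨ lemma C n λ₂ W ⟩
      C * C * (n * n) * (W * W) * (λ₂ * λ₂)       ≤⟨ *-monoʳ-≤ (C * C * (n * n) * (W * W)) (square-log n 1≤n) ⟩
      C * C * (n * n) * (W * W) * (4 * n)         ≡⟨ lemma′ C n W ⟩
      (2 * C * W) ^ 2 * n ^ 3 ∎
    where
    open ≤-Reasoning
    lemma : ∀ c n l w → (c * (n * l * w)) * ((c * (n * l * w)) * 1) ≡ c * c * (n * n) * (w * w) * (l * l)
    lemma = solve-∀
    lemma′ : ∀ c n w → c * c * (n * n) * (w * w) * (4 * n) ≡ (2 * c * w) * ((2 * c * w) * 1) * (n * (n * (n * 1)))
    lemma′ = solve-∀

  -- The numbers are variables here because literal exponents would be unfolded.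
  log-bound : ∀ e {c d d′} → c ≡ 2 * C → d ≡ 2 * e → 3 * e ≤ d′ → t ^ d ≤ (c * W) ^ d * n ^ d′
  log-bound e refl refl 3e≤d′ = ≤-trans (power-bound {a = 2 * C * W} e square-bound)
    (*-monoʳ-≤ ((2 * C * W) ^ (2 * e)) (^-monoʳ-≤ n {{>-nonZero 1≤n}} 3e≤d′))

module _ {n W : ℕ} (1≤n : 1 ≤ n) (n≤W : n ≤ W) where

  private
    X : ℕ
    X = n * suc ⌊log₂ n ⌋ * W

    1≤W : 1 ≤ W
    1≤W = ≤-trans 1≤n n≤W

    nW≤X : n * W ≤ X
    nW≤X = *-monoˡ-≤ W (m≤m*n n (suc ⌊log₂ n ⌋))

    nn≤X : n * n ≤ X
    nn≤X = ≤-trans (*-monoʳ-≤ n n≤W) nW≤X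

    n≤X : n ≤ X
    n≤X = ≤-trans (≤-trans (≤-reflexive (sym (*-identityʳ n))) (*-monoʳ-≤ n 1≤W)) nW≤X

    1≤X : 1 ≤ X
    1≤X = ≤-trans 1≤n n≤X

  -- The left side is the sum of the bounds of all phases, with `m` edges, `k` rounds of merging,
  -- `c` processed lists of total length `Λ`, `s` printed vertices and row cost `r`. After expansion
  -- every term is a multiple of something at most `X`; the coefficients add up to 1677, which is
  -- rounded up.
  step-bound : ∀ {m k c s Λ r} → m ≤ n → k ≤ n → c ≤ n → s ≤ n → Λ ≤ n * suc ⌊log₂ n ⌋ → r ≤ 511 * W →
    39 + ((3 + ((n * 62 + 1) + 20)) + ((8 + (n * (2 + (4 + (m * 72 + 1))) + 1)) + (3 +
      (((k * (2 + (100 + (4 + (n * 32 + 2)))) + (c * 9 + Λ * (2 + (110 + r))) + 1) + (18 + (8 + (n * (2 + (110 + r)) + 1)))) +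
       ((1 + (n * 7 + 1)) + (6 + (s * 22 + 1))))))) ≤ 3000 * X
  step-bound {m} {k} {c} {s} {Λ} {r} m≤n k≤n c≤n s≤n Λ≤ r≤ = begin
      _ ≡⟨ expand n m k c s Λ r ⟩
      112 + (76 * n + 72 * (n * m) + 108 * k + 32 * (k * n) + 9 * c + 22 * s + 112 * n) + (112 * Λ + Λ * r) + n * r
        ≤⟨ +-mono-≤ (+-mono-≤ (+-mono-≤ ones smalls) (+-mono-≤ Λs Λr)) nr ⟩
      112 * X + (76 * X + 72 * X + 108 * X + 32 * X + 9 * X + 22 * X + 112 * X) + (112 * X + 511 * X) + 511 * X
        ≡⟨ collect X ⟩
      1677 * X ≤⟨ *-monoˡ-≤ X (≤ᵇ⇒≤ 1677 3000 tt) ⟩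
      3000 * X ∎
    where
    open ≤-Reasoning
    expand : ∀ n m k c s Λ r →
      39 + ((3 + ((n * 62 + 1) + 20)) + ((8 + (n * (2 + (4 + (m * 72 + 1))) + 1)) + (3 +
      (((k * (2 + (100 + (4 + (n * 32 + 2)))) + (c * 9 + Λ * (2 + (110 + r))) + 1) + (18 + (8 + (n * (2 + (110 + r)) + 1)))) +
       ((1 + (n * 7 + 1)) + (6 + (s * 22 + 1))))))) ≡
      112 + (76 * n + 72 * (n * m) + 108 * k + 32 * (k * n) + 9 * c + 22 * s + 112 * n) + (112 * Λ + Λ * r) + n * r
    expand = solve-∀
    collect : ∀ x → 112 * x + (76 * x + 72 * x + 108 * x + 32 * x + 9 * x + 22 * x + 112 * x) + (112 * x + 511 * x) + 511 * x ≡ 1677 * x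
    collect = solve-∀
    scale : ∀ a {y} → y ≤ X → a * y ≤ a * X
    scale a = *-monoʳ-≤ a
    ones : 112 ≤ 112 * X
    ones = ≤-trans (≤-reflexive (sym (*-identityʳ 112))) (scale 112 1≤X)
    nm≤X : n * m ≤ X
    nm≤X = ≤-trans (*-monoʳ-≤ n m≤n) nn≤X
    kn≤X : k * n ≤ X
    kn≤X = ≤-trans (*-monoˡ-≤ n k≤n) nn≤X
    smalls : 76 * n + 72 * (n * m) + 108 * k + 32 * (k * n) + 9 * c + 22 * s + 112 * n ≤
             76 * X + 72 * X + 108 * X + 32 * X + 9 * X + 22 * X + 112 * X
    smalls = +-mono-≤ (+-mono-≤ (+-mono-≤ (+-mono-≤ (+-mono-≤ (+-mono-≤ (scale 76 n≤X) (scale 72 nm≤X)) (scale 108 (≤-trans k≤n n≤X)))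
      (scale 32 kn≤X)) (scale 9 (≤-trans c≤n n≤X))) (scale 22 (≤-trans s≤n n≤X))) (scale 112 n≤X)
    Λs : 112 * Λ ≤ 112 * X
    Λs = scale 112 (≤-trans Λ≤ (≤-trans (≤-reflexive (sym (*-identityʳ _))) (*-monoʳ-≤ (n * suc ⌊log₂ n ⌋) 1≤W)))
    Λr : Λ * r ≤ 511 * X
    Λr = ≤-trans (*-mono-≤ Λ≤ r≤) (≤-reflexive (swap₂ (n * suc ⌊log₂ n ⌋) W))
      where
      swap₂ : ∀ a w → a * (511 * w) ≡ 511 * (a * w)
      swap₂ = solve-∀
    nr : n * r ≤ 511 * X
    nr = ≤-trans (*-monoʳ-≤ n r≤) (≤-trans (≤-reflexive (swap₂ n W)) (scale 511 nW≤X))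
      where
      swap₂ : ∀ a w → a * (511 * w) ≡ 511 * (a * w)
      swap₂ = solve-∀

-- The 2 W + 3 cells at 102 each and the final test give 204 W + 307, and 1 ≤ W turns the constant
-- into a multiple of W.
row-bound : ∀ W → 1 ≤ W → suc (suc W + suc W) * 102 + 1 ≤ 511 * W
row-bound W 1≤W = begin
    suc (suc W + suc W) * 102 + 1 ≡⟨ lemma W ⟩
    204 * W + 307                 ≤⟨ +-monoʳ-≤ (204 * W) (≤-trans (≤-reflexive (sym (*-identityʳ 307))) (*-monoʳ-≤ 307 1≤W)) ⟩
    204 * W + 307 * W             ≡⟨ *-distribʳ-+ W 204 307 ⟨
    511 * W ∎
  where
  open ≤-Reasoning
  lemma : ∀ w → suc (suc w + suc w) * 102 + 1 ≡ 204 * w + 307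
  lemma = solve-∀

-- The whole program

countOps : List Op
countOps = minus rCnt rCnt rOne ∷ []

-- `countOps` turns the number of vertices, left behind by `growTree`, into the number of merges.
solve : Cmd
solve = initialise ⨾ growTree ⨾ ops countOps ⨾ mergeAll ⨾ printBest

module Solution {n} (G : BicoloredGraph n) (tree : BicoloredGraph.IsTree G) where

  open BicoloredGraph G
  open Encoding G
  open Initialisation G hiding (W)
  open Growth G tree
  open GrowPhase G tree
  open Merging G tree
  open Optimality G tree
  open Execution (length word)
  open CostLogic (length word)
  open Processing (length word) blue red totalWeight Good hiding (one≡; zero≡; K≡; O≡; blue≡; red≡)
  open Rows blue red totalWeight
  open FillCell (length word) blue red totalWeight using (rowCost; rowCost≡)

  n≤word : n ≤ length word
  n≤word = ≤-trans (≤-trans (m≤n+m n 2) (≤-trans (m≤m+n (2 + n) n) (≤-trans (m≤m+n _ (length edges)) (m≤m+n _ (length edges)))))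
    (≤-reflexive (sym length-word))

  open Printing n≤word

  1≤n : 1 ≤ n
  1≤n = >-nonZero⁻¹ n {{IsTree.nonempty tree}}

  n≤W : n ≤ totalWeight
  n≤W = ≤-trans (≤-reflexive (sym (trans (sum-const n 1) (*-identityʳ n)))) (sum-mono w-positive)

  -- The bound `n + potential n` of `schedule-length`, written as a product.
  Λ : ℕ
  Λ = n * suc ⌊log₂ n ⌋

  schedCost≡ : ∀ ls → schedCost ls ≡ length ls * 9 + totalLength ls * (2 + (110 + rowCost))
  schedCost≡ [] = refl
  schedCost≡ (l ∷ ls) = trans (cong₂ _+_ (listCost≡ (length l)) (schedCost≡ ls))
      (lemma (length l) (length ls) (totalLength ls) (2 + (110 + rowCost)))
    where
    lemma : ∀ a b c r → 8 + (a * r + 1) + (b * 9 + c * r) ≡ suc b * 9 + (a + c) * r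
    lemma = solve-∀

  length-schedule : ∀ (xs : List (Fin n × Fin n)) (L : Fin n → Forest n) → length (schedule xs L) ≤ length xs
  length-schedule [] L = z≤n
  length-schedule ((r , _) ∷ []) L = ≤-refl
  length-schedule ((x , p) ∷ xs@(_ ∷ _)) L = s≤s (length-schedule xs (merge x p L))

  single : Fin n → Forest n
  single v = rooted v []

  -- The only pick is the empty set. Its difference is 0, so it belongs to index `O`, and its weight
  -- 0 is stored as 1.
  unit-row : ∀ {A : Memory} → (∀ i → A 8 i ≡ ((λ _ → 0) [ O ≔ 1 ]) i) → (∀ i → A 10 i ≡ 0) → Row A (suc K) 0 []
  unit-row {A} weights≡ nodes≡ i i≤K = record { e<f = s≤s i≤K ; sound = found ; complete = best }
    where
    found : ∀ {k} → weightAt A i ≡ suc k → ∃[ s ] Candidate [] i s × k ≡ weigh s × Chain A (suc K) i s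
    found eq = lemma (i ≟ O) (trans (sym (weights≡ i)) eq)
      where
      lemma : ∀ {k} → Dec (i ≡ O) → ((λ _ → 0) [ O ≔ 1 ]) i ≡ suc k → ∃[ s ] Candidate [] i s × k ≡ weigh s × Chain A (suc K) i s
      lemma (yes refl) eq′ = [] , (done , refl) , suc-injective (trans (sym eq′) (≔-same (λ _ → 0) O)) , [] (s≤s i≤K) (nodes≡ i)
      lemma (no i≢O) eq′ = ⊥-elim (0≢1+n (trans (sym (≔-other (λ _ → 0) i≢O)) eq′))
    best : ∀ {s} → Candidate [] i s → weigh s < weightAt A i
    best (done , eq) = subst (λ j → 0 < weightAt A j) (+-cancelʳ-≡ 0 O i eq)
      (≤-reflexive (sym (trans (weights≡ O) (≔-same (λ _ → 0) O))))

  record Solved (τ : Store) : Set where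
    field
      {answer} : List (Fin n)
      few      : length edges ≤ n
      optimum  : IsOptimalWBCS (toSubset answer)
      printed  : ∀ v → inp τ (toℕ v) ≡ bit (lookup (toSubset answer) v)

  mergeBound printBound growBound : ℕ
  mergeBound = (n * (2 + (100 + (4 + (n * 32 + 2)))) + (n * 9 + Λ * (2 + (110 + rowCost))) + 1) +
               (18 + (8 + (n * (2 + (110 + rowCost)) + 1)))
  printBound = (1 + (n * 7 + 1)) + (6 + (n * 22 + 1))
  growBound = 8 + (n * (2 + (4 + (length edges * 72 + 1))) + 1)

  mergeBound-correct : ∀ {xs} → Grown xs → (∀ v → v ∈ visited xs) →
    loopCost (length xs) (schedule xs single) + (18 + listCost n) ≤ mergeBound
  mergeBound-correct {xs} g all = +-mono-≤ (+-monoˡ-≤ 1 (+-mono-≤ (*-mono-≤ xs≤n (≤-reflexive (cong (2 +_) mergeCost≡)))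
      (≤-trans (≤-reflexive (schedCost≡ (schedule xs single)))
        (+-mono-≤ (*-monoˡ-≤ 9 (≤-trans (length-schedule xs single) xs≤n)) (*-monoˡ-≤ (2 + (110 + rowCost)) lengths)))))
    (≤-reflexive (cong (18 +_) (listCost≡ n)))
    where
    xs≤n : length xs ≤ n
    xs≤n = ≤-trans (≤-reflexive (sym (length-map proj₁ xs))) (length-unique (grown-unique g))
    lengths : totalLength (schedule xs single) ≤ Λ
    lengths = ≤-trans (m≤m+n _ (sum (λ v → potential (length (single v)))))
      (≤-trans (schedule-length g (initial-invariant all)) (≤-reflexive (sym (*-suc n ⌊log₂ n ⌋))))

  afterMerge : ∀ {xs} → Grown xs → (∀ v → v ∈ visited xs) → ∀ σ τ → var τ rOne ≡ 1 → var τ rZero ≡ 0 → var τ rN ≡ n →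
    Finished (schedule xs single) σ τ → Ensures printBest τ printBound Solved
  afterMerge {xs} g all σ τ one≡ zero≡ N≡ (best , _ , beats) =
    relax (+-monoʳ-≤ (1 + (n * 7 + 1)) (+-monoʳ-≤ 6 (+-monoˡ-≤ 1 (*-monoˡ-≤ 22 (length-unique (proj₂ (Best.good best)))))))
      (weaken finish (printBest-correct τ one≡ zero≡ N≡ (Best.chain best)))
    where
    s : List (Fin n)
    s = Best.picked best
    not-heavier : ∀ {l} → l ∈ schedule xs single → ∀ {t} → Spanned l t → total blue t ≡ total red t → weigh t ≤ weigh s
    not-heavier l∈ sp bal = s≤s⁻¹ (≤-trans (beats l∈ sp bal) (≤-reflexive (Best.weight best)))
    finish : ∀ τ′ → (∀ v → inp τ′ (toℕ v) ≡ bit (does (v ∈? s))) → Solved τ′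
    finish τ′ out = record
      { answer = s
      ; few = Counting.edges≤n G tree g all
      ; optimum = optimal (Best.good best) (Best.balanced best) (maximal g all {s} not-heavier)
      ; printed = λ v → trans (out v) (cong bit (sym (lookup∘tabulate (λ v → does (v ∈? s)) v))) }

  start-merging : ∀ {τ₁} → Initialised τ₁ → ∀ τ₂ → Frame growTree τ₁ τ₂ → (gt : GrownTree τ₂) →
    Running (GrownTree.order gt) single (evals countOps τ₂)
  start-merging {τ₁} init τ₂ fr gt = record
      { env = env ; layout = layout ; ordered = ordered-cong order refl refl ordered ; Cnt≡ = count
      ; unit = subst (λ f → Row (arr τ₂) f 0 []) (sym F≡′) unit
      ; best = subst₂ (Best (arr τ₂)) (sym F≡′) (sym best≡′) empty }
    where
    open Initialised init
    open GrownTree gt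
    env : Env (evals countOps τ₂)
    env = env-frame (frame-ops countOps) (env-frame fr (record
      { one≡ = one≡ ; zero≡ = zero≡ ; K≡ = K≡ ; O≡ = O≡ ; blue≡ = blue≡ ; red≡ = red≡ }))
    count : var τ₂ rCnt ∸ var τ₂ rOne ≡ length order ∸ 1
    count = cong₂ _∸_ Cnt≡ (trans (keep fr rOne tt) one≡)
    F≡′ : var τ₂ rF ≡ suc K
    F≡′ = trans (keep fr rF tt) F≡
    best≡′ : var τ₂ rBest ≡ O
    best≡′ = trans (keep fr rBest tt) best≡
    weights≡′ : ∀ i → arr τ₂ 8 i ≡ ((λ _ → 0) [ O ≔ 1 ]) i
    weights≡′ i = trans (cong (λ f → f i) (keepArr fr 8 tt)) (weights≡ i)
    nodes≡′ : ∀ i → arr τ₂ 10 i ≡ 0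
    nodes≡′ i = trans (cong (λ f → f i) (keepArr fr 10 tt)) (nodes i)
    unit : Row (arr τ₂) (suc K) 0 []
    unit = unit-row weights≡′ nodes≡′
    empty : Best (arr τ₂) (suc K) O
    empty = record
      { good = good-[] ; balanced = refl
      ; weight = trans (weights≡′ O) (≔-same (λ _ → 0) O)
      ; chain = [] (s≤s (m≤m+n O O)) (nodes≡′ O) ; best<f = s≤s (m≤m+n O O) }
    addr≡ : ∀ (v : Fin n) → arr τ₂ 3 (toℕ v) ≡ toℕ v
    addr≡ v = trans (cong (λ f → f (toℕ v)) (keepArr fr 3 tt)) (addr v)
    block : ∀ v → Block (arr τ₂) (arr τ₂ 3 (toℕ v)) (single v)
    block v = trans (cong (arr τ₂ 5) (addr≡ v)) (trans (cong (λ f → f (toℕ v)) (keepArr fr 5 tt)) (vertex v)) ,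
              trans (cong (λ f → f (arr τ₂ 3 (toℕ v))) (keepArr fr 6 tt)) (desc (arr τ₂ 3 (toℕ v))) , tt
    layout : Layout (visited order) single (evals countOps τ₂)
    layout = record
      { block = λ {v} _ → block-same {A = arr τ₂} {B = arr τ₂} {h = suc (arr τ₂ 3 (toℕ v) + 1)} (single v) (record { same₅ = λ _ → refl ; same₆ = λ _ → refl }) (n≤1+n _) (block v)
      ; len = λ {v} _ → trans (cong (λ f → f (toℕ v)) (keepArr fr 4 tt)) (len v)
      ; room = λ {v} _ → ≤-trans (≤-reflexive (trans (cong (_+ 1) (addr≡ v)) (+-comm (toℕ v) 1)))
          (≤-trans (toℕ<n v) (≤-reflexive (sym (trans (keep fr rH tt) H≡)))) }

  solve-correct : Ensures solve σ₀ ((3 + ((n * 62 + 1) + 20)) + (growBound + (3 + (mergeBound + printBound)))) Solved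
  solve-correct = ⨾-rule (framed afterInit initialise-correct)
    where
    first : Fin n
    first = fromℕ< 1≤n
    afterInit : ∀ τ₁ → Frame initialise σ₀ τ₁ → Initialised τ₁ →
      Ensures (growTree ⨾ ops countOps ⨾ mergeAll ⨾ printBest) τ₁ (growBound + (3 + (mergeBound + printBound))) Solved
    afterInit τ₁ _ init = ⨾-rule (framed afterGrow
        (growTree-correct (first , toℕ-fromℕ< 1≤n) τ₁ one≡ two≡ zero≡ N≡ M≡ inp≡ vis ord par))
      where
      open Initialised init
      afterGrow : ∀ τ₂ → Frame growTree τ₁ τ₂ → GrownTree τ₂ →
        Ensures (ops countOps ⨾ mergeAll ⨾ printBest) τ₂ (3 + (mergeBound + printBound)) Solved
      afterGrow τ₂ fr₂ gt = ops-then countOps 3 _ (⨾-rule (relax (mergeBound-correct grown spanning)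
          (framed (λ τ fr₃ → afterMerge grown spanning (evals countOps τ₂) τ
              (trans (keep fr₃ rOne tt) (trans (keep fr₂ rOne tt) one≡))
              (trans (keep fr₃ rZero tt) (trans (keep fr₂ rZero tt) zero≡))
              (trans (keep fr₃ rN tt) (trans (keep fr₂ rN tt) N≡)))
            (mergeAll-correct grown (initial-invariant spanning) (evals countOps τ₂) (start-merging init τ₂ fr₂ gt)))))
        where open GrownTree gt

-- Register k < 16 receives k plus the length of the input.
prologue : List Instr
prologue =
  const 16 0 ∷ load 17 16 ∷ const 16 1 ∷ load 18 16 ∷
  const 0 2 ∷ add 0 0 17 ∷ add 0 0 17 ∷ add 0 0 18 ∷ add 0 0 18 ∷
  concatMap (λ k → const 16 k ∷ add k 16 0 ∷ []) (applyUpTo suc 15)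

-- The compiled code starts at 39 because the prologue has 9 + 2 · 15 instructions.
program : Program
program = prologue ++ compile 39 solve

isStraight : Instr → Bool
isStraight (jump _)       = false
isStraight (jumpZero _ _) = false
isStraight _              = true

at-end : ∀ {A : Set} (l : List A) {k} → k ≡ length l → l at k ≡ nothing
at-end []      refl = refl
at-end (_ ∷ l) refl = at-end l refl

beyond : ∀ l {i} → length l ≤ i → fromMaybe 0 (l at i) ≡ 0
beyond []      {zero}  _        = refl
beyond []      {suc i} _        = refl
beyond (_ ∷ l) {suc i} (s≤s le) = beyond l le

module _ {n} (G : BicoloredGraph n) (tree : BicoloredGraph.IsTree G) where

  open BicoloredGraph G
  open Encoding G
  open Initialisation G hiding (W)
  open Execution (length word)
  open CostLogic (length word)
  open Solution G tree
  open FillCell (length word) blue red totalWeight using (rowCost≡)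
  open Optimality G tree

  straight-all : ∀ is → T (List.foldr (λ i b → isStraight i ∧ b) true is) → AllStraight is
  straight-all [] _ = []
  straight-all (const r k ∷ is) t = refl ∷ straight-all is t
  straight-all (add r s t′ ∷ is) t = refl ∷ straight-all is t
  straight-all (sub r s t′ ∷ is) t = refl ∷ straight-all is t
  straight-all (load r s ∷ is) t = refl ∷ straight-all is t
  straight-all (store r s ∷ is) t = refl ∷ straight-all is t

  offset : ℕ
  offset = 2 + n + n + length edges + length edges

  based : ∀ k → k + offset ≡ k + length word
  based k = cong (k +_) (sym length-word)

  prologue-implements : let s = execs prologue (initial word) in Implements (reg s) (mem s) σ₀
  prologue-implements = record
    { vars  = λ _ → refl
    ; bases = bases′
    ; inps  = λ _ _ → refl
    ; arrs  = λ a i → beyond word (base≤address (toℕ a) i)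
    }
    where
    bases′ : ∀ (a : Fin 16) → reg (execs prologue (initial word)) (toℕ a) ≡ toℕ a + length word
    bases′ Fin.zero = based 0
    bases′ (Fin.suc Fin.zero) = based 1
    bases′ (Fin.suc (Fin.suc Fin.zero)) = based 2
    bases′ (Fin.suc (Fin.suc (Fin.suc Fin.zero))) = based 3
    bases′ (Fin.suc (Fin.suc (Fin.suc (Fin.suc Fin.zero)))) = based 4
    bases′ (Fin.suc (Fin.suc (Fin.suc (Fin.suc (Fin.suc Fin.zero))))) = based 5
    bases′ (Fin.suc (Fin.suc (Fin.suc (Fin.suc (Fin.suc (Fin.suc Fin.zero)))))) = based 6
    bases′ (Fin.suc (Fin.suc (Fin.suc (Fin.suc (Fin.suc (Fin.suc (Fin.suc Fin.zero))))))) = based 7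
    bases′ (Fin.suc (Fin.suc (Fin.suc (Fin.suc (Fin.suc (Fin.suc (Fin.suc (Fin.suc Fin.zero)))))))) = based 8
    bases′ (Fin.suc (Fin.suc (Fin.suc (Fin.suc (Fin.suc (Fin.suc (Fin.suc (Fin.suc (Fin.suc Fin.zero))))))))) = based 9
    bases′ (Fin.suc (Fin.suc (Fin.suc (Fin.suc (Fin.suc (Fin.suc (Fin.suc (Fin.suc (Fin.suc (Fin.suc Fin.zero)))))))))) = based 10
    bases′ (Fin.suc (Fin.suc (Fin.suc (Fin.suc (Fin.suc (Fin.suc (Fin.suc (Fin.suc (Fin.suc (Fin.suc (Fin.suc Fin.zero))))))))))) = based 11
    bases′ (Fin.suc (Fin.suc (Fin.suc (Fin.suc (Fin.suc (Fin.suc (Fin.suc (Fin.suc (Fin.suc (Fin.suc (Fin.suc (Fin.suc Fin.zero)))))))))))) = based 12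
    bases′ (Fin.suc (Fin.suc (Fin.suc (Fin.suc (Fin.suc (Fin.suc (Fin.suc (Fin.suc (Fin.suc (Fin.suc (Fin.suc (Fin.suc (Fin.suc Fin.zero))))))))))))) = based 13
    bases′ (Fin.suc (Fin.suc (Fin.suc (Fin.suc (Fin.suc (Fin.suc (Fin.suc (Fin.suc (Fin.suc (Fin.suc (Fin.suc (Fin.suc (Fin.suc (Fin.suc Fin.zero)))))))))))))) = based 14
    bases′ (Fin.suc (Fin.suc (Fin.suc (Fin.suc (Fin.suc (Fin.suc (Fin.suc (Fin.suc (Fin.suc (Fin.suc (Fin.suc (Fin.suc (Fin.suc (Fin.suc (Fin.suc Fin.zero))))))))))))))) = based 15

  program-correct : ∃[ t ] ∃[ τ ] ∃[ H ] program ⊢ initial (encode G) ⇓[ t ] τ × Outputs τ H × IsOptimalWBCS H ×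
                    t ≤ 3000 * (n * suc ⌊log₂ n ⌋ * totalWeight)
  program-correct = after solve-correct
    where
    Result : Set
    Result = ∃[ t ] ∃[ τ ] ∃[ H ] program ⊢ initial (encode G) ⇓[ t ] τ × Outputs τ H × IsOptimalWBCS H ×
             t ≤ 3000 * (n * suc ⌊log₂ n ⌋ * totalWeight)
    budget : ℕ
    budget = (3 + ((n * 62 + 1) + 20)) + (growBound + (3 + (mergeBound + printBound)))
    placed-all : CodeAt program 0 (prologue ++ compile 39 solve)
    placed-all = code (sym (++-identityʳ program))
    start : State
    start = execs prologue (initial word)
    begun : Leads program (initial word) 39 start
    begun = straight program (straight-all prologue tt) (take-code program prologue placed-all)
    length-program : size solve + 39 ≡ length program
    length-program = trans (+-comm (size solve) 39)
      (sym (trans (length-++ prologue {compile 39 solve}) (cong (39 +_) (length-compile 39 solve))))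
    within : budget + 39 ≤ 3000 * (n * suc ⌊log₂ n ⌋ * totalWeight) → ∀ {t} → t ≤ budget → (39 + t) + 0 ≤ 3000 * (n * suc ⌊log₂ n ⌋ * totalWeight)
    within le t≤ = ≤-trans (≤-reflexive (+-identityʳ _)) (≤-trans (+-monoʳ-≤ 39 t≤) (≤-trans (≤-reflexive (+-comm 39 budget)) le))
    bounded : length edges ≤ n → budget + 39 ≤ 3000 * (n * suc ⌊log₂ n ⌋ * totalWeight)
    bounded few = ≤-trans (≤-reflexive (+-comm budget 39))
      (step-bound 1≤n n≤W few ≤-refl ≤-refl ≤-refl ≤-refl (≤-trans (≤-reflexive rowCost≡) (row-bound totalWeight (≤-trans 1≤n n≤W))))
    finish : ∀ {t τ} → t ≤ budget → Solved τ → Simulates program (size solve + 39) start τ t → Result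
    finish {t} {τ} t≤ solved (g , m , impl , ended) =
      (39 + t) + 0 , state (size solve + 39) g m , toSubset (Solved.answer solved) ,
      continue (leads-trans program {t = 39} begun ended) (halt (at-end program length-program)) ,
      (λ v → trans (Implements.inps impl (toℕ v) (<-≤-trans (toℕ<n v) n≤word)) (Solved.printed solved v)) ,
      Solved.optimum solved , within (bounded (Solved.few solved)) t≤
    after : Ensures solve σ₀ budget Solved → Result
    after (ensures run t≤ solved) = finish t≤ solved
      (simulate program run prologue-implements (skip-code program prologue placed-all))

theorem3 : ∃[ P ] ∃[ c₁ ] ∃[ c₂ ]
    ∀ (n : ℕ) (G : BicoloredGraph n) → let open BicoloredGraph G in
    IsTree →
    ∃[ t ] ∃[ τ ] ∃[ H ]
    P ⊢ initial (encode G) ⇓[ t ] τ ×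
    Outputs τ H ×
    IsOptimalWBCS H ×
    t ≤ c₁ * (n * totalWeight ^ 2) ×
    t ^ 200 ≤ (c₂ * totalWeight) ^ 200 * n ^ 317
-- 3000 comes from `step-bound` and 6000 is its double, as in `square-bound`. The exponent obtained
-- is 300/200, and 300 ≤ 317.
theorem3 = program , 3000 , 6000 , λ n G tree → bounds G tree 3000 6000 200 317 refl refl (≤ᵇ⇒≤ 300 317 tt) (program-correct G tree)
  where
  -- As in `log-bound`, the constants enter as variables together with equations, so that the powers
  -- are not unfolded.
  bounds : ∀ {n} (G : BicoloredGraph n) (tree : BicoloredGraph.IsTree G) C c d d′ → c ≡ 2 * C → d ≡ 2 * 100 → 300 ≤ d′ →
    let open BicoloredGraph G in
    (∃[ t ] ∃[ τ ] ∃[ H ] program ⊢ initial (encode G) ⇓[ t ] τ × Outputs τ H × IsOptimalWBCS H ×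
      t ≤ C * (n * suc ⌊log₂ n ⌋ * totalWeight)) →
    ∃[ t ] ∃[ τ ] ∃[ H ] program ⊢ initial (encode G) ⇓[ t ] τ × Outputs τ H × IsOptimalWBCS H ×
      t ≤ C * (n * totalWeight ^ 2) × t ^ d ≤ (c * totalWeight) ^ d * n ^ d′
  bounds G tree C c d d′ c≡ d≡ 300≤ (t , τ , H , run , out , opt , t≤) =
    t , τ , H , run , out , opt , cubic-bound C 1≤n n≤W t≤ , log-bound C 1≤n n≤W t≤ 100 c≡ d≡ 300≤
    where open Solution G tree using (1≤n; n≤W)
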